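{- Let $\delta\in(0,1/2]$ and $\varepsilon>0$. Consider a UFL instance with general opening costs, let $S'$ be the solution returned by \texttt{LocalSearch-JMS} (with parameter $\varepsilon$), and let $\mathrm{OPT}$ be any feasible solution; write $d'=d(S')$ and $\mathrm{opt}=d(\mathrm{OPT})$. Call $f'\in S'$ and $f^*\in\mathrm{OPT}$ matched if $f'$ $(1-\delta)$-captures $f^*$ and $f^*$ $(1/2)$-captures $f'$; other facilities are lonely. Then $$o(S')+d'\le o(\mathrm{OPT})+\frac{\delta}{1-\delta}d'+\frac{1}{1-\delta}\mathrm{opt}^{M}+4\,\mathrm{opt}^{L}+O\big(\varepsilon(d'+\mathrm{opt})\big).$$
   Context: UFL instance: clients $C$, facilities $F$, metric $dist$, opening costs $o:F\to\mathbb{R}_{\ge0}$; for nonempty $S\subseteq F$, $o(S)=\sum_{f\in S}o(f)$, $d(S)=\sum_{j\in C}\min_{f\in S}dist(j,f)$, $\mathrm{cost}(S)=o(S)+d(S)$. Each client is served by a closest facility of the solution; $C_S(f)$ is the set of clients served by $f$ in $S$. For $\alpha\ge1/2$, $f\in S$ $\alpha$-captures $f''\in S''$ if $|C_S(f)\cap C_{S''}(f'')|>\alpha|C_{S''}(f'')|$. $\mathrm{opt}^M$ (resp. $\mathrm{opt}^L$) is the connection cost in $\mathrm{OPT}$ of the clients served by matched (resp. lonely) facilities of $\mathrm{OPT}$. JMS algorithm: maintain active clients $A$ (initially $C$), open facilities $S$ (initially $\emptyset$), values $\alpha_j$ (initially $0$), and for each inactive client $j$ a facility $S(j)$. Each client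 $j$ offers to each closed facility $f$ the amount $\max\{0,\alpha_j-dist(j,f)\}$ if $j$ is active and $\max\{0,dist(j,S(j))-dist(j,f)\}$ otherwise. Raise all $\alpha_j$ of active clients uniformly until: if $\alpha_j=dist(j,f)$ for an active $j$ and an open $f$, $j$ becomes inactive with $S(j)=f$; if the offers to a closed $f$ reach $o(f)$, open $f$ and set $S(j)=f$ (making $j$ inactive) for every client making a strictly positive offer to $f$. Stop when no client is active and output $S$. \texttt{Extend-JMS}$(X)$: run JMS on the instance in which the opening costs of the facilities in $X$ are set to $0$ (others unchanged) and return its output. \texttt{LocalSearch-JMS} with parameter $\varepsilon$: start with $S'$ = output of JMS; while there is $S''$ with $\mathrm{cost}(S'')<\mathrm{cost}(S')$ (original costs) such that either $|S''\setminus S'|+|S'\setminus S''|\le 1/\varepsilon+1$, or $S''=$\texttt{Extend-JMS}$(S'\setminus\{f\}\cup\{f'\})$ for some $f\in S'$, $f'\notin S'$, set $S'\leftarrow S''$; return $S'$.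
   Formalization: Distances, opening costs, δ and ε are taken to be rational rather than real numbers. -}

module Defs where

open import Data.Nat as ℕ using (ℕ; zero; suc)
open import Data.Integer using (+_)
open import Data.Rational using (ℚ; 0ℚ; 1ℚ; _+_; _*_; _-_; _÷_; _⊓_; _⊔_; _≤_; _<_; _≤ᵇ_; _/_; ≢-nonZero)
open import Data.Rational.Properties using (_≟_; _<?_)
open import Data.Bool using (Bool; true; false; if_then_else_; not; _∧_)
import Data.Bool.ListAction
open import Data.Maybe using (Maybe; just; nothing; is-nothing)
open import Data.List using (List; []; _∷_; foldr; map; filter; length; _++_; concatMap)
open import Data.Fin using (Fin)
import Data.Fin as Fin
open import Data.Fin.Subset using (Subset; _∈_; _∉_; _─_; _∪_; ⁅_⁆; ∣_∣; Nonempty) renaming (_-_ to _∖_)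
open import Data.Vec using (lookup)
open import Data.Sum using (_⊎_; inj₁; inj₂)
open import Data.Product using (_×_; Σ; ∃; _,_)
open import Relation.Nullary using (Dec; yes; no; ¬_)
open import Relation.Nullary.Decidable using (⌊_⌋; _×-dec_)
open import Relation.Binary.PropositionalEquality using (_≡_)
import Data.Fin.Properties as FinP

ℕ→ℚ : ℕ → ℚ
ℕ→ℚ n = + n / 1

-- total division (equals _÷_ whenever the divisor is nonzero; 0 otherwise)
divQ : ℚ → ℚ → ℚ
divQ p q with q ≟ 0ℚ
... | yes _ = 0ℚ
... | no q≢0 = _÷_ p q {{≢-nonZero q≢0}}

sumQ : List ℚ → ℚ
sumQ = foldr _+_ 0ℚ

minL : ℚ → List ℚ → ℚ
minL d [] = d
minL _ (x ∷ xs) = foldr _⊓_ x xs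

_<ᵇ_ : ℚ → ℚ → Bool
p <ᵇ q = not (q ≤ᵇ p)

countWhere : {A : Set} → (A → Bool) → List A → ℕ
countWhere p [] = 0
countWhere p (x ∷ xs) = if p x then suc (countWhere p xs) else countWhere p xs

firstWhere : {n : ℕ} → (Fin n → Bool) → Maybe (Fin n)
firstWhere {n} p = go (Data.List.allFin n)
  where
  go : List (Fin n) → Maybe (Fin n)
  go [] = nothing
  go (x ∷ xs) = if p x then just x else go xs

members : {n : ℕ} → Subset n → List (Fin n)
members {n} S = filter (λ f → lookup S f Data.Bool.≟ true) (Data.List.allFin n)
  where import Data.Bool

-- UFL instances: clients Fin nC, facilities Fin nF, a (pseudo)metric on
-- the disjoint union of clients and facilities, opening costs.

Point : ℕ → ℕ → Set
Point nC nF = Fin nC ⊎ Fin nF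

record IsMetric {A : Set} (dist : A → A → ℚ) : Set where
  field
    nonneg   : ∀ x y → 0ℚ ≤ dist x y
    self     : ∀ x → dist x x ≡ 0ℚ
    symm     : ∀ x y → dist x y ≡ dist y x
    triangle : ∀ x y z → dist x z ≤ dist x y + dist y z

cdist : {nC nF : ℕ} → (Point nC nF → Point nC nF → ℚ) → Fin nC → Fin nF → ℚ
cdist dist j f = dist (inj₁ j) (inj₂ f)

module UFL {nC nF : ℕ} (cd : Fin nC → Fin nF → ℚ) (o : Fin nF → ℚ) where

  clients : List (Fin nC)
  clients = Data.List.allFin nC

  openCost : Subset nF → ℚ
  openCost S = sumQ (map o (members S))

  distTo : Subset nF → Fin nC → ℚ
  distTo S j = minL 0ℚ (map (cd j) (members S))

  connCost : Subset nF → ℚ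
  connCost S = sumQ (map (distTo S) clients)

  cost : Subset nF → ℚ
  cost S = openCost S + connCost S

  Closest : Subset nF → (Fin nC → Fin nF) → Set
  Closest S σ = ∀ j → σ j ∈ S × (∀ f → f ∈ S → cd j (σ j) ≤ cd j f)

  servedCount : (Fin nC → Fin nF) → Fin nF → ℕ
  servedCount σ f = countWhere (λ j → ⌊ σ j Fin.≟ f ⌋) clients

  commonCount : (Fin nC → Fin nF) → Fin nF → (Fin nC → Fin nF) → Fin nF → ℕ
  commonCount σ f σ'' f'' = countWhere (λ j → ⌊ σ j Fin.≟ f ⌋ ∧ ⌊ σ'' j Fin.≟ f'' ⌋) clients

  Captures : ℚ → (Fin nC → Fin nF) → Fin nF → (Fin nC → Fin nF) → Fin nF → Set
  Captures α σ f σ'' f'' = α * ℕ→ℚ (servedCount σ'' f'') < ℕ→ℚ (commonCount σ f σ'' f'')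

  captures? : ∀ α σ f σ'' f'' → Dec (Captures α σ f σ'' f'')
  captures? α σ f σ'' f'' = (α * ℕ→ℚ (servedCount σ'' f'')) <? ℕ→ℚ (commonCount σ f σ'' f'')

  Matched : ℚ → (Fin nC → Fin nF) → (Fin nC → Fin nF) → Fin nF → Fin nF → Set
  Matched δ σ' σ* f' f* = Captures (1ℚ - δ) σ' f' σ* f* × Captures (+ 1 / 2) σ* f* σ' f'

  MatchedOpt : ℚ → (Fin nC → Fin nF) → (Fin nC → Fin nF) → Fin nF → Set
  MatchedOpt δ σ' σ* f* = ∃ λ f' → Matched δ σ' σ* f' f*

  matchedOpt? : ∀ δ σ' σ* f* → Dec (MatchedOpt δ σ' σ* f*)
  matchedOpt? δ σ' σ* f* =
    FinP.any? (λ f' → captures? (1ℚ - δ) σ' f' σ* f* ×-dec captures? (+ 1 / 2) σ* f* σ' f')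

  optM : ℚ → (Fin nC → Fin nF) → (Fin nC → Fin nF) → ℚ
  optM δ σ' σ* = sumQ (map (λ j → if ⌊ matchedOpt? δ σ' σ* (σ* j) ⌋ then cd j (σ* j) else 0ℚ) clients)

  optL : ℚ → (Fin nC → Fin nF) → (Fin nC → Fin nF) → ℚ
  optL δ σ' σ* = sumQ (map (λ j → if ⌊ matchedOpt? δ σ' σ* (σ* j) ⌋ then 0ℚ else cd j (σ* j)) clients)

-- The JMS algorithm (exact event simulation over ℚ).
-- State: current value t of the α's of active clients, for every client
-- either nothing (active) or just S(j) (inactive), and the open facilities.

module JMS {nC nF : ℕ} (cd : Fin nC → Fin nF → ℚ) (o : Fin nF → ℚ) where

  record State : Set where
    constructor st
    field
      t   : ℚ
      asg : Fin nC → Maybe (Fin nF)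
      opn : Subset nF
  open State public

  clients : List (Fin nC)
  clients = Data.List.allFin nC

  facilities : List (Fin nF)
  facilities = Data.List.allFin nF

  isOpen : State → Fin nF → Bool
  isOpen s f = lookup (opn s) f

  isActive : State → Fin nC → Bool
  isActive s j = is-nothing (asg s j)

  offer : State → Fin nC → Fin nF → ℚ
  offer s j f with asg s j
  ... | nothing = 0ℚ ⊔ (t s - cd j f)
  ... | just g  = 0ℚ ⊔ (cd j g - cd j f)

  totalOffer : State → Fin nF → ℚ
  totalOffer s f = sumQ (map (λ j → offer s j f) clients)

  -- offers of inactive clients only (constant in time)
  inactiveOffer : State → Fin nF → ℚ
  inactiveOffer s f = sumQ (map (λ j → if isActive s j then 0ℚ else offer s j f) clients)

  activeClients : State → List (Fin nC)
  activeClients s = filter (λ j → is-nothing (asg s j) Data.Bool.≟ true) clients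
    where import Data.Bool

  -- time at which the offers to the closed facility f reach o(f), when the
  -- active clients j with dist(j,f) ≤ dist(j0,f) are those paying
  openTimeCand : State → Fin nF → Fin nC → ℚ
  openTimeCand s f j0 =
    let J = filter (λ j → cd j f Data.Rational.Properties.≤? cd j0 f) (activeClients s)
    in divQ (o f - inactiveOffer s f + sumQ (map (λ j → cd j f) J)) (ℕ→ℚ (length J))
    where import Data.Rational.Properties

  candidates : State → List ℚ
  candidates s =
    concatMap (λ j → concatMap (λ f → if isOpen s f then cd j f ∷ [] else []) facilities) (activeClients s)
    ++ concatMap (λ f → if isOpen s f then [] else map (openTimeCand s f) (activeClients s)) facilities

  data Result : Set where
    done : Subset nF → Result
    next : State → Result

  update : {A : Set} → (Fin nC → A) → Fin nC → A → Fin nC → A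
  update g j a j' = if ⌊ j' Fin.≟ j ⌋ then a else g j'

  -- one step: (1) an active client reaches an open facility;
  -- (2) otherwise a closed facility whose offers reach its cost opens;
  -- (3) otherwise stop if no client is active; (4) otherwise advance time
  -- to the next event.
  step : State → Result
  step s with firstWhere (λ j → isActive s j ∧ Data.Bool.ListAction.any (λ f → isOpen s f ∧ (cd j f ≤ᵇ t s)) facilities)
  ... | just j with firstWhere (λ f → isOpen s f ∧ (cd j f ≤ᵇ t s))
  ...   | just f  = next (st (t s) (update (asg s) j (just f)) (opn s))
  ...   | nothing = done (opn s)
  step s | nothing with firstWhere (λ f → not (isOpen s f) ∧ (o f ≤ᵇ totalOffer s f))
  ... | just f = next (st (t s)
                          (λ j → if 0ℚ <ᵇ offer s j f then just f else asg s j)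
                          (Data.Vec.updateAt (opn s) f (λ _ → true)))
    where import Data.Vec
  ... | nothing with activeClients s
  ...   | [] = done (opn s)
  ...   | _ ∷ _ = next (st (minL (t s) (candidates s)) (asg s) (opn s))

  run : ℕ → State → Subset nF
  run zero s = opn s
  run (suc k) s with step s
  ... | done S = S
  ... | next s' = run k s'

  initial : State
  initial = st 0ℚ (λ _ → nothing) (Data.Fin.Subset.⊥)
    where import Data.Fin.Subset

  -- at most nC + nF events, each preceded by at most one time advance
  output : Subset nF
  output = run (3 ℕ.* (nC ℕ.+ nF) ℕ.+ 3) initial

jms : {nC nF : ℕ} → (Fin nC → Fin nF → ℚ) → (Fin nF → ℚ) → Subset nF
jms cd o = JMS.output cd o

extendJMS : {nC nF : ℕ} → (Fin nC → Fin nF → ℚ) → (Fin nF → ℚ) → Subset nF → Subset nF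
extendJMS cd o X = jms cd (λ f → if lookup X f then 0ℚ else o f)

module LocalSearch {nC nF : ℕ} (cd : Fin nC → Fin nF → ℚ) (o : Fin nF → ℚ) (ε : ℚ) where
  open UFL cd o

  data Move (S S'' : Subset nF) : Set where
    small : Nonempty S'' → cost S'' < cost S →
            ℕ→ℚ (∣ S'' ─ S ∣ ℕ.+ ∣ S ─ S'' ∣) ≤ divQ 1ℚ ε + 1ℚ → Move S S''
    extend : (f f' : Fin nF) → f ∈ S → f' ∉ S →
             S'' ≡ extendJMS cd o ((S ∖ f) ∪ ⁅ f' ⁆) → cost S'' < cost S → Move S S''

  data Reachable : Subset nF → Set where
    start : Reachable (jms cd o)
    move  : ∀ {S S''} → Reachable S → Move S S'' → Reachable S''

  Returned : Subset nF → Set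
  Returned S = Reachable S × (∀ S'' → ¬ Move S S'')

{-# OPTIONS --safe #-}

-- Single additions, single deletions and Extend-JMS moves already give the bound with c = 0.
--
-- JMS produces duals α with cost ≤ Σ α, with α j ≤ o f + dist(j,f), and with
-- Σ_{j∈D} α j ≤ o f + 2 Σ_{j∈D} dist(j,f) for every facility f and set of clients D. The last bound
-- follows by averaging, over the times at which the clients of D become inactive, the fact that the
-- offers to f never exceed o f.
--
-- Let f ∈ S' and let P be the set of facilities of OPT that f ½-captures. Closing f while opening
-- one h' ∈ P (the mate of f, if it has one) and applying Extend-JMS gives a solution whose cost is
-- bounded through the duals: the facilities of P other than h' are paid at the price of a factor 2
-- on their clients, and every other client of f is rerouted to a facility of S'. Each facility
-- of OPT is captured at most once and the uncaptured ones can be added alone, so that local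
-- optimality, summed over all moves, bounds o(S') by o(OPT) plus a charge for every client.
--
-- The clients of a lonely h are rerouted to the two facilities of S' closest to h, which costs
-- 2 opt in total since at most half of them are at the closest one; with the factor 2 this is 4 opt.
-- The clients of a matched h outside its mate are rerouted to the mate, and their detours are
-- charged to the clients in common, who outnumber them by (1-δ)/δ.
module Submission where

open import Defs
open import Data.Bool using (Bool; true; false; if_then_else_; not; _∧_; T)
import Data.Bool as Bool
import Data.Bool.ListAction as BoolList
open import Data.Empty using (⊥; ⊥-elim)
open import Data.Fin using (Fin)
import Data.Fin as Fin
open import Data.Fin.Subset using (Subset; _∈_; _∉_; _∪_; ⁅_⁆; Nonempty; _─_; ∣_∣) renaming (_-_ to _∖_)
import Data.Fin.Subset.Properties as SubsetP
import Data.Integer as ℤ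
import Data.Integer.Properties as ℤP
open import Data.List using (List; []; _∷_; foldr; map; filter; length; allFin; concatMap; _++_)
open import Data.List.Membership.Propositional using (find; lose) renaming (_∈_ to _∈ˡ_)
open import Data.List.Membership.Propositional.Properties
open import Data.List.Properties using (map-tabulate; length-tabulate)
open import Data.List.Relation.Unary.Any using (here; there)
open import Data.Maybe using (Maybe; just; nothing; maybe′; is-nothing)
open import Data.Nat as ℕ using (ℕ; zero; suc)
import Data.Nat.Properties as ℕP
open import Data.Product using (_×_; Σ; ∃; _,_; proj₁; proj₂)
open import Data.Rational using (ℚ; 0ℚ; 1ℚ; ½; _+_; _*_; _-_; -_; _⊓_; _⊔_; _≤_; _<_; _≤ᵇ_; _/_; 1/_; positive; nonNegative; toℚᵘ; ≢-nonZero; NonZero)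
open import Data.Rational.Properties
import Data.Rational.Unnormalised as ℚᵘ
import Data.Rational.Unnormalised.Properties as ℚᵘP
open import Data.Sum using (_⊎_; inj₁; inj₂; [_,_]′)
open import Data.Unit using (tt)
import Data.Vec as Vec
open import Data.Vec using (lookup; updateAt)
open import Data.Vec.Properties using ([]=⇒lookup; lookup⇒[]=; lookup∘updateAt; lookup∘updateAt′; lookup-replicate)
open import Function using (_∘_; id)
open import Level using (0ℓ)
open import Relation.Binary.PropositionalEquality
open import Relation.Nullary using (Dec; yes; no; ¬_)
open import Relation.Nullary.Decidable using (⌊_⌋; dec⇒maybe; toWitness; decidable-stable)
open import Relation.Unary using (Pred; Decidable)
open import Tactic.RingSolver using (solve)
open import Tactic.RingSolver.Core.AlmostCommutativeRing using (AlmostCommutativeRing; fromCommutativeRing)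

-- As ε may be large, 1/ε + 1 guarantees no small move beyond one addition or one deletion. Even the
-- exchange of f for a single facility therefore goes through Extend-JMS, which makes one new
-- facility free although f may capture many. The others are paid through the duals, whose bound has
-- coefficient 1 at o(h), as the claim requires, but coefficient 2 at the distances. A matched
-- facility cannot bear that 2, since its share of opt may only be multiplied by 1/(1-δ). It need
-- not: a matched facility ½-captures its mate in return, so that each f captures at most one
-- matched facility, and this one is made free. The remaining obstacle is that S' and OPT may
-- overlap. Extend-JMS asks for a facility outside S' and a deletion must leave something open,
-- which dictates the case distinction on how f is closed. Each move closes at most one facility and
-- captured facilities are never grouped into swaps of bounded size, so nothing is lost in ε. With κ
-- = δ/(1-δ) one has 1/(1-δ) = 1 + κ, and both constants of the matched part come from charging κ
-- times a detour to each common client.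

ℚ-ring : AlmostCommutativeRing 0ℓ 0ℓ
ℚ-ring = fromCommutativeRing +-*-commutativeRing (λ x → dec⇒maybe (0ℚ ≟ x))

-- Linear arithmetic: the second argument is left to the ring solver.
≤-by-difference : ∀ {a b A B} → a ≤ b → B - A ≡ b - a → A ≤ B
≤-by-difference {a} {b} {A} {B} a≤b eq = begin
  A               ≡⟨ solve (A ∷ a ∷ []) ℚ-ring ⟩
  a + (A - a)     ≤⟨ +-monoˡ-≤ (A - a) a≤b ⟩
  b + (A - a)     ≡⟨ solve (A ∷ a ∷ b ∷ []) ℚ-ring ⟩
  (b - a) + A     ≡⟨ cong (_+ A) (sym eq) ⟩
  (B - A) + A     ≡⟨ solve (A ∷ B ∷ []) ℚ-ring ⟩
  B               ∎
  where open ≤-Reasoning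

+-interchange : ∀ a b c d → (a + b) + (c + d) ≡ (a + c) + (b + d)
+-interchange a b c d = solve (a ∷ b ∷ c ∷ d ∷ []) ℚ-ring

-- Passing to unnormalised rationals avoids the reduction to lowest terms hidden in `_/_`.
ℕ→ℚ-suc : ∀ n → ℕ→ℚ (suc n) ≡ 1ℚ + ℕ→ℚ n
ℕ→ℚ-suc n = toℚᵘ-injective (begin
  toℚᵘ (ℕ→ℚ (suc n))                  ≈⟨ toℚᵘ-homo-/ (suc n) ⟩
  (ℤ.+ suc n) ℚᵘ./ 1                     ≈⟨ ℚᵘ.*≡* (cong (λ z → (ℤ.+ 1 ℤ.+ z) ℤ.* ℤ.+ 1) (sym (ℤP.*-identityʳ (ℤ.+ n)))) ⟩
  ℚᵘ.1ℚᵘ ℚᵘ.+ ((ℤ.+ n) ℚᵘ./ 1)           ≈⟨ ℚᵘP.+-congʳ ℚᵘ.1ℚᵘ (ℚᵘP.≃-sym (toℚᵘ-homo-/ n)) ⟩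
  toℚᵘ 1ℚ ℚᵘ.+ toℚᵘ (ℕ→ℚ n)            ≈⟨ ℚᵘP.≃-sym (toℚᵘ-homo-+ 1ℚ (ℕ→ℚ n)) ⟩
  toℚᵘ (1ℚ + ℕ→ℚ n)                   ∎)
  where
  open ℚᵘP.≃-Reasoning
  toℚᵘ-homo-/ : ∀ k → toℚᵘ (ℕ→ℚ k) ℚᵘ.≃ ((ℤ.+ k) ℚᵘ./ 1)
  toℚᵘ-homo-/ k = toℚᵘ-fromℚᵘ ((ℤ.+ k) ℚᵘ./ 1)

-- Sums

when : Bool → ℚ → ℚ
when b x = if b then x else 0ℚ

when-mono : ∀ b {x y} → (b ≡ true → x ≤ y) → when b x ≤ when b y
when-mono true  h = h refl
when-mono false h = ≤-refl

when-+ : ∀ b x y → when b (x + y) ≡ when b x + when b y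
when-+ true  x y = refl
when-+ false x y = refl

when-0 : ∀ b → when b 0ℚ ≡ 0ℚ
when-0 true  = refl
when-0 false = refl

when-* : ∀ b x → when b x ≡ when b 1ℚ * x
when-* true  x = sym (*-identityˡ x)
when-* false x = sym (*-zeroˡ x)

when-nonneg : ∀ b {x} → 0ℚ ≤ x → 0ℚ ≤ when b x
when-nonneg true  h = h
when-nonneg false h = ≤-refl

when-≤ : ∀ b {x} → 0ℚ ≤ x → when b x ≤ x
when-≤ true  h = ≤-refl
when-≤ false h = h

when-swap : ∀ b c x → when b (when c x) ≡ when c (when b x)
when-swap true  c x = refl
when-swap false c x = sym (when-0 c)

sumQ-0 : ∀ {A : Set} (xs : List A) → sumQ (map (λ _ → 0ℚ) xs) ≡ 0ℚ
sumQ-0 []       = refl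
sumQ-0 (x ∷ xs) = trans (+-identityˡ _) (sumQ-0 xs)

module _ {A : Set} where

  sumQ-mono : ∀ {f g : A → ℚ} → (∀ x → f x ≤ g x) → ∀ xs → sumQ (map f xs) ≤ sumQ (map g xs)
  sumQ-mono h []       = ≤-refl
  sumQ-mono h (x ∷ xs) = +-mono-≤ (h x) (sumQ-mono h xs)

  sumQ-cong : ∀ {f g : A → ℚ} → (∀ x → f x ≡ g x) → ∀ xs → sumQ (map f xs) ≡ sumQ (map g xs)
  sumQ-cong h []       = refl
  sumQ-cong h (x ∷ xs) = cong₂ _+_ (h x) (sumQ-cong h xs)

  sumQ-+ : ∀ (f g : A → ℚ) xs → sumQ (map (λ x → f x + g x) xs) ≡ sumQ (map f xs) + sumQ (map g xs)
  sumQ-+ f g []       = refl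
  sumQ-+ f g (x ∷ xs) = trans (cong ((f x + g x) +_) (sumQ-+ f g xs))
                              (+-interchange (f x) (g x) (sumQ (map f xs)) (sumQ (map g xs)))

  sumQ-* : ∀ c (f : A → ℚ) xs → sumQ (map (λ x → c * f x) xs) ≡ c * sumQ (map f xs)
  sumQ-* c f []       = sym (*-zeroʳ c)
  sumQ-* c f (x ∷ xs) = trans (cong (c * f x +_) (sumQ-* c f xs)) (sym (*-distribˡ-+ c (f x) (sumQ (map f xs))))

  sumQ-swap : ∀ {B : Set} (F : A → B → ℚ) xs ys →
    sumQ (map (λ x → sumQ (map (F x) ys)) xs) ≡ sumQ (map (λ y → sumQ (map (λ x → F x y) xs)) ys)
  sumQ-swap F []       ys = sym (sumQ-0 ys)
  sumQ-swap F (x ∷ xs) ys = trans (cong (sumQ (map (F x) ys) +_) (sumQ-swap F xs ys)) (sym (split ys))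
    where
    split : ∀ ys → sumQ (map (λ y → F x y + sumQ (map (λ x′ → F x′ y) xs)) ys)
                   ≡ sumQ (map (F x) ys) + sumQ (map (λ y → sumQ (map (λ x′ → F x′ y) xs)) ys)
    split []       = refl
    split (y ∷ ys) = trans (cong ((F x y + _) +_) (split ys)) (+-interchange (F x y) _ _ _)

  sumQ-filter : ∀ {P : Pred A 0ℓ} (P? : Decidable P) (f : A → ℚ) xs →
    sumQ (map f (filter P? xs)) ≡ sumQ (map (λ x → when ⌊ P? x ⌋ (f x)) xs)
  sumQ-filter P? f [] = refl
  sumQ-filter P? f (x ∷ xs) with P? x
  ... | yes _ = cong (f x +_) (sumQ-filter P? f xs)
  ... | no _  = trans (sumQ-filter P? f xs) (sym (+-identityˡ _))

  sumQ-const : ∀ c (xs : List A) → sumQ (map (λ _ → c) xs) ≡ ℕ→ℚ (length xs) * c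
  sumQ-const c []       = sym (*-zeroˡ c)
  sumQ-const c (x ∷ xs) = trans (cong (c +_) (sumQ-const c xs))
    (trans (distrib c (ℕ→ℚ (length xs))) (cong (_* c) (sym (ℕ→ℚ-suc (length xs)))))
    where
    distrib : ∀ c k → c + k * c ≡ (1ℚ + k) * c
    distrib c k = solve (c ∷ k ∷ []) ℚ-ring

  countWhere-sum : ∀ (p : A → Bool) xs → ℕ→ℚ (countWhere p xs) ≡ sumQ (map (λ x → when (p x) 1ℚ) xs)
  countWhere-sum p [] = refl
  countWhere-sum p (x ∷ xs) with p x
  ... | true  = trans (ℕ→ℚ-suc (countWhere p xs)) (cong (λ z → 1ℚ + z) (countWhere-sum p xs))
  ... | false = trans (countWhere-sum p xs) (sym (+-identityˡ _))

∑ : ∀ {n} → (Fin n → ℚ) → ℚ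
∑ {n} f = sumQ (map f (allFin n))

∑-mono : ∀ {n} {f g : Fin n → ℚ} → (∀ x → f x ≤ g x) → ∑ f ≤ ∑ g
∑-mono {n} h = sumQ-mono h (allFin n)

∑-cong : ∀ {n} {f g : Fin n → ℚ} → (∀ x → f x ≡ g x) → ∑ f ≡ ∑ g
∑-cong {n} h = sumQ-cong h (allFin n)

∑-+ : ∀ {n} (f g : Fin n → ℚ) → ∑ (λ x → f x + g x) ≡ ∑ f + ∑ g
∑-+ {n} f g = sumQ-+ f g (allFin n)

∑-* : ∀ {n} c (f : Fin n → ℚ) → ∑ (λ x → c * f x) ≡ c * ∑ f
∑-* {n} c f = sumQ-* c f (allFin n)

∑-0 : ∀ n → ∑ {n} (λ _ → 0ℚ) ≡ 0ℚ
∑-0 n = sumQ-0 (allFin n)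

∑-nonneg : ∀ {n} {f : Fin n → ℚ} → (∀ x → 0ℚ ≤ f x) → 0ℚ ≤ ∑ f
∑-nonneg {n} {f} h = subst (_≤ ∑ f) (∑-0 n) (∑-mono h)

∑-swap : ∀ {m n} (F : Fin m → Fin n → ℚ) → ∑ (λ x → ∑ (F x)) ≡ ∑ (λ y → ∑ (λ x → F x y))
∑-swap {m} {n} F = sumQ-swap F (allFin m) (allFin n)

∑-neg : ∀ {n} (f : Fin n → ℚ) → ∑ (λ x → - f x) ≡ - ∑ f
∑-neg f = trans (∑-cong (λ x → minus-one (f x))) (trans (∑-* (- 1ℚ) f) (sym (minus-one (∑ f))))
  where
  minus-one : ∀ x → - x ≡ (- 1ℚ) * x
  minus-one x = solve (x ∷ []) ℚ-ring

∑-- : ∀ {n} (f g : Fin n → ℚ) → ∑ (λ x → f x - g x) ≡ ∑ f - ∑ g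
∑-- f g = trans (∑-+ f (λ x → - g x)) (cong (∑ f +_) (∑-neg g))

∑-suc : ∀ {n} (f : Fin (suc n) → ℚ) → ∑ f ≡ f Fin.zero + ∑ (f ∘ Fin.suc)
∑-suc {n} f = cong (λ xs → f Fin.zero + sumQ xs)
  (trans (map-tabulate Fin.suc f) (sym (map-tabulate id (f ∘ Fin.suc))))

∑-point : ∀ {n} (a : Fin n) (f : Fin n → ℚ) → ∑ (λ i → when ⌊ a Fin.≟ i ⌋ (f i)) ≡ f a
∑-point {suc n} Fin.zero f = trans (∑-suc {n} (λ i → when ⌊ Fin.zero Fin.≟ i ⌋ (f i)))
  (trans (cong (f Fin.zero +_) (∑-0 n)) (+-identityʳ _))
∑-point {suc n} (Fin.suc a) f = trans (∑-suc {n} (λ i → when ⌊ Fin.suc a Fin.≟ i ⌋ (f i)))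
  (trans (+-identityˡ _) (trans (∑-cong shift) (∑-point a (f ∘ Fin.suc))))
  where
  shift : ∀ i → when ⌊ Fin.suc a Fin.≟ Fin.suc i ⌋ (f (Fin.suc i)) ≡ when ⌊ a Fin.≟ i ⌋ (f (Fin.suc i))
  shift i with a Fin.≟ i
  ... | yes _ = refl
  ... | no _  = refl

∑-fibres : ∀ {m n} (σ : Fin m → Fin n) (f : Fin m → ℚ) →
  ∑ f ≡ ∑ (λ o → ∑ (λ j → when ⌊ σ j Fin.≟ o ⌋ (f j)))
∑-fibres {m} {n} σ f = trans (∑-cong {m} (λ j → sym (∑-point (σ j) (λ _ → f j))))
  (∑-swap {m} {n} (λ j o → when ⌊ σ j Fin.≟ o ⌋ (f j)))

when-∑ : ∀ {n} b (f : Fin n → ℚ) → when b (∑ f) ≡ ∑ (λ x → when b (f x))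
when-∑     true  f = refl
when-∑ {n} false f = sym (∑-0 n)

1≤∑ : ∀ {n} (D : Fin n → Bool) {i} → D i ≡ true → 1ℚ ≤ ∑ (λ j → when (D j) 1ℚ)
1≤∑ D {i₀} Di₀ = ≤-trans (≤-reflexive (sym (∑-point i₀ (λ _ → 1ℚ)))) (∑-mono term)
  where
  term : ∀ i → when ⌊ i₀ Fin.≟ i ⌋ 1ℚ ≤ when (D i) 1ℚ
  term i with i₀ Fin.≟ i
  ... | yes refl rewrite Di₀ = ≤-refl
  ... | no _ = when-nonneg (D i) (nonNegative⁻¹ 1ℚ)

⌊⌋-true : ∀ {P : Set} (d : Dec P) → ⌊ d ⌋ ≡ true → P
⌊⌋-true (yes p) _ = p

⌊⌋-false : ∀ {P : Set} (d : Dec P) → ⌊ d ⌋ ≡ false → ¬ P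
⌊⌋-false (no ¬p) _ = ¬p

true⇒⌊⌋ : ∀ {P : Set} (d : Dec P) → P → ⌊ d ⌋ ≡ true
true⇒⌊⌋ (yes _) _ = refl
true⇒⌊⌋ (no ¬p) p = ⊥-elim (¬p p)

false⇒⌊⌋ : ∀ {P : Set} (d : Dec P) → ¬ P → ⌊ d ⌋ ≡ false
false⇒⌊⌋ (yes p) ¬p = ⊥-elim (¬p p)
false⇒⌊⌋ (no _)  _  = refl

≟true : ∀ b → ⌊ b Bool.≟ true ⌋ ≡ b
≟true true  = refl
≟true false = refl

true≢false : ∀ {b : Bool} → b ≡ true → b ≡ false → ⊥
true≢false refl ()

∑-when-- : ∀ {n} (D : Fin n → Bool) (a b : Fin n → ℚ) →
  ∑ (λ j → when (D j) (a j - b j)) ≡ ∑ (λ j → when (D j) (a j)) - ∑ (λ j → when (D j) (b j))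
∑-when-- {n} D a b = trans (∑-cong {n} (λ j → sub (D j) (a j) (b j))) (∑-- (λ j → when (D j) (a j)) (λ j → when (D j) (b j)))
  where
  sub : ∀ c x y → when c (x - y) ≡ when c x - when c y
  sub true  x y = refl
  sub false x y = refl

∑-when-affine : ∀ {n} (D : Fin n → Bool) a c (w : Fin n → ℚ) →
  ∑ (λ j → when (D j) (a + c * w j)) ≡ a * ∑ (λ j → when (D j) 1ℚ) + c * ∑ (λ j → when (D j) (w j))
∑-when-affine {n} D a c w = begin
  ∑ (λ j → when (D j) (a + c * w j))
    ≡⟨ ∑-cong {n} (λ j → affine (D j) (w j)) ⟩
  ∑ (λ j → a * when (D j) 1ℚ + c * when (D j) (w j))
    ≡⟨ ∑-+ (λ j → a * when (D j) 1ℚ) (λ j → c * when (D j) (w j)) ⟩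
  ∑ (λ j → a * when (D j) 1ℚ) + ∑ (λ j → c * when (D j) (w j))
    ≡⟨ cong₂ _+_ (∑-* a (λ j → when (D j) 1ℚ)) (∑-* c (λ j → when (D j) (w j))) ⟩
  a * ∑ (λ j → when (D j) 1ℚ) + c * ∑ (λ j → when (D j) (w j)) ∎
  where
  open ≡-Reasoning
  affine : ∀ b x → when b (a + c * x) ≡ a * when b 1ℚ + c * when b x
  affine true  x = cong (_+ c * x) (sym (*-identityʳ a))
  affine false x = sym (trans (cong₂ _+_ (*-zeroʳ a) (*-zeroʳ c)) (+-identityʳ 0ℚ))

-- An averaging device: every excess or credit is a multiple of the same distance `K`, and weights
-- `y` of nonpositive sum let the credits absorb the excesses. It balances the clients at the
-- closest facility against those elsewhere, and the clients shared with a mate against the rest.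
∑-when-transfer : ∀ {n} (D : Fin n → Bool) (a b y : Fin n → ℚ) K → 0ℚ ≤ K →
  ∑ (λ j → when (D j) (y j)) ≤ 0ℚ → (∀ j → D j ≡ true → a j ≤ b j + y j * K) →
  ∑ (λ j → when (D j) (a j)) ≤ ∑ (λ j → when (D j) (b j))
∑-when-transfer {n} D a b y K K≥0 y≤0 a≤ = begin
  ∑ (λ j → when (D j) (a j))
    ≤⟨ ∑-mono (λ j → when-mono (D j) (a≤ j)) ⟩
  ∑ (λ j → when (D j) (b j + y j * K))
    ≡⟨ ∑-cong {n} (λ j → split (D j) (b j) (y j)) ⟩
  ∑ (λ j → when (D j) (b j) + K * when (D j) (y j))
    ≡⟨ ∑-+ (λ j → when (D j) (b j)) (λ j → K * when (D j) (y j)) ⟩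
  ∑ (λ j → when (D j) (b j)) + ∑ (λ j → K * when (D j) (y j))
    ≡⟨ cong (∑ (λ j → when (D j) (b j)) +_) (∑-* K (λ j → when (D j) (y j))) ⟩
  ∑ (λ j → when (D j) (b j)) + K * ∑ (λ j → when (D j) (y j))
    ≤⟨ +-monoʳ-≤ (∑ (λ j → when (D j) (b j))) (*-monoˡ-≤-nonNeg K {{nonNegative K≥0}} y≤0) ⟩
  ∑ (λ j → when (D j) (b j)) + K * 0ℚ
    ≡⟨ trans (cong (∑ (λ j → when (D j) (b j)) +_) (*-zeroʳ K)) (+-identityʳ _) ⟩
  ∑ (λ j → when (D j) (b j)) ∎
  where
  open ≤-Reasoning
  split : ∀ c x z → when c (x + z * K) ≡ when c x + K * when c z
  split true  x z = cong (x +_) (*-comm z K)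
  split false x z = sym (trans (+-identityˡ (K * 0ℚ)) (*-zeroʳ K))

-- Explicit motives, because `with` would unfold the arithmetic of ℚ in the goal and the context.
bool-elim : ∀ (Q : Bool → Set) b → (b ≡ true → Q true) → (b ≡ false → Q false) → Q b
bool-elim Q true  t f = t refl
bool-elim Q false t f = f refl

dec-elim : ∀ {P : Set} (Q : Bool → Set) (d : Dec P) → (P → Q true) → (¬ P → Q false) → Q ⌊ d ⌋
dec-elim Q (yes p) t f = t p
dec-elim Q (no ¬p) t f = f ¬p

-- With a constant `g` this doubles as an exhaustive search for an index satisfying `p`.
argmin : ∀ {n} (p : Fin n → Bool) (g : Fin n → ℚ) →
  (∀ x → p x ≡ false) ⊎ ∃ λ x → p x ≡ true × (∀ y → p y ≡ true → g x ≤ g y)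
argmin {zero} p g = inj₁ λ ()
argmin {suc n} p g with p Fin.zero in p0 | argmin (p ∘ Fin.suc) (g ∘ Fin.suc)
... | false | inj₁ none = inj₁ λ { Fin.zero → p0 ; (Fin.suc x) → none x }
... | false | inj₂ (x , px , least) =
  inj₂ (Fin.suc x , px , λ { Fin.zero py → ⊥-elim (true≢false py p0) ; (Fin.suc y) py → least y py })
... | true | inj₁ none =
  inj₂ (Fin.zero , p0 , λ { Fin.zero _ → ≤-refl ; (Fin.suc y) py → ⊥-elim (true≢false py (none y)) })
... | true | inj₂ (x , px , least) with ≤-total (g Fin.zero) (g (Fin.suc x))
...   | inj₁ le = inj₂ (Fin.zero , p0 , λ { Fin.zero _ → ≤-refl ; (Fin.suc y) py → ≤-trans le (least y py) })
...   | inj₂ ge = inj₂ (Fin.suc x , px , λ { Fin.zero _ → ge ; (Fin.suc y) py → least y py })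

minL-≤ : ∀ d {x} xs → x ∈ˡ xs → minL d xs ≤ x
minL-≤ d (x ∷ xs) (here refl) = below xs
  where
  below : ∀ {z} ys → foldr _⊓_ z ys ≤ z
  below []       = ≤-refl
  below (y ∷ ys) = ≤-trans (p⊓q≤q y _) (below ys)
minL-≤ d (x ∷ xs) (there q) = below xs q
  where
  below : ∀ {z y} ys → y ∈ˡ ys → foldr _⊓_ z ys ≤ y
  below (y ∷ ys) (here refl) = p⊓q≤p y _
  below (y ∷ ys) (there r)   = ≤-trans (p⊓q≤q y _) (below ys r)

minL-∈ : ∀ d {x} xs → x ∈ˡ xs → minL d xs ∈ˡ xs
minL-∈ d (x ∷ xs) _ = attained xs
  where
  attained : ∀ ys → foldr _⊓_ x ys ∈ˡ (x ∷ ys)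
  attained [] = here refl
  attained (y ∷ ys) with ⊓-sel y (foldr _⊓_ x ys)
  ... | inj₁ eq = there (here eq)
  ... | inj₂ eq with attained ys
  ...   | here eq′ = here (trans eq eq′)
  ...   | there q  = there (there (subst (_∈ˡ ys) (sym eq) q))

∈-members⁺ : ∀ {n} (S : Subset n) {f} → lookup S f ≡ true → f ∈ˡ members S
∈-members⁺ S {f} h = ∈-filter⁺ (λ f → lookup S f Bool.≟ true) (∈-allFin f) h

∈-members⁻ : ∀ {n} (S : Subset n) {f} → f ∈ˡ members S → lookup S f ≡ true
∈-members⁻ {n} S h = proj₂ (∈-filter⁻ (λ f → lookup S f Bool.≟ true) {xs = allFin n} h)

-- Opening and connection costs as sums and minima

module _ {nC nF : ℕ} (cd : Fin nC → Fin nF → ℚ) (o : Fin nF → ℚ) where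
  open UFL cd o

  openCost-∑ : ∀ S → openCost S ≡ ∑ (λ f → when (lookup S f) (o f))
  openCost-∑ S = trans (sumQ-filter (λ f → lookup S f Bool.≟ true) o (allFin nF))
    (∑-cong (λ f → cong (λ b → when b (o f)) (≟true (lookup S f))))

  distTo-≤ : ∀ S j {f} → lookup S f ≡ true → distTo S j ≤ cd j f
  distTo-≤ S j h = minL-≤ 0ℚ _ (∈-map⁺ (cd j) (∈-members⁺ S h))

  distTo-attained : ∀ S j {f} → lookup S f ≡ true → ∃ λ g → lookup S g ≡ true × distTo S j ≡ cd j g
  distTo-attained S j h with ∈-map⁻ (cd j) (minL-∈ 0ℚ _ (∈-map⁺ (cd j) (∈-members⁺ S h)))
  ... | g , g∈ , eq = g , ∈-members⁻ S g∈ , eq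

-- The list recursion inside firstWhere has no name outside Defs, so it is recovered by unification.
firstIn : ∀ {n} → (Fin n → Bool) → List (Fin n) → Maybe (Fin n)
firstWhere≡firstIn : ∀ {n} (p : Fin n → Bool) → firstWhere p ≡ firstIn p (allFin n)
firstIn p xs = _
firstWhere≡firstIn {n} p with allFin n
... | xs = refl

firstIn-just : ∀ {n} (p : Fin n → Bool) xs {x} → firstIn p xs ≡ just x → p x ≡ true
firstIn-just p (y ∷ ys) eq with p y in py
firstIn-just p (y ∷ ys) refl | true = py
... | false = firstIn-just p ys eq

firstIn-nothing : ∀ {n} (p : Fin n → Bool) xs {x} → firstIn p xs ≡ nothing → x ∈ˡ xs → p x ≡ false
firstIn-nothing p (y ∷ ys) eq x∈ with p y in py
firstIn-nothing p (y ∷ ys) eq (here refl) | false = py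
firstIn-nothing p (y ∷ ys) eq (there x∈)  | false = firstIn-nothing p ys eq x∈

firstWhere-just : ∀ {n} (p : Fin n → Bool) {x} → firstWhere p ≡ just x → p x ≡ true
firstWhere-just {n} p eq = firstIn-just p (allFin n) (trans (sym (firstWhere≡firstIn p)) eq)

firstWhere-nothing : ∀ {n} (p : Fin n → Bool) → firstWhere p ≡ nothing → ∀ x → p x ≡ false
firstWhere-nothing {n} p eq x = firstIn-nothing p (allFin n) (trans (sym (firstWhere≡firstIn p)) eq) (∈-allFin x)

countWhere-mono : ∀ {A : Set} (p q : A → Bool) → (∀ x → q x ≡ true → p x ≡ true) →
  ∀ xs → countWhere q xs ℕ.≤ countWhere p xs
countWhere-mono p q h [] = ℕ.z≤n
countWhere-mono p q h (x ∷ xs) with q x in qx | p x in px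
... | true  | true  = ℕ.s≤s (countWhere-mono p q h xs)
... | true  | false = ⊥-elim (true≢false (h x qx) px)
... | false | true  = ℕP.m≤n⇒m≤1+n (countWhere-mono p q h xs)
... | false | false = countWhere-mono p q h xs

countWhere-strict : ∀ {A : Set} (p q : A → Bool) → (∀ x → q x ≡ true → p x ≡ true) →
  ∀ {y} xs → y ∈ˡ xs → p y ≡ true → q y ≡ false → countWhere q xs ℕ.< countWhere p xs
countWhere-strict p q h (x ∷ xs) (here refl) py qy rewrite py | qy = ℕ.s≤s (countWhere-mono p q h xs)
countWhere-strict p q h (x ∷ xs) (there y∈) py qy with q x in qx | p x in px
... | true  | true  = ℕ.s≤s (countWhere-strict p q h xs y∈ py qy)
... | true  | false = ⊥-elim (true≢false (h x qx) px)
... | false | true  = ℕP.m≤n⇒m≤1+n (countWhere-strict p q h xs y∈ py qy)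
... | false | false = countWhere-strict p q h xs y∈ py qy

countWhere-≤-length : ∀ {A : Set} (p : A → Bool) xs → countWhere p xs ℕ.≤ length xs
countWhere-≤-length p [] = ℕ.z≤n
countWhere-≤-length p (x ∷ xs) with p x
... | true  = ℕ.s≤s (countWhere-≤-length p xs)
... | false = ℕP.m≤n⇒m≤1+n (countWhere-≤-length p xs)

-- The JMS algorithm

≤ᵇ-true : ∀ {p q} → (p ≤ᵇ q) ≡ true → p ≤ q
≤ᵇ-true eq = ≤ᵇ⇒≤ (subst T (sym eq) tt)

≤ᵇ-false : ∀ {p q} → (p ≤ᵇ q) ≡ false → q < p
≤ᵇ-false eq = ≰⇒> (λ p≤q → subst T eq (≤⇒≤ᵇ p≤q))

∧-true : ∀ a {b} → a ∧ b ≡ true → a ≡ true × b ≡ true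
∧-true true eq = refl , eq

not-true : ∀ {b} → not b ≡ true → b ≡ false
not-true {false} _ = refl

not-false : ∀ {b} → not b ≡ false → b ≡ true
not-false {true} _ = refl

any-false : ∀ {A : Set} (p : A → Bool) xs {x} → BoolList.any p xs ≡ false → x ∈ˡ xs → p x ≡ false
any-false p (y ∷ ys) eq x∈ with p y in py
any-false p (y ∷ ys) eq (here refl) | false = py
any-false p (y ∷ ys) eq (there x∈)  | false = any-false p ys eq x∈

all-false : ∀ {A : Set} (p : A → Bool) xs → (∀ x → p x ≡ false) → BoolList.any p xs ≡ false
all-false p []       h = refl
all-false p (x ∷ xs) h rewrite h x = all-false p xs h

is-nothing-true : ∀ {A : Set} {m : Maybe A} → is-nothing m ≡ true → m ≡ nothing
is-nothing-true {m = nothing} _ = refl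

ℕ→ℚ-nonneg : ∀ n → 0ℚ ≤ ℕ→ℚ n
ℕ→ℚ-nonneg zero    = ≤-refl
ℕ→ℚ-nonneg (suc n) = subst (0ℚ ≤_) (sym (ℕ→ℚ-suc n)) (+-mono-≤ (≤ᵇ⇒≤ {0ℚ} {1ℚ} tt) (ℕ→ℚ-nonneg n))

length-nonzero : ∀ {A : Set} (xs : List A) {x} → x ∈ˡ xs → ℕ→ℚ (length xs) ≢ 0ℚ
length-nonzero (_ ∷ xs) _ eq = <-irrefl (sym eq)
  (subst (0ℚ <_) (sym (ℕ→ℚ-suc (length xs))) (+-mono-<-≤ (positive⁻¹ 1ℚ) (ℕ→ℚ-nonneg (length xs))))

*-divQ : ∀ p {q} → q ≢ 0ℚ → q * divQ p q ≡ p
*-divQ p {q} q≢0 with q ≟ 0ℚ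
... | yes q≡0 = ⊥-elim (q≢0 q≡0)
... | no q≢0′ = trans (rotate q p (1/ q)) (trans (cong (p *_) (*-inverseʳ q)) (*-identityʳ p))
  where
  instance
    q-nonZero : NonZero q
    q-nonZero = ≢-nonZero q≢0′
  rotate : ∀ q p r → q * (p * r) ≡ p * (q * r)
  rotate q p r = solve (q ∷ p ∷ r ∷ []) ℚ-ring

-- Event times of JMS

module _ {A B : Set} (op : B → Bool) (d : A → B → ℚ) (T : B → A → ℚ) (as : List A) (bs : List B) where

  private
    openTerm : A → B → List ℚ
    openTerm a b = if op b then d a b ∷ [] else []

    closedTerm : B → List ℚ
    closedTerm b = if op b then [] else map (T b) as

  -- The shape of `candidates` with its ingredients left abstract, so that the case splits on `op b`
  -- take place without the rational expressions for the times in view.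
  events : List ℚ
  events = concatMap (λ a → concatMap (openTerm a) bs) as ++ concatMap closedTerm bs

  ∈-events-open : ∀ {a b} → a ∈ˡ as → b ∈ˡ bs → op b ≡ true → d a b ∈ˡ events
  ∈-events-open {a} {b} a∈ b∈ op-b = ∈-++⁺ˡ (∈-concatMap⁺ (λ a → concatMap (openTerm a) bs)
    (lose a∈ (∈-concatMap⁺ (openTerm a) (lose b∈ term))))
    where
    term : d a b ∈ˡ openTerm a b
    term rewrite op-b = here refl

  ∈-events-closed : ∀ {a b} → a ∈ˡ as → b ∈ˡ bs → op b ≡ false → T b a ∈ˡ events
  ∈-events-closed {a} {b} a∈ b∈ cl-b = ∈-++⁺ʳ (concatMap (λ a → concatMap (openTerm a) bs) as)
    (∈-concatMap⁺ closedTerm (lose b∈ term))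
    where
    term : T b a ∈ˡ closedTerm b
    term rewrite cl-b = ∈-map⁺ (T b) a∈

  ∈-events⁻ : ∀ {x} → x ∈ˡ events →
    (∃ λ a → ∃ λ b → a ∈ˡ as × op b ≡ true × x ≡ d a b) ⊎ (∃ λ a → ∃ λ b → a ∈ˡ as × op b ≡ false × x ≡ T b a)
  ∈-events⁻ {x} x∈ with ∈-++⁻ (concatMap (λ a → concatMap (openTerm a) bs) as) x∈
  ... | inj₁ x∈ˡ with find (∈-concatMap⁻ (λ a → concatMap (openTerm a) bs) {xs = as} x∈ˡ)
  ...   | a , a∈ , q with find (∈-concatMap⁻ (openTerm a) {xs = bs} q)
  ...     | b , _ , r with op b in eq
  ...       | true with here x≡ ← r = inj₁ (a , b , a∈ , eq , x≡)
  ∈-events⁻ {x} x∈ | inj₂ x∈ʳ with find (∈-concatMap⁻ closedTerm {xs = bs} x∈ʳ)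
  ... | b , _ , r with op b in eq
  ...   | false with ∈-map⁻ (T b) r
  ...     | a , a∈ , x≡ = inj₂ (a , b , a∈ , eq , x≡)

-- The clients paying at time τ are those up to the farthest one, j₀, that pays, so τ ≤ T j₀ bounds
-- their payments.
early-payment : ∀ {n} (act : Fin n → Bool) (c T : Fin n → ℚ) (τ R : ℚ) →
  (∀ j₀ → act j₀ ≡ true → ∑ (λ j → when (act j) (when ⌊ c j ≤? c j₀ ⌋ (T j₀ - c j))) ≡ R) →
  (∀ j → act j ≡ true → τ ≤ T j) →
  (∀ j → act j ≡ true → τ ≤ c j) ⊎ (∑ (λ j → when (act j) (0ℚ ⊔ (τ - c j))) ≤ R)
early-payment act c T τ R pays early with argmin (λ j → act j ∧ ⌊ c j <? τ ⌋) (λ j → - c j)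
... | inj₁ none = inj₁ far
  where
  far : ∀ j → act j ≡ true → τ ≤ c j
  far j a with none j
  ... | eq rewrite a = ≮⇒≥ (⌊⌋-false (c j <? τ) eq)
... | inj₂ (j₀ , near₀ , farthest) =
  inj₂ (≤-trans (∑-mono (λ j → when-mono (act j) (term j))) (≤-reflexive (pays j₀ a₀)))
  where
  a₀ : act j₀ ≡ true
  a₀ = proj₁ (∧-true (act j₀) near₀)
  near : c j₀ < τ
  near = ⌊⌋-true (c j₀ <? τ) (proj₂ (∧-true (act j₀) near₀))
  nonneg : ∀ τ T c → τ ≤ T → c ≤ τ → 0ℚ ≤ T - c
  nonneg τ T c h₁ h₂ = ≤-by-difference (+-mono-≤ h₁ h₂) (solve (τ ∷ T ∷ c ∷ []) ℚ-ring)
  nonpos : ∀ x y → x ≤ y → x - y ≤ 0ℚ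
  nonpos x y h = ≤-by-difference h (solve (x ∷ y ∷ []) ℚ-ring)
  neg-cancel-≤ : ∀ x y → - x ≤ - y → y ≤ x
  neg-cancel-≤ x y h = ≤-by-difference h (solve (x ∷ y ∷ []) ℚ-ring)
  term : ∀ j → act j ≡ true → 0ℚ ⊔ (τ - c j) ≤ when ⌊ c j ≤? c j₀ ⌋ (T j₀ - c j)
  term j a with c j ≤? c j₀
  -- Payments counted in `pays` are not truncated at zero, so their sign has to be checked: c j ≤ c
  -- j₀ < τ ≤ T j₀.
  ... | yes le = ⊔-lub (nonneg τ (T j₀) (c j) (early j₀ a₀) (≤-trans le (<⇒≤ near)))
                       (+-monoˡ-≤ (- c j) (early j₀ a₀))
  ... | no ¬le = ⊔-lub ≤-refl (nonpos τ (c j) (≮⇒≥ not-near))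
    where
    not-near : ¬ (c j < τ)
    not-near lt = ¬le (neg-cancel-≤ (c j₀) (c j) (farthest j (cong₂ _∧_ a (true⇒⌊⌋ (c j <? τ) lt))))

-- Dual certificate of a JMS run

module JMSAnalysis {nC nF : ℕ} (cd : Fin nC → Fin nF → ℚ) (o : Fin nF → ℚ)
  (cd≥0 : ∀ j f → 0ℚ ≤ cd j f) (o≥0 : ∀ f → 0ℚ ≤ o f)
  (detour : ∀ i j f g → cd i g ≤ cd i f + cd j f + cd j g)
  (someFacility : Fin nC → Fin nF) where

  open JMS cd o
  open UFL cd o using (openCost; distTo; connCost; cost)

  Active : State → Fin nC → Set
  Active s j = asg s j ≡ nothing

  -- With this quantity both branches of `offer` become the positive excess of one number over the
  -- distance. It is also the client's term in the potential that pays for openings.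
  radius : State → Fin nC → ℚ
  radius s j = maybe′ (cd j) (t s) (asg s j)

  offer-radius : ∀ s j f → offer s j f ≡ 0ℚ ⊔ (radius s j - cd j f)
  offer-radius s j f with asg s j
  ... | nothing = refl
  ... | just _  = refl

  offer-nonneg : ∀ s j f → 0ℚ ≤ offer s j f
  offer-nonneg s j f = subst (0ℚ ≤_) (sym (offer-radius s j f)) (p≤p⊔q 0ℚ (radius s j - cd j f))

  radius≤offer : ∀ s j f → radius s j ≤ offer s j f + cd j f
  radius≤offer s j f = subst (λ z → radius s j ≤ z + cd j f) (sym (offer-radius s j f))
    (shift (radius s j) (cd j f) (p≤q⊔p 0ℚ (radius s j - cd j f)))
    where
    shift : ∀ r c {z} → r - c ≤ z → r ≤ z + c
    shift r c {z} h = ≤-by-difference h (solve (r ∷ c ∷ z ∷ []) ℚ-ring)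

  offer-positive : ∀ s j f → 0ℚ < offer s j f → cd j f + offer s j f ≡ radius s j
  offer-positive s j f pos with ⊔-sel 0ℚ (radius s j - cd j f)
  ... | inj₁ eq = ⊥-elim (<-irrefl refl (subst (0ℚ <_) (trans (offer-radius s j f) eq) pos))
  ... | inj₂ eq = trans (cong (cd j f +_) (trans (offer-radius s j f) eq)) (cancel (cd j f) (radius s j))
    where
    cancel : ∀ c r → c + (r - c) ≡ r
    cancel c r = solve (c ∷ r ∷ []) ℚ-ring

  offer-mono : ∀ s s' j f → radius s' j ≤ radius s j → offer s' j f ≤ offer s j f
  offer-mono s s' j f h = subst₂ _≤_ (sym (offer-radius s' j f)) (sym (offer-radius s j f))
    (⊔-mono-≤ (≤-refl {0ℚ}) (+-monoˡ-≤ (- cd j f) h))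

  radius-active : ∀ s {j} → Active s j → radius s j ≡ t s
  radius-active s {j} h = cong (maybe′ (cd j) (t s)) h

  radius-inactive : ∀ s {j g} → asg s j ≡ just g → radius s j ≡ cd j g
  radius-inactive s {j} h = cong (maybe′ (cd j) (t s)) h

  -- Offers to open facilities are bounded as well, because the dual bounds are needed for every
  -- facility. Waiting cannot raise them, since `active-far` keeps the active clients at distance at
  -- least the current time.
  record Invariant (s : State) : Set where
    field
      offers-bounded : ∀ f → totalOffer s f ≤ o f
      assigned-open  : ∀ {j g} → asg s j ≡ just g → isOpen s g ≡ true
      active-far     : ∀ {i g} → Active s i → isOpen s g ≡ true → t s ≤ cd i g
  open Invariant

  -- A connection lowers the first count; an opening lowers the second and does not raise the first.
  measure : State → ℕ
  measure s = countWhere (isActive s) clients ℕ.+ countWhere (not ∘ isOpen s) facilities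

  -- A connection or an opening; p j is the share of the new opening cost paid by client j.
  record Event (s s' : State) : Set where
    field
      same-time      : t s' ≡ t s
      p              : Fin nC → ℚ
      p-nonneg       : ∀ j → 0ℚ ≤ p j
      opening-paid   : openCost (opn s') ≤ openCost (opn s) + ∑ p
      -- A client finances its share from the drop of its radius.
      inactive-pays  : ∀ {j g} → asg s' j ≡ just g → cd j g + p j ≤ radius s j
      active-free    : ∀ {j} → Active s' j → p j ≤ 0ℚ
      active-before  : ∀ {j} → Active s' j → Active s j
      assigned-open′ : ∀ {j g} → asg s' j ≡ just g → isOpen s' g ≡ true
      active-far′    : ∀ {i g} → Active s' i → isOpen s' g ≡ true → t s' ≤ cd i g
      progress       : measure s' ℕ.< measure s
  open Event

  event-invariant : ∀ {s s'} → Event s s' → Invariant s → Invariant s'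
  event-invariant {s} {s'} e inv = record
    { offers-bounded = λ f → ≤-trans (∑-mono (λ j → offer-mono s s' j f (shrink j))) (offers-bounded inv f)
    ; assigned-open  = assigned-open′ e
    ; active-far     = active-far′ e
    }
    where
    drop : ∀ {a b c} → 0ℚ ≤ b → a + b ≤ c → a ≤ c
    drop {a} {b} {c} b≥0 h = ≤-by-difference (+-mono-≤ b≥0 h) (solve (a ∷ b ∷ c ∷ []) ℚ-ring)
    shrink : ∀ j → radius s' j ≤ radius s j
    shrink j with asg s' j in eq
    ... | nothing = ≤-reflexive (trans (same-time e) (sym (radius-active s (active-before e eq))))
    ... | just g  = drop (p-nonneg e j) (inactive-pays e eq)

  -- Dual certificate for the run from s to the final solution S: α i is the time at which the
  -- active client i stops being active and W i j f the offer of j to f at that time.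
  record Dual (s : State) (S : Subset nF) : Set where
    field
      α      : Fin nC → ℚ
      W      : Fin nC → Fin nC → Fin nF → ℚ
      paid   : openCost S + connCost S ≤ openCost (opn s) + ∑ (λ j → maybe′ (cd j) (α j) (asg s j))
      budget : ∀ {i} f → Active s i → ∑ (λ j → W i j f) ≤ o f
      W-nonneg : ∀ {i} j f → Active s i → 0ℚ ≤ W i j f
      own    : ∀ {i} f → Active s i → α i ≤ W i i f + cd i f
      -- A form symmetric in the order of leaving. The client that leaves later satisfies `mixed`;
      -- the earlier one leaves while the other is still active, so its time is at most the other's
      -- offer plus the other's distance.
      pair   : ∀ {i j} f → Active s i → Active s j →
               α i + α j ≤ (W i j f + W j i f) + ((cd i f + cd j f) + (cd i f + cd j f))
      mixed  : ∀ {i j g} f → Active s i → asg s j ≡ just g → α i ≤ W i j f + (cd i f + cd j f + cd j f)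
  open Dual

  -- Induction backwards along the run. Clients leaving in this event receive the time and the
  -- offers of `s`, the state before the event, where `offers-bounded` supplies the budget; clients
  -- that remain active keep the values of the later run.
  event-dual : ∀ {s s' S} → Invariant s → Event s s' → Dual s' S → Dual s S
  event-dual {s} {s'} {S} inv e d = record
    { α = α₀ ; W = W₀ ; paid = paid₀ ; budget = budget₀ ; W-nonneg = W-nonneg₀
    ; own = own₀ ; pair = pair₀ ; mixed = mixed₀ }
    where
    α₀ : Fin nC → ℚ
    α₀ i = maybe′ (λ _ → t s) (α d i) (asg s' i)
    W₀ : Fin nC → Fin nC → Fin nF → ℚ
    W₀ i j f = maybe′ (λ _ → offer s j f) (W d i j f) (asg s' i)

    paid₀ : openCost S + connCost S ≤ openCost (opn s) + ∑ (λ j → maybe′ (cd j) (α₀ j) (asg s j))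
    paid₀ = chain (openCost S + connCost S) (openCost (opn s')) (openCost (opn s))
      (∑ (λ j → maybe′ (cd j) (α d j) (asg s' j))) (∑ (λ j → maybe′ (cd j) (α₀ j) (asg s j))) (∑ (p e)) (paid d) (opening-paid e)
      (subst (_≤ ∑ (λ j → maybe′ (cd j) (α₀ j) (asg s j)))
        (∑-+ (λ j → maybe′ (cd j) (α d j) (asg s' j)) (p e)) (∑-mono share))
      where
      chain : ∀ c a b x y q → c ≤ a + x → a ≤ b + q → x + q ≤ y → c ≤ b + y
      chain c a b x y q h₁ h₂ h₃ = ≤-by-difference (+-mono-≤ h₁ (+-mono-≤ h₂ h₃))
        (solve (c ∷ a ∷ b ∷ x ∷ y ∷ q ∷ []) ℚ-ring)
      share : ∀ j → maybe′ (cd j) (α d j) (asg s' j) + p e j ≤ maybe′ (cd j) (α₀ j) (asg s j)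
      share j with asg s' j in eq
      ... | nothing rewrite active-before e eq =
        subst (α d j + p e j ≤_) (+-identityʳ (α d j)) (+-monoʳ-≤ (α d j) (active-free e eq))
      ... | just g = inactive-pays e eq

    leaving-own : ∀ j f → Active s j → t s ≤ offer s j f + cd j f
    leaving-own j f aj = subst (_≤ offer s j f + cd j f) (radius-active s aj) (radius≤offer s j f)

    -- The active `i` is at distance at least `t s` from the open facility `g` of `j`. Going from
    -- `i` to `g` through `f` and `j`, the last leg is the radius of `j`, hence at most its offer to
    -- `f` plus its distance to `f`.
    leaving-mixed : ∀ {i j g} f → Active s i → asg s j ≡ just g → t s ≤ offer s j f + (cd i f + cd j f + cd j f)
    leaving-mixed {i} {j} {g} f ai eq = chain (t s) (cd i g) (cd i f) (cd j f) (cd j g) (offer s j f)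
      (active-far inv ai (assigned-open inv eq)) (detour i j f g)
      (subst (_≤ offer s j f + cd j f) (radius-inactive s eq) (radius≤offer s j f))
      where
      chain : ∀ τ x a b y w → τ ≤ x → x ≤ a + b + y → y ≤ w + b → τ ≤ w + (a + b + b)
      chain τ x a b y w h₁ h₂ h₃ = ≤-by-difference (+-mono-≤ h₁ (+-mono-≤ h₂ h₃))
        (solve (τ ∷ x ∷ a ∷ b ∷ y ∷ w ∷ []) ℚ-ring)

    budget₀ : ∀ {i} f → Active s i → ∑ (λ j → W₀ i j f) ≤ o f
    budget₀ {i} f ai with asg s' i in eq
    ... | nothing = budget d f eq
    ... | just _  = offers-bounded inv f

    W-nonneg₀ : ∀ {i} j f → Active s i → 0ℚ ≤ W₀ i j f
    W-nonneg₀ {i} j f ai with asg s' i in eq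
    ... | nothing = W-nonneg d j f eq
    ... | just _  = offer-nonneg s j f

    own₀ : ∀ {i} f → Active s i → α₀ i ≤ W₀ i i f + cd i f
    own₀ {i} f ai with asg s' i in eq
    ... | nothing = own d f eq
    ... | just _  = leaving-own i f ai

    pair₀ : ∀ {i j} f → Active s i → Active s j →
            α₀ i + α₀ j ≤ (W₀ i j f + W₀ j i f) + ((cd i f + cd j f) + (cd i f + cd j f))
    pair₀ {i} {j} f ai aj with asg s' i in eqi | asg s' j in eqj
    ... | nothing | nothing = pair d f eqi eqj
    ... | nothing | just _ = combine (α d i) (t s) (W d i j f) (offer s i f) (cd i f) (cd j f)
       (mixed d f eqi eqj) (leaving-own i f ai)
      where
      combine : ∀ x y w v a b → x ≤ w + (a + b + b) → y ≤ v + a → x + y ≤ (w + v) + ((a + b) + (a + b))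
      combine x y w v a b h₁ h₂ = ≤-by-difference (+-mono-≤ h₁ h₂)
        (solve (x ∷ y ∷ w ∷ v ∷ a ∷ b ∷ []) ℚ-ring)
    ... | just _ | nothing = combine (t s) (α d j) (offer s j f) (W d j i f) (cd i f) (cd j f)
       (leaving-own j f aj) (mixed d f eqj eqi)
      where
      combine : ∀ x y w v a b → x ≤ w + b → y ≤ v + (b + a + a) → x + y ≤ (w + v) + ((a + b) + (a + b))
      combine x y w v a b h₁ h₂ = ≤-by-difference (+-mono-≤ h₁ h₂)
        (solve (x ∷ y ∷ w ∷ v ∷ a ∷ b ∷ []) ℚ-ring)
    ... | just _ | just _ = combine (t s) (t s) (offer s j f) (offer s i f) (cd i f) (cd j f)
       (cd≥0 i f) (cd≥0 j f) (leaving-own j f aj) (leaving-own i f ai)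
      where
      combine : ∀ x y w v a b → 0ℚ ≤ a → 0ℚ ≤ b → x ≤ w + b → y ≤ v + a →
                x + y ≤ (w + v) + ((a + b) + (a + b))
      combine x y w v a b h₁ h₂ h₃ h₄ = ≤-by-difference (+-mono-≤ (+-mono-≤ h₁ h₂) (+-mono-≤ h₃ h₄))
        (solve (x ∷ y ∷ w ∷ v ∷ a ∷ b ∷ []) ℚ-ring)

    mixed₀ : ∀ {i j g} f → Active s i → asg s j ≡ just g → α₀ i ≤ W₀ i j f + (cd i f + cd j f + cd j f)
    mixed₀ {i} {j} f ai eqj with asg s' i in eqi
    ... | just _  = leaving-mixed f ai eqj
    ... | nothing with asg s' j in eqj′
    ...   | just _  = mixed d f eqi eqj′
    ...   | nothing with () ← trans (sym eqj) (active-before e eqj′)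

  connect-event : ∀ {s j f} → Invariant s → Active s j → isOpen s f ≡ true → cd j f ≤ t s →
    Event s (st (t s) (update (asg s) j (just f)) (opn s))
  connect-event {s} {j} {f} inv aj open-f near = record
    { same-time = refl ; p = λ _ → 0ℚ ; p-nonneg = λ _ → ≤-refl
    ; opening-paid = ≤-reflexive (sym (trans (cong (openCost (opn s) +_) (∑-0 nC)) (+-identityʳ _)))
    ; inactive-pays = λ {i} {g} → pays i g ; active-free = λ _ → ≤-refl ; active-before = λ {i} → before i
    ; assigned-open′ = λ {i} {g} → assigned i g ; active-far′ = λ {i} a → active-far inv (before i a)
    ; progress = ℕP.+-monoˡ-< _ (countWhere-strict (isActive s) (isActive s') shrinks clients (∈-allFin j)
                                   (cong is-nothing aj) j-inactive) }
    where
    s' : State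
    s' = st (t s) (update (asg s) j (just f)) (opn s)
    pays : ∀ i g → asg s' i ≡ just g → cd i g + 0ℚ ≤ radius s i
    pays i g eq with i Fin.≟ j
    pays i g refl | yes refl = subst₂ _≤_ (sym (+-identityʳ (cd i g))) (sym (radius-active s aj)) near
    ... | no _ = ≤-reflexive (trans (+-identityʳ (cd i g)) (sym (radius-inactive s eq)))
    before : ∀ i → Active s' i → Active s i
    before i eq with i Fin.≟ j
    before i () | yes _
    ... | no _ = eq
    assigned : ∀ i g → asg s' i ≡ just g → isOpen s g ≡ true
    assigned i g eq with i Fin.≟ j
    assigned i g refl | yes _ = open-f
    ... | no _ = assigned-open inv eq
    shrinks : ∀ i → isActive s' i ≡ true → isActive s i ≡ true
    shrinks i h = cong is-nothing (before i (is-nothing-true h))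
    j-inactive : isActive s' j ≡ false
    j-inactive with j Fin.≟ j
    ... | yes _   = refl
    ... | no j≢j = ⊥-elim (j≢j refl)

  -- The shares are the offers themselves. A positive offer is exactly what its client saves by
  -- switching to `f`, and an active client without a positive offer is at distance at least `t s`
  -- from `f`, which preserves `active-far`.
  open-event : ∀ {s f} → Invariant s → isOpen s f ≡ false → o f ≤ totalOffer s f →
    Event s (st (t s) (λ j → if 0ℚ <ᵇ offer s j f then just f else asg s j) (updateAt (opn s) f (λ _ → true)))
  open-event {s} {f} inv closed-f enough = record
    { same-time = refl ; p = λ j → offer s j f ; p-nonneg = λ j → offer-nonneg s j f
    ; opening-paid = opening
    ; inactive-pays = λ {i} {g} → pays i g ; active-free = λ {i} a → proj₂ (before i a)
    ; active-before = λ {i} a → proj₁ (before i a)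
    ; assigned-open′ = λ {i} {g} → assigned i g ; active-far′ = λ {i} {g} → far i g
    ; progress = ℕP.+-mono-≤-<
        (countWhere-mono (isActive s) (isActive s') (λ i h → cong is-nothing (proj₁ (before i (is-nothing-true h)))) clients)
        (countWhere-strict (not ∘ isOpen s) (not ∘ isOpen s') closes facilities (∈-allFin f)
          (cong not closed-f) (cong not open-f)) }
    where
    s' : State
    s' = st (t s) (λ j → if 0ℚ <ᵇ offer s j f then just f else asg s j) (updateAt (opn s) f (λ _ → true))
    open-f : isOpen s' f ≡ true
    open-f = lookup∘updateAt f (opn s)
    open-other : ∀ g → f ≢ g → isOpen s' g ≡ isOpen s g
    open-other g f≢g = lookup∘updateAt′ g f (f≢g ∘ sym) (opn s)
    before : ∀ i → Active s' i → Active s i × offer s i f ≤ 0ℚ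
    before i a with offer s i f ≤ᵇ 0ℚ in eq
    ... | true = a , ≤ᵇ-true eq
    pays : ∀ i g → asg s' i ≡ just g → cd i g + offer s i f ≤ radius s i
    pays i g eq with offer s i f ≤ᵇ 0ℚ in le
    pays i g refl | false = ≤-reflexive (offer-positive s i g (≤ᵇ-false le))
    ... | true = ≤-trans (+-monoʳ-≤ (cd i g) (≤ᵇ-true le))
                   (≤-reflexive (trans (+-identityʳ (cd i g)) (sym (radius-inactive s eq))))
    assigned : ∀ i g → asg s' i ≡ just g → isOpen s' g ≡ true
    assigned i g eq with offer s i f ≤ᵇ 0ℚ
    assigned i g refl | false = open-f
    ... | true with f Fin.≟ g
    ...   | yes refl = open-f
    ...   | no f≢g   = trans (open-other g f≢g) (assigned-open inv eq)
    far : ∀ i g → Active s' i → isOpen s' g ≡ true → t s ≤ cd i g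
    far i g a og with f Fin.≟ g
    ... | yes refl = subst₂ _≤_ (radius-active s (proj₁ (before i a))) (+-identityˡ (cd i f))
                       (≤-trans (radius≤offer s i f) (+-monoˡ-≤ (cd i f) (proj₂ (before i a))))
    ... | no f≢g   = active-far inv (proj₁ (before i a)) (trans (sym (open-other g f≢g)) og)
    closes : ∀ g → not (isOpen s' g) ≡ true → not (isOpen s g) ≡ true
    closes g h with f Fin.≟ g
    ... | yes refl = cong not closed-f
    ... | no f≢g   = trans (cong not (sym (open-other g f≢g))) h
    opening : openCost (opn s') ≤ openCost (opn s) + totalOffer s f
    opening = begin
      openCost (opn s')
        ≡⟨ openCost-∑ cd o (opn s') ⟩
      ∑ (λ g → when (isOpen s' g) (o g))
        ≤⟨ ∑-mono pointwise ⟩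
      ∑ (λ g → when (isOpen s g) (o g) + when ⌊ f Fin.≟ g ⌋ (o g))
        ≡⟨ ∑-+ (λ g → when (isOpen s g) (o g)) (λ g → when ⌊ f Fin.≟ g ⌋ (o g)) ⟩
      ∑ (λ g → when (isOpen s g) (o g)) + ∑ (λ g → when ⌊ f Fin.≟ g ⌋ (o g))
        ≡⟨ cong₂ _+_ (sym (openCost-∑ cd o (opn s))) (∑-point f o) ⟩
      openCost (opn s) + o f
        ≤⟨ +-monoʳ-≤ (openCost (opn s)) enough ⟩
      openCost (opn s) + totalOffer s f ∎
      where
      open ≤-Reasoning
      pointwise : ∀ g → when (isOpen s' g) (o g) ≤ when (isOpen s g) (o g) + when ⌊ f Fin.≟ g ⌋ (o g)
      pointwise g with f Fin.≟ g
      ... | yes refl rewrite closed-f | open-f = ≤-reflexive (sym (+-identityˡ (o f)))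
      ... | no f≢g rewrite open-other g f≢g = ≤-reflexive (sym (+-identityʳ (when (isOpen s g) (o g))))

  -- The situation in which `step` advances the time. Its strict inequalities are what an event that
  -- has just become due contradicts.
  record Idle (s : State) : Set where
    field
      none-reached : ∀ {i g} → Active s i → isOpen s g ≡ true → t s < cd i g
      none-paid    : ∀ {f} → isOpen s f ≡ false → totalOffer s f < o f
  open Idle

  at : ℚ → State → State
  at τ s = st τ (asg s) (opn s)

  data Outcome (s : State) : Result → Set where
    event    : ∀ {s'} → Event s s' → Outcome s (next s')
    finished : (∀ j → ¬ Active s j) → Outcome s (done (opn s))
    wait     : ∀ {i} → Idle s → Active s i → Outcome s (next (at (minL (t s) (candidates s)) s))

  ∈-active⁺ : ∀ s {j} → Active s j → j ∈ˡ activeClients s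
  ∈-active⁺ s {j} a = ∈-filter⁺ (λ j → is-nothing (asg s j) Bool.≟ true) (∈-allFin j) (cong is-nothing a)

  ∈-active⁻ : ∀ s {j} → j ∈ˡ activeClients s → Active s j
  ∈-active⁻ s h = is-nothing-true (proj₂ (∈-filter⁻ (λ j → is-nothing (asg s j) Bool.≟ true) {xs = clients} h))

  outcome : ∀ s → Invariant s → Outcome s (step s)
  outcome s inv with firstWhere (λ j → isActive s j ∧ BoolList.any (λ f → isOpen s f ∧ (cd j f ≤ᵇ t s)) facilities) in eq₁
  ... | just j with firstWhere (λ f → isOpen s f ∧ (cd j f ≤ᵇ t s)) in eq₂
  ...   | just f =
    let open-near = ∧-true (isOpen s f) (firstWhere-just (λ f → isOpen s f ∧ (cd j f ≤ᵇ t s)) eq₂)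
        active    = ∧-true (isActive s j) (firstWhere-just _ eq₁)
    in event (connect-event inv (is-nothing-true (proj₁ active)) (proj₁ open-near) (≤ᵇ-true (proj₂ open-near)))
  ...   | nothing = ⊥-elim (true≢false (proj₂ (∧-true (isActive s j) (firstWhere-just _ eq₁)))
                      (all-false _ facilities (firstWhere-nothing (λ f → isOpen s f ∧ (cd j f ≤ᵇ t s)) eq₂)))
  outcome s inv | nothing with firstWhere (λ f → not (isOpen s f) ∧ (o f ≤ᵇ totalOffer s f)) in eq₂
  ... | just f =
    let paid-f = ∧-true (not (isOpen s f)) (firstWhere-just (λ f → not (isOpen s f) ∧ (o f ≤ᵇ totalOffer s f)) eq₂)
    in event (open-event inv (not-true (proj₁ paid-f)) (≤ᵇ-true (proj₂ paid-f)))
  ... | nothing with activeClients s in eq₃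
  ...   | [] = finished none
    where
    none : ∀ j → ¬ Active s j
    none j a with () ← subst (j ∈ˡ_) eq₃ (∈-active⁺ s a)
  ...   | i ∷ _ = wait (record { none-reached = reached ; none-paid = unpaid })
                       (∈-active⁻ s (subst (i ∈ˡ_) (sym eq₃) (here refl)))
    where
    reached : ∀ {i g} → Active s i → isOpen s g ≡ true → t s < cd i g
    reached {i} {g} a og with firstWhere-nothing (λ j → isActive s j ∧ BoolList.any (λ f → isOpen s f ∧ (cd j f ≤ᵇ t s)) facilities) eq₁ i
    ... | eq rewrite a with any-false (λ f → isOpen s f ∧ (cd i f ≤ᵇ t s)) facilities eq (∈-allFin g)
    ...   | eq′ rewrite og = ≤ᵇ-false eq′
    unpaid : ∀ {f} → isOpen s f ≡ false → totalOffer s f < o f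
    unpaid {f} cf with firstWhere-nothing (λ f → not (isOpen s f) ∧ (o f ≤ᵇ totalOffer s f)) eq₂ f
    ... | eq rewrite cf = ≤ᵇ-false eq

  candidate-open : ∀ s {j f} → Active s j → isOpen s f ≡ true → cd j f ∈ˡ candidates s
  candidate-open s {j} {f} a of =
    ∈-events-open (isOpen s) cd (openTimeCand s) (activeClients s) facilities (∈-active⁺ s a) (∈-allFin f) of

  candidate-closed : ∀ s {j f} → Active s j → isOpen s f ≡ false → openTimeCand s f j ∈ˡ candidates s
  candidate-closed s {j} {f} a cf =
    ∈-events-closed (isOpen s) cd (openTimeCand s) (activeClients s) facilities (∈-active⁺ s a) (∈-allFin f) cf

  candidate-inversion : ∀ s {x} → x ∈ˡ candidates s →
    (∃ λ j → ∃ λ f → j ∈ˡ activeClients s × isOpen s f ≡ true × x ≡ cd j f)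
    ⊎ (∃ λ j → ∃ λ f → j ∈ˡ activeClients s × isOpen s f ≡ false × x ≡ openTimeCand s f j)
  candidate-inversion s = ∈-events⁻ (isOpen s) cd (openTimeCand s) (activeClients s) facilities

  activeOffer : State → Fin nF → ℚ → ℚ
  activeOffer s f τ = ∑ (λ j → when (isActive s j) (0ℚ ⊔ (τ - cd j f)))

  totalOffer-split : ∀ s f τ → totalOffer (at τ s) f ≡ inactiveOffer s f + activeOffer s f τ
  totalOffer-split s f τ = trans (∑-cong split)
    (∑-+ (λ j → if isActive s j then 0ℚ else offer s j f) (λ j → when (isActive s j) (0ℚ ⊔ (τ - cd j f))))
    where
    split : ∀ j → offer (at τ s) j f
                  ≡ (if isActive s j then 0ℚ else offer s j f) + when (isActive s j) (0ℚ ⊔ (τ - cd j f))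
    split j with asg s j
    ... | nothing = sym (+-identityˡ _)
    ... | just _  = sym (+-identityʳ _)

  payers : State → Fin nF → Fin nC → List (Fin nC)
  payers s f j₀ = filter (λ j → cd j f ≤? cd j₀ f) (activeClients s)

  -- Client payments may be negative here, unlike offers.
  payersOffer : State → Fin nF → Fin nC → ℚ → ℚ
  payersOffer s f j₀ τ = ∑ (λ j → when (isActive s j) (when ⌊ cd j f ≤? cd j₀ f ⌋ (τ - cd j f)))

  sumQ-payers : ∀ s f j₀ (g : Fin nC → ℚ) →
    sumQ (map g (payers s f j₀)) ≡ ∑ (λ j → when (isActive s j) (when ⌊ cd j f ≤? cd j₀ f ⌋ (g j)))
  sumQ-payers s f j₀ g = trans (sumQ-filter (λ j → cd j f ≤? cd j₀ f) g (activeClients s))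
    (trans (sumQ-filter (λ j → is-nothing (asg s j) Bool.≟ true) _ clients)
      (∑-cong (λ j → cong (λ b → when b (when ⌊ cd j f ≤? cd j₀ f ⌋ (g j))) (≟true (isActive s j)))))

  -- This is the equation that the candidate solves, linear because payments are not truncated. The
  -- divisor is nonzero since `j₀` counts among its own payers.
  openTimeCand-pays : ∀ s f {j₀} → Active s j₀ →
    payersOffer s f j₀ (openTimeCand s f j₀) ≡ o f - inactiveOffer s f
  openTimeCand-pays s f {j₀} a = begin
    payersOffer s f j₀ T₀
      ≡⟨ sym (sumQ-payers s f j₀ (λ j → T₀ - cd j f)) ⟩
    X
      ≡⟨ add-sub X C ⟩
    (X + C) - C
      ≡⟨ cong (_- C) (sym (sumQ-+ (λ j → T₀ - cd j f) (λ j → cd j f) Js)) ⟩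
    sumQ (map (λ j → (T₀ - cd j f) + cd j f) Js) - C
      ≡⟨ cong (_- C) (sumQ-cong (λ j → sub-add T₀ (cd j f)) Js) ⟩
    sumQ (map (λ _ → T₀) Js) - C
      ≡⟨ cong (_- C) (sumQ-const T₀ Js) ⟩
    ℕ→ℚ (length Js) * T₀ - C
      ≡⟨ cong (_- C) (*-divQ (R + C) {ℕ→ℚ (length Js)} (length-nonzero Js j₀∈Js)) ⟩
    (R + C) - C
      ≡⟨ sym (add-sub R C) ⟩
    R ∎
    where
    open ≡-Reasoning
    Js : List (Fin nC)
    Js = payers s f j₀
    T₀ X C R : ℚ
    T₀ = openTimeCand s f j₀
    X = sumQ (map (λ j → T₀ - cd j f) Js)
    C = sumQ (map (λ j → cd j f) Js)
    R = o f - inactiveOffer s f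
    add-sub : ∀ x c → x ≡ (x + c) - c
    add-sub x c = solve (x ∷ c ∷ []) ℚ-ring
    sub-add : ∀ x c → (x - c) + c ≡ x
    sub-add x c = solve (x ∷ c ∷ []) ℚ-ring
    j₀∈Js : j₀ ∈ˡ Js
    j₀∈Js = ∈-filter⁺ (λ j → cd j f ≤? cd j₀ f) (∈-active⁺ s a) ≤-refl

  payersOffer≤activeOffer : ∀ s f j₀ τ → payersOffer s f j₀ τ ≤ activeOffer s f τ
  payersOffer≤activeOffer s f j₀ τ = ∑-mono (λ j → when-mono (isActive s j) (λ _ → term j))
    where
    term : ∀ j → when ⌊ cd j f ≤? cd j₀ f ⌋ (τ - cd j f) ≤ 0ℚ ⊔ (τ - cd j f)
    term j with cd j f ≤? cd j₀ f
    ... | yes _ = p≤q⊔p 0ℚ (τ - cd j f)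
    ... | no _  = p≤p⊔q 0ℚ (τ - cd j f)

  totalOffer-far : ∀ s f τ → (∀ j → Active s j → τ ≤ cd j f) → totalOffer (at τ s) f ≤ totalOffer s f
  totalOffer-far s f τ far = ∑-mono term
    where
    term : ∀ j → offer (at τ s) j f ≤ offer s j f
    term j with asg s j in eq
    ... | just _  = ≤-refl
    ... | nothing = ≤-trans (⊔-lub ≤-refl (nonpos (far j eq))) (p≤p⊔q 0ℚ (t s - cd j f))
      where
      nonpos : ∀ {x y} → x ≤ y → x - y ≤ 0ℚ
      nonpos {x} {y} h = ≤-by-difference h (solve (x ∷ y ∷ []) ℚ-ring)

  totalOffer-closed : ∀ s f τ → Invariant s →
    (∀ j → Active s j → τ ≤ openTimeCand s f j) → totalOffer (at τ s) f ≤ o f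
  totalOffer-closed s f τ inv early =
    [ (λ far → ≤-trans (totalOffer-far s f τ (λ j a → far j (cong is-nothing a))) (offers-bounded inv f))
    , (λ le → ≤-trans (≤-reflexive (totalOffer-split s f τ))
                (fits (inactiveOffer s f) (activeOffer s f τ) (o f) le)) ]′
    (early-payment (isActive s) (λ j → cd j f) (openTimeCand s f) τ (o f - inactiveOffer s f)
      (λ j₀ a → openTimeCand-pays s f (is-nothing-true a)) (λ j a → early j (is-nothing-true a)))
    where
    fits : ∀ x y z → y ≤ z - x → x + y ≤ z
    fits x y z h = ≤-by-difference h (solve (x ∷ y ∷ z ∷ []) ℚ-ring)

  module _ (s : State) (inv : Invariant s) {i₀ : Fin nC} (a₀ : Active s i₀) where

    private
      τ : ℚ
      τ = minL (t s) (candidates s)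

      τ≤ : ∀ {x} → x ∈ˡ candidates s → τ ≤ x
      τ≤ = minL-≤ (t s) (candidates s)

      -- On an empty list `minL` would return its default, the current time. The facility supplied
      -- by `someFacility` rules this out: it yields a candidate whether it is open or closed.
      some-candidate : ∃ λ x → x ∈ˡ candidates s
      some-candidate = by-status (isOpen s (someFacility i₀)) refl
        where
        by-status : ∀ b → isOpen s (someFacility i₀) ≡ b → ∃ λ x → x ∈ˡ candidates s
        by-status true  eq = cd i₀ (someFacility i₀) , candidate-open s a₀ eq
        by-status false eq = openTimeCand s (someFacility i₀) i₀ , candidate-closed s a₀ eq

    -- At the earliest candidate no active client has passed an open facility, so offers to open
    -- facilities do not grow; for a closed facility `early-payment` applies.
    wait-invariant : Invariant (at τ s)
    wait-invariant = record
      { offers-bounded = λ f → bounded f (isOpen s f) refl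
      ; assigned-open  = assigned-open inv
      ; active-far     = λ a og → τ≤ (candidate-open s a og) }
      where
      bounded : ∀ f b → isOpen s f ≡ b → totalOffer (at τ s) f ≤ o f
      bounded f true  eq = ≤-trans (totalOffer-far s f τ (λ j a → τ≤ (candidate-open s a eq))) (offers-bounded inv f)
      bounded f false eq = totalOffer-closed s f τ inv (λ j a → τ≤ (candidate-closed s a eq))

    -- The minimum is attained. If it is a distance, a client has reached an open facility. If it is
    -- an opening time, truncation only increases the payments of its payers, so that the offers
    -- reach the opening cost.
    wait-not-idle : ¬ Idle (at τ s)
    wait-not-idle idle = now (candidate-inversion s (minL-∈ (t s) (candidates s) (proj₂ some-candidate)))
      where
      open ≤-Reasoning
      cancel : ∀ x y → y ≡ x + (y - x)
      cancel x y = solve (x ∷ y ∷ []) ℚ-ring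
      enough : ∀ j f → Active s j → τ ≡ openTimeCand s f j → o f ≤ totalOffer (at τ s) f
      enough j f a eq = begin
        o f
          ≡⟨ cancel (inactiveOffer s f) (o f) ⟩
        inactiveOffer s f + (o f - inactiveOffer s f)
          ≡⟨ cong (inactiveOffer s f +_) (sym (trans (cong (payersOffer s f j) eq) (openTimeCand-pays s f a))) ⟩
        inactiveOffer s f + payersOffer s f j τ
          ≤⟨ +-monoʳ-≤ (inactiveOffer s f) (payersOffer≤activeOffer s f j τ) ⟩
        inactiveOffer s f + activeOffer s f τ
          ≡⟨ sym (totalOffer-split s f τ) ⟩
        totalOffer (at τ s) f ∎
      now : (∃ λ j → ∃ λ f → j ∈ˡ activeClients s × isOpen s f ≡ true × τ ≡ cd j f)
            ⊎ (∃ λ j → ∃ λ f → j ∈ˡ activeClients s × isOpen s f ≡ false × τ ≡ openTimeCand s f j) → ⊥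
      now (inj₁ (j , f , j∈ , of , eq)) = <-irrefl eq (none-reached idle (∈-active⁻ s j∈) of)
      now (inj₂ (j , f , j∈ , cf , eq)) =
        <-irrefl refl (<-≤-trans (none-paid idle cf) (enough j f (∈-active⁻ s j∈) eq))

  finished-dual : ∀ {s} → Invariant s → (∀ j → ¬ Active s j) → Dual s (opn s)
  finished-dual {s} inv none = record
    { α = λ _ → 0ℚ ; W = λ _ _ _ → 0ℚ
    ; paid = +-monoʳ-≤ (openCost (opn s)) (∑-mono nearest)
    ; budget = λ {i} _ a → ⊥-elim (none i a) ; W-nonneg = λ _ _ _ → ≤-refl
    ; own = λ {i} _ a → ⊥-elim (none i a) ; pair = λ {i} _ a _ → ⊥-elim (none i a)
    ; mixed = λ {i} _ a _ → ⊥-elim (none i a) }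
    where
    nearest : ∀ j → distTo (opn s) j ≤ maybe′ (cd j) 0ℚ (asg s j)
    nearest j with asg s j in eq
    ... | nothing = ⊥-elim (none j eq)
    ... | just g  = distTo-≤ cd o (opn s) j (assigned-open inv eq)

  continue : ℕ → Result → Subset nF
  continue k (done S)  = S
  continue k (next s') = run k s'

  run-suc : ∀ k s → run (suc k) s ≡ continue k (step s)
  run-suc k s with step s
  ... | done _ = refl
  ... | next _ = refl

  -- Each unit of measure provides two steps, one wait and one event. The reserve is 1 in a state
  -- where an event or termination is due and 2 in an arbitrary state, which may have to wait first.
  event-fuel : ∀ {m m' k} → m' ℕ.< m → 2 ℕ.* m ℕ.+ 1 ℕ.≤ suc k → 2 ℕ.* m' ℕ.+ 2 ℕ.≤ k
  event-fuel {m} {m'} {k} lt fuel = ℕP.≤-trans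
    (subst (ℕ._≤ 2 ℕ.* m) (trans (ℕP.*-suc 2 m') (ℕP.+-comm 2 (2 ℕ.* m'))) (ℕP.*-monoʳ-≤ 2 lt))
    (ℕP.≤-pred (subst (ℕ._≤ suc k) (ℕP.+-comm (2 ℕ.* m) 1) fuel))

  wait-fuel : ∀ m {k} → 2 ℕ.* m ℕ.+ 2 ℕ.≤ suc k → 2 ℕ.* m ℕ.+ 1 ℕ.≤ k
  wait-fuel m {k} fuel = ℕP.≤-pred (subst (ℕ._≤ suc k) (ℕP.+-suc (2 ℕ.* m) 1) fuel)

  no-fuel : ∀ m k → ¬ (2 ℕ.* m ℕ.+ suc k ℕ.≤ 0)
  no-fuel m k fuel with () ← ℕP.m+n≤o⇒n≤o (2 ℕ.* m) fuel

  wait-dual : ∀ {s S τ} → Dual (at τ s) S → Dual s S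
  wait-dual d = record
    { α = α d ; W = W d ; paid = paid d ; budget = budget d ; W-nonneg = W-nonneg d
    ; own = own d ; pair = pair d ; mixed = mixed d }

  -- Every event lowers the measure, and a wait is followed by an event.
  mutual
    run-dual : ∀ k s → Invariant s → 2 ℕ.* measure s ℕ.+ 2 ℕ.≤ k → Dual s (run k s)
    run-dual zero    s inv fuel = ⊥-elim (no-fuel (measure s) 1 fuel)
    run-dual (suc k) s inv fuel = subst (Dual s) (sym (run-suc k s)) (after (outcome s inv))
      where
      after : ∀ {r} → Outcome s r → Dual s (continue k r)
      after (finished none) = finished-dual inv none
      after (event {s'} e)  = event-dual inv e (run-dual k s' (event-invariant e inv)
        (event-fuel (progress e) (ℕP.m≤n⇒m≤1+n (wait-fuel (measure s) fuel))))
      after (wait _ a)      = wait-dual (run-ready k (at (minL (t s) (candidates s)) s)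
        (wait-invariant s inv a) (wait-not-idle s inv a) (wait-fuel (measure s) fuel))

    run-ready : ∀ k s → Invariant s → ¬ Idle s → 2 ℕ.* measure s ℕ.+ 1 ℕ.≤ k → Dual s (run k s)
    run-ready zero    s inv ready fuel = ⊥-elim (no-fuel (measure s) 0 fuel)
    run-ready (suc k) s inv ready fuel = subst (Dual s) (sym (run-suc k s)) (after (outcome s inv))
      where
      after : ∀ {r} → Outcome s r → Dual s (continue k r)
      after (finished none) = finished-dual inv none
      after (event {s'} e)  = event-dual inv e (run-dual k s' (event-invariant e inv) (event-fuel (progress e) fuel))
      after (wait idle _)   = ⊥-elim (ready idle)

  closed-initially : ∀ f → isOpen initial f ≡ false
  closed-initially f = lookup-replicate f false

  initial-invariant : Invariant initial
  initial-invariant = record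
    { offers-bounded = λ f → ≤-trans (∑-mono (λ j → no-offer j f)) (≤-trans (≤-reflexive (∑-0 nC)) (o≥0 f))
    ; assigned-open  = λ ()
    ; active-far     = λ {_} {g} _ og → ⊥-elim (true≢false og (closed-initially g)) }
    where
    no-offer : ∀ j f → 0ℚ ⊔ (0ℚ - cd j f) ≤ 0ℚ
    no-offer j f = ⊔-lub ≤-refl (nonpos (cd j f) (cd≥0 j f))
      where
      nonpos : ∀ x → 0ℚ ≤ x → 0ℚ - x ≤ 0ℚ
      nonpos x h = ≤-by-difference h (solve (x ∷ []) ℚ-ring)

  output-dual : Dual initial output
  output-dual = run-dual (3 ℕ.* (nC ℕ.+ nF) ℕ.+ 3) initial initial-invariant
    (ℕP.+-mono-≤ (ℕP.*-mono-≤ {2} {3} (ℕ.s≤s (ℕ.s≤s ℕ.z≤n)) measure≤) (ℕ.s≤s (ℕ.s≤s ℕ.z≤n)))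
    where
    measure≤ : measure initial ℕ.≤ nC ℕ.+ nF
    measure≤ = ℕP.+-mono-≤
      (subst (countWhere (isActive initial) clients ℕ.≤_) (length-tabulate {n = nC} id)
        (countWhere-≤-length (isActive initial) clients))
      (subst (countWhere (not ∘ isOpen initial) facilities ℕ.≤_) (length-tabulate {n = nF} id)
        (countWhere-≤-length (not ∘ isOpen initial) facilities))

  dual : Fin nC → ℚ
  dual = α output-dual

  cost≤dual : cost output ≤ ∑ dual
  cost≤dual = ≤-trans (paid output-dual) (≤-reflexive (trans (cong (_+ ∑ dual) nothing-open) (+-identityˡ (∑ dual))))
    where
    nothing-open : openCost (opn initial) ≡ 0ℚ
    nothing-open = trans (openCost-∑ cd o (opn initial))
      (trans (∑-cong {nF} (λ f → cong (λ b → when b (o f)) (closed-initially f))) (∑-0 nF))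

  -- At the time when `j` leaves, its own offer to `f` is one nonnegative term of a sum within the
  -- budget `o f`.
  dual≤connect : ∀ j f → dual j ≤ o f + cd j f
  dual≤connect j f = ≤-trans (own output-dual f refl) (+-monoˡ-≤ (cd j f) (begin
    W output-dual j j f
      ≡⟨ sym (∑-point j (λ i → W output-dual j i f)) ⟩
    ∑ (λ i → when ⌊ j Fin.≟ i ⌋ (W output-dual j i f))
      ≤⟨ ∑-mono (λ i → when-≤ ⌊ j Fin.≟ i ⌋ (W-nonneg output-dual {j} i f refl)) ⟩
    ∑ (λ i → W output-dual j i f)
      ≤⟨ budget output-dual {j} f refl ⟩
    o f ∎))
    where open ≤-Reasoning

  -- The pair inequalities are summed over all pairs of clients in D.
  dual≤open : ∀ f (D : Fin nC → Bool) →
    ∑ (λ j → when (D j) (dual j)) ≤ o f + (∑ (λ j → when (D j) (cd j f)) + ∑ (λ j → when (D j) (cd j f)))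
  dual≤open f D with argmin D (λ _ → 0ℚ)
  ... | inj₁ none = begin
    ∑ (λ j → when (D j) (dual j))  ≡⟨ empty dual ⟩
    0ℚ                             ≤⟨ o≥0 f ⟩
    o f                            ≡⟨ sym (+-identityʳ (o f)) ⟩
    o f + (0ℚ + 0ℚ)                ≡⟨ cong (o f +_) (sym (cong₂ _+_ (empty (λ j → cd j f)) (empty (λ j → cd j f)))) ⟩
    o f + (∑ (λ j → when (D j) (cd j f)) + ∑ (λ j → when (D j) (cd j f))) ∎
    where
    open ≤-Reasoning
    empty : ∀ (h : Fin nC → ℚ) → ∑ (λ j → when (D j) (h j)) ≡ 0ℚ
    empty h = trans (∑-cong {nC} (λ j → cong (λ b → when b (h j)) (none j))) (∑-0 nC)
  -- Over ordered pairs each dual is counted 2|D| times, while each row of offers is bounded by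
  -- `o f`. Division by 2|D| is why the empty `D` is treated apart.
  ... | inj₂ (i₀ , Di₀ , _) = *-cancelˡ-≤-pos (k + k) {{positive (+-mono-< k>0 k>0)}} (begin
    (k + k) * A
      ≡⟨ *-distribʳ-+ A k k ⟩
    k * A + k * A
      ≡⟨ sym (cong₂ _+_ (∑∑-row dual) (∑∑-col dual)) ⟩
    ∑∑ (λ i j → dual i) + ∑∑ (λ i j → dual j)
      ≡⟨ sym (∑∑-+ (λ i j → dual i) (λ i j → dual j)) ⟩
    ∑∑ (λ i j → dual i + dual j)
      ≤⟨ ∑∑-mono (λ i j → pair output-dual {i} {j} f refl refl) ⟩
    ∑∑ (λ i j → (w i j + w j i) + ((c i + c j) + (c i + c j)))
      ≡⟨ ∑∑-+ (λ i j → w i j + w j i) (λ i j → (c i + c j) + (c i + c j)) ⟩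
    ∑∑ (λ i j → w i j + w j i) + ∑∑ (λ i j → (c i + c j) + (c i + c j))
      ≡⟨ cong₂ _+_ (∑∑-+ w (λ i j → w j i)) (∑∑-+ (λ i j → c i + c j) (λ i j → c i + c j)) ⟩
    (∑∑ w + ∑∑ (λ i j → w j i)) + (∑∑ (λ i j → c i + c j) + ∑∑ (λ i j → c i + c j))
      ≡⟨ cong₂ _+_ (cong (∑∑ w +_) (∑∑-flip w)) (cong₂ _+_ ∑∑c ∑∑c) ⟩
    (∑∑ w + ∑∑ w) + ((k * C + k * C) + (k * C + k * C))
      ≤⟨ +-monoˡ-≤ ((k * C + k * C) + (k * C + k * C)) (+-mono-≤ ∑∑w≤ ∑∑w≤) ⟩
    (k * o f + k * o f) + ((k * C + k * C) + (k * C + k * C))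
      ≡⟨ collect k (o f) C ⟩
    (k + k) * (o f + (C + C)) ∎)
    where
    open ≤-Reasoning
    k A C : ℚ
    k = ∑ (λ j → when (D j) 1ℚ)
    A = ∑ (λ j → when (D j) (dual j))
    C = ∑ (λ j → when (D j) (cd j f))
    c : Fin nC → ℚ
    c j = cd j f
    w : Fin nC → Fin nC → ℚ
    w i j = W output-dual i j f
    ∑∑ : (Fin nC → Fin nC → ℚ) → ℚ
    ∑∑ F = ∑ (λ i → when (D i) (∑ (λ j → when (D j) (F i j))))
    ∑∑-mono : ∀ {F G : Fin nC → Fin nC → ℚ} → (∀ i j → F i j ≤ G i j) → ∑∑ F ≤ ∑∑ G
    ∑∑-mono {F} {G} h = ∑-mono (λ i → when-mono (D i) (λ _ → ∑-mono (λ j → when-mono (D j) (λ _ → h i j))))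
    ∑∑-+ : ∀ (F G : Fin nC → Fin nC → ℚ) → ∑∑ (λ i j → F i j + G i j) ≡ ∑∑ F + ∑∑ G
    ∑∑-+ F G = trans
      (∑-cong {nC} (λ i → trans
        (cong (when (D i)) (trans (∑-cong {nC} (λ j → when-+ (D j) (F i j) (G i j)))
                                  (∑-+ (λ j → when (D j) (F i j)) (λ j → when (D j) (G i j)))))
        (when-+ (D i) (∑ (λ j → when (D j) (F i j))) (∑ (λ j → when (D j) (G i j))))))
      (∑-+ (λ i → when (D i) (∑ (λ j → when (D j) (F i j)))) (λ i → when (D i) (∑ (λ j → when (D j) (G i j)))))
    ∑∑-flip : ∀ (F : Fin nC → Fin nC → ℚ) → ∑∑ (λ i j → F j i) ≡ ∑∑ F
    ∑∑-flip F = trans (∑-cong {nC} (λ i → when-∑ (D i) (λ j → when (D j) (F j i))))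
      (trans (∑-swap {nC} {nC} (λ i j → when (D i) (when (D j) (F j i))))
        (∑-cong {nC} (λ j → trans (∑-cong {nC} (λ i → when-swap (D i) (D j) (F j i)))
                                  (sym (when-∑ (D j) (λ i → when (D i) (F j i)))))))
    ∑∑-col : ∀ h → ∑∑ (λ i j → h j) ≡ k * ∑ (λ j → when (D j) (h j))
    ∑∑-col h = trans
      (∑-cong {nC} (λ i → trans (when-* (D i) H) (*-comm (when (D i) 1ℚ) H)))
      (trans (∑-* H (λ i → when (D i) 1ℚ)) (*-comm H k))
      where
      H : ℚ
      H = ∑ (λ j → when (D j) (h j))
    ∑∑-row : ∀ h → ∑∑ (λ i j → h i) ≡ k * ∑ (λ j → when (D j) (h j))
    ∑∑-row h = trans (∑∑-flip (λ i j → h j)) (∑∑-col h)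
    ∑∑c : ∑∑ (λ i j → c i + c j) ≡ k * C + k * C
    ∑∑c = trans (∑∑-+ (λ i j → c i) (λ i j → c j)) (cong₂ _+_ (∑∑-row c) (∑∑-col c))
    ∑∑w≤ : ∑∑ w ≤ k * o f
    ∑∑w≤ = begin
      ∑∑ w
        ≤⟨ ∑-mono (λ i → when-mono (D i) (λ _ → ≤-trans
             (∑-mono (λ j → when-≤ (D j) (W-nonneg output-dual {i} j f refl))) (budget output-dual {i} f refl))) ⟩
      ∑ (λ i → when (D i) (o f))
        ≡⟨ ∑-cong {nC} (λ i → trans (when-* (D i) (o f)) (*-comm (when (D i) 1ℚ) (o f))) ⟩
      ∑ (λ i → o f * when (D i) 1ℚ)
        ≡⟨ trans (∑-* (o f) (λ i → when (D i) 1ℚ)) (*-comm (o f) k) ⟩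
      k * o f ∎
    k>0 : 0ℚ < k
    k>0 = <-≤-trans (positive⁻¹ 1ℚ) (1≤∑ D Di₀)
    collect : ∀ k x c → (k * x + k * x) + ((k * c + k * c) + (k * c + k * c)) ≡ (k + k) * (x + (c + c))
    collect k x c = solve (k ∷ x ∷ c ∷ []) ℚ-ring

-- Subsets through their characteristic functions

module _ {n : ℕ} where

  lookup⇒∈ : ∀ (S : Subset n) {x} → lookup S x ≡ true → x ∈ S
  lookup⇒∈ S {x} = lookup⇒[]= x S

  lookup⇒∉ : ∀ (S : Subset n) {x} → lookup S x ≡ false → x ∉ S
  lookup⇒∉ S eq x∈ = true≢false ([]=⇒lookup x∈) eq

  lookup-∪ : ∀ (S T : Subset n) {x} → lookup (S ∪ T) x ≡ true → lookup S x ≡ true ⊎ lookup T x ≡ true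
  lookup-∪ S T eq with SubsetP.x∈p∪q⁻ S T (lookup⇒∈ (S ∪ T) eq)
  ... | inj₁ x∈ = inj₁ ([]=⇒lookup x∈)
  ... | inj₂ x∈ = inj₂ ([]=⇒lookup x∈)

  lookup-∪ˡ : ∀ (S T : Subset n) {x} → lookup S x ≡ true → lookup (S ∪ T) x ≡ true
  lookup-∪ˡ S T eq = []=⇒lookup (SubsetP.p⊆p∪q T (lookup⇒∈ S eq))

  lookup-∪⁅⁆ : ∀ (S : Subset n) x → lookup (S ∪ ⁅ x ⁆) x ≡ true
  lookup-∪⁅⁆ S x = []=⇒lookup (SubsetP.q⊆p∪q S ⁅ x ⁆ (SubsetP.x∈⁅x⁆ x))

  lookup-⁅⁆ : ∀ {x y : Fin n} → lookup ⁅ y ⁆ x ≡ true → x ≡ y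
  lookup-⁅⁆ {x} {y} eq = SubsetP.x∈⁅y⁆⇒x≡y y (lookup⇒∈ ⁅ y ⁆ eq)

  lookup-∖ : ∀ (S : Subset n) {x y} → lookup S x ≡ true → x ≢ y → lookup (S ∖ y) x ≡ true
  lookup-∖ S eq x≢y = []=⇒lookup (SubsetP.x∈p∧x≢y⇒x∈p-y (lookup⇒∈ S eq) x≢y)

  lookup-∖⁻ : ∀ (S : Subset n) {x y} → lookup (S ∖ y) x ≡ true → lookup S x ≡ true
  lookup-∖⁻ S {y = y} eq = []=⇒lookup (SubsetP.p─q⊆p S ⁅ y ⁆ (lookup⇒∈ (S ∖ y) eq))

lookup-─ : ∀ {n} (S T : Subset n) x → lookup (S ─ T) x ≡ true → lookup T x ≡ false
lookup-─ (_ Vec.∷ _) (false Vec.∷ _) Fin.zero    _  = refl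
lookup-─ (_ Vec.∷ S) (_ Vec.∷ T)     (Fin.suc x) eq = lookup-─ S T x eq

lookup-∖-self : ∀ {n} (S : Subset n) {x y} → lookup (S ∖ y) x ≡ true → x ≢ y
lookup-∖-self S {x} {y} eq refl = true≢false ([]=⇒lookup (SubsetP.x∈⁅x⁆ y)) (lookup-─ S ⁅ y ⁆ y eq)

∣∣≤0 : ∀ {n} (S : Subset n) → (∀ x → lookup S x ≡ true → ⊥) → ∣ S ∣ ℕ.≤ 0
∣∣≤0 {n} S empty = ℕP.≤-reflexive (trans (cong ∣_∣ (SubsetP.Empty-unique {p = S} (λ (x , x∈) → empty x ([]=⇒lookup x∈)))) (SubsetP.∣⊥∣≡0 n))

∣∣≤1 : ∀ {n} (S : Subset n) y → (∀ x → lookup S x ≡ true → x ≡ y) → ∣ S ∣ ℕ.≤ 1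
∣∣≤1 S y only = subst (∣ S ∣ ℕ.≤_) (SubsetP.∣⁅x⁆∣≡1 y)
  (SubsetP.p⊆q⇒∣p∣≤∣q∣ {p = S} (λ {x} x∈ → subst (_∈ ⁅ y ⁆) (sym (only x ([]=⇒lookup x∈))) (SubsetP.x∈⁅x⁆ y)))

-- Captures

halves : ∀ x → ½ * x + ½ * x ≡ x
halves x = trans (sym (*-distribʳ-+ x ½ ½)) (*-identityˡ x)

half-nonneg : ∀ x → 0ℚ ≤ x → 0ℚ ≤ ½ * x
half-nonneg x h = subst (_≤ ½ * x) (*-zeroʳ ½) (*-monoˡ-≤-nonNeg ½ h)

½*x<x : ∀ x → 0ℚ < x → ½ * x < x
½*x<x x pos = subst (½ * x <_) (*-identityˡ x) (*-monoˡ-<-pos x {{positive pos}} {½} {1ℚ} (toWitness {a? = ½ <? 1ℚ} tt))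

module Capture {nC nF : ℕ} (cd : Fin nC → Fin nF → ℚ) (o : Fin nF → ℚ) where
  open UFL cd o

  served : (Fin nC → Fin nF) → Fin nF → ℚ
  served σ f = ∑ (λ j → when ⌊ σ j Fin.≟ f ⌋ 1ℚ)

  common : (Fin nC → Fin nF) → Fin nF → (Fin nC → Fin nF) → Fin nF → ℚ
  common σ f τ g = ∑ (λ j → when ⌊ τ j Fin.≟ g ⌋ (when ⌊ σ j Fin.≟ f ⌋ 1ℚ))

  served-count : ∀ σ f → ℕ→ℚ (servedCount σ f) ≡ served σ f
  served-count σ f = countWhere-sum (λ j → ⌊ σ j Fin.≟ f ⌋) clients

  common-count : ∀ σ f τ g → ℕ→ℚ (commonCount σ f τ g) ≡ common σ f τ g
  common-count σ f τ g = trans (countWhere-sum (λ j → ⌊ σ j Fin.≟ f ⌋ ∧ ⌊ τ j Fin.≟ g ⌋) clients)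
    (∑-cong {nC} (λ j → both ⌊ σ j Fin.≟ f ⌋ ⌊ τ j Fin.≟ g ⌋))
    where
    both : ∀ a b → when (a ∧ b) 1ℚ ≡ when b (when a 1ℚ)
    both true  b = refl
    both false b = sym (when-0 b)

  served-nonneg : ∀ σ f → 0ℚ ≤ served σ f
  served-nonneg σ f = ∑-nonneg (λ j → when-nonneg ⌊ σ j Fin.≟ f ⌋ (nonNegative⁻¹ 1ℚ))

  captures⁻ : ∀ {a σ f τ g} → Captures a σ f τ g → a * served τ g < common σ f τ g
  captures⁻ {a} {σ} {f} {τ} {g} = subst₂ _<_ (cong (a *_) (served-count τ g)) (common-count σ f τ g)

  captures⁺ : ∀ {a σ f τ g} → a * served τ g < common σ f τ g → Captures a σ f τ g
  captures⁺ {a} {σ} {f} {τ} {g} = subst₂ _<_ (sym (cong (a *_) (served-count τ g))) (sym (common-count σ f τ g))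

  captures-weaken : ∀ {a b σ f τ g} → b ≤ a → Captures a σ f τ g → Captures b σ f τ g
  captures-weaken {a} {b} {σ} {f} {τ} {g} b≤a c = captures⁺ {b} {σ} {f} {τ} {g}
    (≤-<-trans (*-monoʳ-≤-nonNeg (served τ g) {{nonNegative (served-nonneg τ g)}} b≤a)
      (captures⁻ {a} {σ} {f} {τ} {g} c))

  common-disjoint : ∀ σ {f₁ f₂} τ g → f₁ ≢ f₂ → common σ f₁ τ g + common σ f₂ τ g ≤ served τ g
  common-disjoint σ {f₁} {f₂} τ g f₁≢f₂ = ≤-trans
    (≤-reflexive (sym (∑-+ (λ j → when ⌊ τ j Fin.≟ g ⌋ (when ⌊ σ j Fin.≟ f₁ ⌋ 1ℚ))
                           (λ j → when ⌊ τ j Fin.≟ g ⌋ (when ⌊ σ j Fin.≟ f₂ ⌋ 1ℚ)))))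
    (∑-mono disjoint)
    where
    exclusive : ∀ a b {x} → 0ℚ ≤ x → a ∧ b ≡ false → when a x + when b x ≤ x
    exclusive true  false {x} _   _ = ≤-reflexive (+-identityʳ x)
    exclusive false true  {x} _   _ = ≤-reflexive (+-identityˡ x)
    exclusive false false {x} x≥0 _ = ≤-trans (≤-reflexive (+-identityˡ 0ℚ)) x≥0
    not-both : ∀ j → ⌊ σ j Fin.≟ f₁ ⌋ ∧ ⌊ σ j Fin.≟ f₂ ⌋ ≡ false
    not-both j with σ j Fin.≟ f₁ | σ j Fin.≟ f₂
    ... | yes eq₁ | yes eq₂ = ⊥-elim (f₁≢f₂ (trans (sym eq₁) eq₂))
    ... | yes _   | no _    = refl
    ... | no _    | _       = refl
    disjoint : ∀ j → when ⌊ τ j Fin.≟ g ⌋ (when ⌊ σ j Fin.≟ f₁ ⌋ 1ℚ) + when ⌊ τ j Fin.≟ g ⌋ (when ⌊ σ j Fin.≟ f₂ ⌋ 1ℚ)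
                     ≤ when ⌊ τ j Fin.≟ g ⌋ 1ℚ
    disjoint j = ≤-trans (≤-reflexive (sym (when-+ ⌊ τ j Fin.≟ g ⌋ (when ⌊ σ j Fin.≟ f₁ ⌋ 1ℚ) (when ⌊ σ j Fin.≟ f₂ ⌋ 1ℚ))))
      (when-mono ⌊ τ j Fin.≟ g ⌋ (λ _ → exclusive ⌊ σ j Fin.≟ f₁ ⌋ ⌊ σ j Fin.≟ f₂ ⌋ (nonNegative⁻¹ 1ℚ) (not-both j)))

  common-client : ∀ σ f τ g → (∃ λ j → σ j ≡ f × τ j ≡ g) ⊎ common σ f τ g ≡ 0ℚ
  common-client σ f τ g with argmin (λ j → ⌊ τ j Fin.≟ g ⌋ ∧ ⌊ σ j Fin.≟ f ⌋) (λ _ → 0ℚ)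
  ... | inj₂ (j , eq , _) = let τj , σj = ∧-true ⌊ τ j Fin.≟ g ⌋ eq
                            in inj₁ (j , ⌊⌋-true (σ j Fin.≟ f) σj , ⌊⌋-true (τ j Fin.≟ g) τj)
  ... | inj₁ none = inj₂ (trans (∑-cong {nC} (λ j → empty ⌊ τ j Fin.≟ g ⌋ ⌊ σ j Fin.≟ f ⌋ (none j))) (∑-0 nC))
    where
    empty : ∀ a b → a ∧ b ≡ false → when a (when b 1ℚ) ≡ 0ℚ
    empty true  false _ = refl
    empty false _     _ = refl

  -- Two distinct captors would together share more clients with `g` than it serves.
  ½-captor-unique : ∀ {σ f₁ f₂ τ g} → Captures ½ σ f₁ τ g → Captures ½ σ f₂ τ g → f₁ ≡ f₂
  ½-captor-unique {σ} {f₁} {f₂} {τ} {g} c₁ c₂ = decidable-stable (f₁ Fin.≟ f₂) (λ f₁≢f₂ → <-irrefl refl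
    (<-≤-trans (subst (_< common σ f₁ τ g + common σ f₂ τ g) (halves (served τ g))
                 (+-mono-< (captures⁻ {½} {σ} {f₁} {τ} {g} c₁) (captures⁻ {½} {σ} {f₂} {τ} {g} c₂)))
               (common-disjoint σ τ g f₁≢f₂)))

  captured-client : ∀ {σ f τ g} → Captures ½ σ f τ g → ∃ λ j → σ j ≡ f × τ j ≡ g
  captured-client {σ} {f} {τ} {g} c = [ id , (λ zero-common → ⊥-elim (<-irrefl refl
    (<-≤-trans (captures⁻ {½} {σ} {f} {τ} {g} c)
      (subst (_≤ ½ * served τ g) (sym zero-common) (half-nonneg (served τ g) (served-nonneg τ g)))))) ]′
    (common-client σ f τ g)

  -- All clients of `τ j` are shared, and there is at least one, namely `j`; this makes the
  -- inequality strict.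
  sole-captures : ∀ {σ f} (τ : Fin nC → Fin nF) j → (∀ i → σ i ≡ f) → Captures ½ σ f τ (τ j)
  sole-captures {σ} {f} τ j sole = captures⁺ {½} {σ} {f} {τ} {τ j} (begin-strict
    ½ * served τ (τ j)    <⟨ ½*x<x (served τ (τ j)) (<-≤-trans (positive⁻¹ 1ℚ) (1≤∑ (λ i → ⌊ τ i Fin.≟ τ j ⌋) (true⇒⌊⌋ (τ j Fin.≟ τ j) refl))) ⟩
    served τ (τ j)        ≡⟨ ∑-cong {nC} (λ i → cong (when ⌊ τ i Fin.≟ τ j ⌋)
                               (sym (cong (λ b → when b 1ℚ) (true⇒⌊⌋ (σ i Fin.≟ f) (sole i))))) ⟩
    common σ f τ (τ j)    ∎)
    where
    open ≤-Reasoning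

-- Charging the local moves to the clients

-- near j and opt j are the connection costs of j in the local optimum S and in the solution O,
-- and alt j is its connection cost in S without the facility σ' j.
module Charging {nC nF : ℕ} (o : Fin nF → ℚ) (S O : Fin nF → Bool) (σ' σ* : Fin nC → Fin nF)
  (near opt alt : Fin nC → ℚ) (cap : Fin nF → Fin nF → Bool) (matched : Fin nF → Bool)
  (o≥0 : ∀ f → 0ℚ ≤ o f) (opt≥0 : ∀ j → 0ℚ ≤ opt j)
  (σ'∈S : ∀ j → S (σ' j) ≡ true) (σ*∈O : ∀ j → O (σ* j) ≡ true)
  (cap-unique : ∀ {f g h} → cap f h ≡ true → cap g h ≡ true → f ≡ g)
  (cap-client : ∀ {f h} → cap f h ≡ true → ∃ λ j → σ' j ≡ f × σ* j ≡ h)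
  (cap-sole : ∀ {f} → (∀ i → σ' i ≡ f) → ∀ j → cap f (σ* j) ≡ true) where

  serves : Fin nF → Fin nC → Bool
  serves h j = ⌊ σ* j Fin.≟ h ⌋

  -- The bound on the cost change of j when its facility in O is opened.
  enter : Fin nC → ℚ
  enter j = if matched (σ* j)
            then (if cap (σ' j) (σ* j) then opt j - near j else 0ℚ ⊓ (opt j - near j))
            else (opt j + opt j) - near j

  leave : Fin nC → ℚ
  leave j = alt j - near j

  -- When `f` is closed, those of its clients whose facility in `O` is captured by `f` are accounted
  -- for by `enter`; only the others must find another facility of `S`.
  rerouting : Fin nF → Fin nC → ℚ
  rerouting f j = when (not (cap f (σ* j))) (leave j)

  enterCost : Fin nF → ℚ
  enterCost h = o h + ∑ (λ j → when (serves h j) (enter j))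

  -- The inequality derived from the move that closes f and opens the facilities captured by f.
  Closing : Fin nF → Set
  Closing f = o f ≤ ∑ (λ h → when (cap f h) (enterCost h)) + ∑ (λ j → when ⌊ σ' j Fin.≟ f ⌋ (rerouting f j))

  private
    2x-y : ∀ x y z → 0ℚ ≤ x → z ≤ x → z - y ≤ (x + x) - y
    2x-y x y z h₁ h₂ = ≤-by-difference (+-mono-≤ h₁ h₂) (solve (x ∷ y ∷ z ∷ []) ℚ-ring)

    nonpos : ∀ x y → x ≤ y → x - y ≤ 0ℚ
    nonpos x y h = ≤-by-difference h (solve (x ∷ y ∷ []) ℚ-ring)

    nonneg : ∀ x y → y ≤ x → 0ℚ ≤ x - y
    nonneg x y h = ≤-by-difference h (solve (x ∷ y ∷ []) ℚ-ring)

  -- The doubled `opt j` of a lonely facility leaves room for the dual bound. For a matched facility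
  -- not captured by `σ' j`, opening it does not close `σ' j`, so the client may stay where it is:
  -- this is the minimum with zero.
  ≤-enter : ∀ j x → x ≤ opt j → (cap (σ' j) (σ* j) ≡ false → x ≤ near j) → x - near j ≤ enter j
  ≤-enter j x x≤opt x≤near = bool-elim
    (λ m → x - near j ≤ (if m then (if cap (σ' j) (σ* j) then opt j - near j else 0ℚ ⊓ (opt j - near j))
                              else (opt j + opt j) - near j))
    (matched (σ* j))
    (λ _ → bool-elim (λ c → x - near j ≤ (if c then opt j - near j else 0ℚ ⊓ (opt j - near j))) (cap (σ' j) (σ* j))
      (λ _ → +-monoˡ-≤ (- near j) x≤opt)
      (λ uncaptured → ⊓-glb (nonpos x (near j) (x≤near uncaptured)) (+-monoˡ-≤ (- near j) x≤opt)))
    (λ _ → 2x-y (opt j) (near j) x (opt≥0 j) x≤opt)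

  enter-nonneg : ∀ j → near j ≤ opt j → 0ℚ ≤ enter j
  enter-nonneg j h = subst (_≤ enter j) (+-inverseʳ (near j)) (≤-enter j (near j) h (λ _ → ≤-refl))

  enter-lonely : ∀ j → matched (σ* j) ≡ false → enter j ≡ (opt j + opt j) - near j
  enter-lonely j = cong (λ m → if m then (if cap (σ' j) (σ* j) then opt j - near j else 0ℚ ⊓ (opt j - near j))
                                    else (opt j + opt j) - near j)

  enterCost-open : ∀ h → (∀ j → σ* j ≡ h → near j ≤ opt j) → 0ℚ ≤ enterCost h
  enterCost-open h near≤opt = +-mono-≤ (o≥0 h) (∑-nonneg term)
    where
    term : ∀ j → 0ℚ ≤ when (serves h j) (enter j)
    term j = dec-elim (λ b → 0ℚ ≤ when b (enter j)) (σ* j Fin.≟ h)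
      (λ eq → enter-nonneg j (near≤opt j eq)) (λ _ → ≤-refl)

  -- A local optimum gains nothing from one more facility. Nonnegativity of `enterCost` is later
  -- needed for the facilities of `O` that nobody captures.
  enterCost-add : ∀ h (a : Fin nC → ℚ) → (∀ j → a j ≤ near j) → (∀ j → σ* j ≡ h → a j ≤ opt j) →
    ∑ near ≤ o h + ∑ a → 0ℚ ≤ enterCost h
  enterCost-add h a a≤near a≤opt add = combine (∑ near) (o h) (∑ a) (∑ (λ j → when (serves h j) (enter j)))
    add (≤-trans (≤-reflexive (sym (∑-- a near))) (∑-mono term))
    where
    combine : ∀ n x a e → n ≤ x + a → a - n ≤ e → 0ℚ ≤ x + e
    combine n x a e h₁ h₂ = ≤-by-difference (+-mono-≤ h₁ h₂) (solve (n ∷ x ∷ a ∷ e ∷ []) ℚ-ring)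
    term : ∀ j → a j - near j ≤ when (serves h j) (enter j)
    term j = dec-elim (λ b → a j - near j ≤ when b (enter j)) (σ* j Fin.≟ h)
      (λ eq → ≤-enter j (a j) (a≤opt j eq) (λ _ → a≤near j)) (λ _ → nonpos (a j) (near j) (a≤near j))

  -- α bounds the connection costs after the move and q the opening costs paid beyond those in α.
  closing : ∀ f (α : Fin nC → ℚ) (q : Fin nF → ℚ) →
    o f + ∑ near ≤ ∑ q + ∑ α →
    (∀ j → σ' j ≢ f → α j ≤ near j) →
    (∀ j → σ' j ≡ f → cap f (σ* j) ≡ false → α j ≤ alt j) →
    (∀ h → cap f h ≡ true → q h + ∑ (λ j → when (serves h j) (α j - near j)) ≤ enterCost h) →
    (∀ h → cap f h ≡ false → q h ≤ 0ℚ) →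
    Closing f
  closing f α q total stay move paid unpaid = combine (o f) (∑ near) (∑ q) (∑ α)
    (∑ (λ h → when (cap f h) (enterCost h))) (∑ (λ j → when ⌊ σ' j Fin.≟ f ⌋ (rerouting f j)))
    (∑ (λ j → when (not (cap f (σ* j))) (change j))) (∑ (λ h → when (cap f h) (∑ (λ j → when (serves h j) (change j)))))
    total split
    (≤-trans (≤-reflexive (sym (∑-+ q (λ h → when (cap f h) (∑ (λ j → when (serves h j) (change j))))))) (∑-mono entering))
    (∑-mono leaving)
    where
    combine : ∀ x n q a e r s u → x + n ≤ q + a → a - n ≡ u + s → q + u ≤ e → s ≤ r → x ≤ e + r
    combine x n q a e r s u h₁ h₂ h₃ h₄ = ≤-by-difference (+-mono-≤ (+-mono-≤ h₁ (≤-reflexive h₂)) (+-mono-≤ h₃ h₄))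
      (solve (x ∷ n ∷ q ∷ a ∷ e ∷ r ∷ s ∷ u ∷ []) ℚ-ring)
    change : Fin nC → ℚ
    change j = α j - near j
    split-when : ∀ b x → x ≡ when b x + when (not b) x
    split-when true  x = sym (+-identityʳ x)
    split-when false x = sym (+-identityˡ x)
    fibre : ∀ h j → when (serves h j) (when (cap f (σ* j)) (change j)) ≡ when (cap f h) (when (serves h j) (change j))
    fibre h j = dec-elim (λ b → when b (when (cap f (σ* j)) (change j)) ≡ when (cap f h) (when b (change j)))
      (σ* j Fin.≟ h) (λ eq → cong (λ g → when (cap f g) (change j)) eq) (λ _ → sym (when-0 (cap f h)))
    -- The cost change is divided according to whether `f` captures the client's facility in `O`.
    -- The captured part is settled facility by facility, the rest client by client.
    split : ∑ α - ∑ near ≡ ∑ (λ h → when (cap f h) (∑ (λ j → when (serves h j) (change j))))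
                           + ∑ (λ j → when (not (cap f (σ* j))) (change j))
    split = begin
      ∑ α - ∑ near
        ≡⟨ sym (∑-- α near) ⟩
      ∑ change
        ≡⟨ ∑-cong {nC} (λ j → split-when (cap f (σ* j)) (change j)) ⟩
      ∑ (λ j → when (cap f (σ* j)) (change j) + when (not (cap f (σ* j))) (change j))
        ≡⟨ ∑-+ (λ j → when (cap f (σ* j)) (change j)) (λ j → when (not (cap f (σ* j))) (change j)) ⟩
      ∑ (λ j → when (cap f (σ* j)) (change j)) + ∑ (λ j → when (not (cap f (σ* j))) (change j))
        ≡⟨ cong (_+ ∑ (λ j → when (not (cap f (σ* j))) (change j)))
             (trans (∑-fibres σ* (λ j → when (cap f (σ* j)) (change j)))
               (∑-cong {nF} (λ h → trans (∑-cong {nC} (fibre h)) (sym (when-∑ (cap f h) (λ j → when (serves h j) (change j))))))) ⟩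
      ∑ (λ h → when (cap f h) (∑ (λ j → when (serves h j) (change j)))) + ∑ (λ j → when (not (cap f (σ* j))) (change j)) ∎
      where open ≡-Reasoning
    entering : ∀ h → q h + when (cap f h) (∑ (λ j → when (serves h j) (change j))) ≤ when (cap f h) (enterCost h)
    entering h = bool-elim
      (λ b → q h + when b (∑ (λ j → when (serves h j) (change j))) ≤ when b (enterCost h)) (cap f h)
      (paid h) (λ eq → ≤-trans (≤-reflexive (+-identityʳ (q h))) (unpaid h eq))
    leaving : ∀ j → when (not (cap f (σ* j))) (change j) ≤ when ⌊ σ' j Fin.≟ f ⌋ (rerouting f j)
    leaving j = bool-elim
      (λ b → when (not b) (change j) ≤ when ⌊ σ' j Fin.≟ f ⌋ (when (not b) (leave j))) (cap f (σ* j))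
      (λ _ → ≤-reflexive (sym (when-0 ⌊ σ' j Fin.≟ f ⌋)))
      (λ uncaptured → dec-elim (λ b → change j ≤ when b (leave j)) (σ' j Fin.≟ f)
        (λ eq → +-monoˡ-≤ (- near j) (move j eq uncaptured))
        (λ ≢f → nonpos (α j) (near j) (stay j ≢f)))

  -- No move is made. The cost `o f` already occurs inside `enterCost f`, and all other terms are
  -- nonnegative because `near` is the smallest distance to `S`, which contains `f`.
  closing-self : ∀ f → cap f f ≡ true → (∀ h → 0ℚ ≤ enterCost h) → (∀ j → σ* j ≡ f → near j ≤ opt j) →
    (∀ j → σ' j ≡ f → cap f (σ* j) ≡ false → near j ≤ alt j) → Closing f
  closing-self f self entry near≤opt near≤alt = begin
    o f
      ≡⟨ sym (trans (+-identityʳ _) (∑-point f o)) ⟩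
    ∑ (λ h → when ⌊ f Fin.≟ h ⌋ (o h)) + 0ℚ
      ≤⟨ +-mono-≤ (∑-mono opened) (∑-nonneg rerouted) ⟩
    ∑ (λ h → when (cap f h) (enterCost h)) + ∑ (λ j → when ⌊ σ' j Fin.≟ f ⌋ (rerouting f j)) ∎
    where
    open ≤-Reasoning
    enter-f : ∀ j → 0ℚ ≤ when (serves f j) (enter j)
    enter-f j = dec-elim (λ b → 0ℚ ≤ when b (enter j)) (σ* j Fin.≟ f)
      (λ eq → enter-nonneg j (near≤opt j eq)) (λ _ → ≤-refl)
    opened-f : o f ≤ when (cap f f) (enterCost f)
    opened-f = subst (λ b → o f ≤ when b (enterCost f)) (sym self)
      (≤-trans (≤-reflexive (sym (+-identityʳ (o f)))) (+-monoʳ-≤ (o f) (∑-nonneg enter-f)))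
    opened : ∀ h → when ⌊ f Fin.≟ h ⌋ (o h) ≤ when (cap f h) (enterCost h)
    opened h = dec-elim (λ b → when b (o h) ≤ when (cap f h) (enterCost h)) (f Fin.≟ h)
      (λ eq → subst (λ g → o g ≤ when (cap f g) (enterCost g)) eq opened-f)
      (λ _ → when-nonneg (cap f h) (entry h))
    rerouted : ∀ j → 0ℚ ≤ when ⌊ σ' j Fin.≟ f ⌋ (rerouting f j)
    rerouted j = dec-elim (λ b → 0ℚ ≤ when b (rerouting f j)) (σ' j Fin.≟ f)
      (λ eq → bool-elim (λ b → 0ℚ ≤ when (not b) (leave j)) (cap f (σ* j))
        (λ _ → ≤-refl) (λ uncaptured → nonneg (alt j) (near j) (near≤alt j eq uncaptured)))
      (λ _ → ≤-refl)

  charge : Fin nC → ℚ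
  charge j = enter j + rerouting (σ' j) j

  -- Every facility is captured at most once, and the uncaptured ones of O have enterCost ≥ 0.
  closing-total : (∀ h → 0ℚ ≤ enterCost h) → (∀ f → S f ≡ true → Closing f) →
    ∑ (λ f → when (S f) (o f)) ≤ ∑ (λ h → when (O h) (o h)) + ∑ charge
  closing-total entry close = begin
    ∑ (λ f → when (S f) (o f))
      ≤⟨ ∑-mono (λ f → when-mono (S f) (close f)) ⟩
    ∑ (λ f → when (S f) (Entering f + Rerouting f))
      ≡⟨ trans (∑-cong {nF} (λ f → when-+ (S f) (Entering f) (Rerouting f)))
               (∑-+ (λ f → when (S f) (Entering f)) (λ f → when (S f) (Rerouting f))) ⟩
    ∑ (λ f → when (S f) (Entering f)) + ∑ (λ f → when (S f) (Rerouting f))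
      ≤⟨ +-mono-≤ entering (≤-reflexive rerouting-total) ⟩
    ∑ (λ h → when (O h) (enterCost h)) + ∑ (λ j → rerouting (σ' j) j)
      ≡⟨ cong (_+ ∑ (λ j → rerouting (σ' j) j)) entering-total ⟩
    (∑ (λ h → when (O h) (o h)) + ∑ enter) + ∑ (λ j → rerouting (σ' j) j)
      ≡⟨ +-assoc (∑ (λ h → when (O h) (o h))) (∑ enter) (∑ (λ j → rerouting (σ' j) j)) ⟩
    ∑ (λ h → when (O h) (o h)) + (∑ enter + ∑ (λ j → rerouting (σ' j) j))
      ≡⟨ cong (∑ (λ h → when (O h) (o h)) +_) (sym (∑-+ enter (λ j → rerouting (σ' j) j))) ⟩
    ∑ (λ h → when (O h) (o h)) + ∑ charge ∎
    where
    open ≤-Reasoning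
    Entering Rerouting : Fin nF → ℚ
    Entering f  = ∑ (λ h → when (cap f h) (enterCost h))
    Rerouting f = ∑ (λ j → when ⌊ σ' j Fin.≟ f ⌋ (rerouting f j))

    captured-once : ∀ h → ∑ (λ f → when (S f) (when (cap f h) (enterCost h))) ≤ when (O h) (enterCost h)
    captured-once h = [ uncaptured , captured ]′ (argmin (λ f → cap f h) (λ _ → 0ℚ))
      where
      uncaptured : (∀ f → cap f h ≡ false) → ∑ (λ f → when (S f) (when (cap f h) (enterCost h))) ≤ when (O h) (enterCost h)
      uncaptured none = ≤-trans (≤-reflexive (trans (∑-cong {nF} term) (∑-0 nF))) (when-nonneg (O h) (entry h))
        where
        term : ∀ f → when (S f) (when (cap f h) (enterCost h)) ≡ 0ℚ
        term f = trans (cong (λ b → when (S f) (when b (enterCost h))) (none f)) (when-0 (S f))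
      captured : (∃ λ f₀ → cap f₀ h ≡ true × (∀ f → cap f h ≡ true → 0ℚ ≤ 0ℚ)) →
        ∑ (λ f → when (S f) (when (cap f h) (enterCost h))) ≤ when (O h) (enterCost h)
      captured (f₀ , cap₀ , _) = begin
        ∑ (λ f → when (S f) (when (cap f h) (enterCost h)))  ≤⟨ ∑-mono term ⟩
        ∑ (λ f → when ⌊ f₀ Fin.≟ f ⌋ (enterCost h))          ≡⟨ ∑-point f₀ (λ _ → enterCost h) ⟩
        enterCost h                                          ≡⟨ sym (cong (λ b → when b (enterCost h)) h∈O) ⟩
        when (O h) (enterCost h)                             ∎
        where
        -- Captures are defined for all facilities; a common client shows that a captured one lies
        -- in `O`.
        h∈O : O h ≡ true
        h∈O = let j , _ , eq = cap-client cap₀ in subst (λ h → O h ≡ true) eq (σ*∈O j)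
        term : ∀ f → when (S f) (when (cap f h) (enterCost h)) ≤ when ⌊ f₀ Fin.≟ f ⌋ (enterCost h)
        term f = bool-elim (λ b → when (S f) (when b (enterCost h)) ≤ when ⌊ f₀ Fin.≟ f ⌋ (enterCost h)) (cap f h)
          (λ cap-f → subst (λ b → when (S f) (enterCost h) ≤ when b (enterCost h))
            (sym (true⇒⌊⌋ (f₀ Fin.≟ f) (cap-unique cap₀ cap-f))) (when-≤ (S f) (entry h)))
          (λ _ → ≤-trans (≤-reflexive (when-0 (S f))) (when-nonneg ⌊ f₀ Fin.≟ f ⌋ (entry h)))

    entering : ∑ (λ f → when (S f) (Entering f)) ≤ ∑ (λ h → when (O h) (enterCost h))
    entering = begin
      ∑ (λ f → when (S f) (Entering f))
        ≡⟨ ∑-cong {nF} (λ f → when-∑ (S f) (λ h → when (cap f h) (enterCost h))) ⟩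
      ∑ (λ f → ∑ (λ h → when (S f) (when (cap f h) (enterCost h))))
        ≡⟨ ∑-swap {nF} {nF} (λ f h → when (S f) (when (cap f h) (enterCost h))) ⟩
      ∑ (λ h → ∑ (λ f → when (S f) (when (cap f h) (enterCost h))))
        ≤⟨ ∑-mono captured-once ⟩
      ∑ (λ h → when (O h) (enterCost h)) ∎

    rerouting-total : ∑ (λ f → when (S f) (Rerouting f)) ≡ ∑ (λ j → rerouting (σ' j) j)
    rerouting-total = trans (∑-cong {nF} (λ f → when-∑ (S f) (λ j → when ⌊ σ' j Fin.≟ f ⌋ (rerouting f j))))
      (trans (∑-swap {nF} {nC} (λ f j → when (S f) (when ⌊ σ' j Fin.≟ f ⌋ (rerouting f j))))
        (∑-cong {nC} (λ j → trans (∑-cong {nF} (own j)) (∑-point (σ' j) (λ f → rerouting f j)))))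
      where
      own : ∀ j f → when (S f) (when ⌊ σ' j Fin.≟ f ⌋ (rerouting f j)) ≡ when ⌊ σ' j Fin.≟ f ⌋ (rerouting f j)
      own j f = dec-elim (λ b → when (S f) (when b (rerouting f j)) ≡ when b (rerouting f j)) (σ' j Fin.≟ f)
        (λ eq → cong (λ b → when b (rerouting f j)) (trans (cong S (sym eq)) (σ'∈S j)))
        (λ _ → when-0 (S f))

    entering-total : ∑ (λ h → when (O h) (enterCost h)) ≡ ∑ (λ h → when (O h) (o h)) + ∑ enter
    entering-total = trans (∑-cong {nF} (λ h → when-+ (O h) (o h) (∑ (λ j → when (serves h j) (enter j)))))
      (trans (∑-+ (λ h → when (O h) (o h)) (λ h → when (O h) (∑ (λ j → when (serves h j) (enter j)))))
        (cong (∑ (λ h → when (O h) (o h)) +_)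
          (trans (∑-cong {nF} (λ h → trans (when-∑ (O h) (λ j → when (serves h j) (enter j))) (∑-cong {nC} (own h))))
                 (sym (∑-fibres σ* enter)))))
      where
      own : ∀ h j → when (O h) (when (serves h j) (enter j)) ≡ when (serves h j) (enter j)
      own h j = dec-elim (λ b → when (O h) (when b (enter j)) ≡ when b (enter j)) (σ* j Fin.≟ h)
        (λ eq → cong (λ b → when b (enter j)) (trans (cong O (sym eq)) (σ*∈O j)))
        (λ _ → when-0 (O h))

  module Rerouting (dF : Fin nF → Fin nF → ℚ) (κ : ℚ)
    (near≥0 : ∀ j → 0ℚ ≤ near j) (dF≥0 : ∀ h g → 0ℚ ≤ dF h g) (κ≥0 : 0ℚ ≤ κ)
    (alt≤ : ∀ j g → S g ≡ true → g ≢ σ' j → alt j ≤ opt j + dF (σ* j) g)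
    (near≤ : ∀ j g → S g ≡ true → near j ≤ opt j + dF (σ* j) g)
    (dF≤ : ∀ j → dF (σ* j) (σ' j) ≤ opt j + near j)
    (uncaptured-half : ∀ g h → cap g h ≡ false →
      ∑ (λ j → when (serves h j) (when ⌊ σ' j Fin.≟ g ⌋ 1ℚ)) + ∑ (λ j → when (serves h j) (when ⌊ σ' j Fin.≟ g ⌋ 1ℚ))
      ≤ ∑ (λ j → when (serves h j) 1ℚ))
    (mate : ∀ h → matched h ≡ true → ∃ λ f → cap f h ≡ true × S f ≡ true ×
      ∑ (λ j → when (serves h j) 1ℚ) ≤ (1ℚ + κ) * ∑ (λ j → when (serves h j) (when ⌊ σ' j Fin.≟ f ⌋ 1ℚ))) where

    -- After adding `near j` these become κ near + (1 + κ) opt and 4 opt, the client's terms in the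
    -- final inequality.
    matchedBound lonelyBound bound : Fin nC → ℚ
    matchedBound j = (opt j - near j) + κ * (opt j + near j)
    lonelyBound j  = ((opt j + opt j) - near j) + (opt j + opt j)
    bound j        = if matched (σ* j) then matchedBound j else lonelyBound j

    private
      served : ∀ {h j} → serves h j ≡ true → σ* j ≡ h
      served {h} {j} = ⌊⌋-true (σ* j Fin.≟ h)

      -- Clients of h not served by the facility g₀ of S closest to h are rerouted to g₀ and the
      -- others, at most half of them, to the second closest facility g₁.
      lonely-rerouting : ∀ h → ∑ (λ j → when (serves h j) (rerouting (σ' j) j)) ≤ ∑ (λ j → when (serves h j) (opt j + opt j))
      lonely-rerouting h = [ no-facility , with-closest ]′ (argmin S (dF h))
        where
        Goal : Set
        Goal = ∑ (λ j → when (serves h j) (rerouting (σ' j) j)) ≤ ∑ (λ j → when (serves h j) (opt j + opt j))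
        pointwise : (∀ j → serves h j ≡ true → rerouting (σ' j) j ≤ opt j + opt j) → Goal
        pointwise le = ∑-mono (λ j → when-mono (serves h j) (le j))
        no-facility : (∀ g → S g ≡ false) → Goal
        no-facility none = pointwise (λ j _ → ⊥-elim (true≢false (σ'∈S j) (none (σ' j))))
        with-closest : (∃ λ g₀ → S g₀ ≡ true × (∀ g → S g ≡ true → dF h g₀ ≤ dF h g)) → Goal
        with-closest (g₀ , g₀∈S , closest) = bool-elim (λ _ → Goal) (cap g₀ h) captured uncaptured
          where
          d₀ : ℚ
          d₀ = dF h g₀
          alt₀ : ∀ j → σ* j ≡ h → g₀ ≢ σ' j → alt j ≤ opt j + d₀
          alt₀ j eq ≢ = subst (λ h → alt j ≤ opt j + dF h g₀) eq (alt≤ j g₀ g₀∈S ≢)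
          dist-served : ∀ j → σ* j ≡ h → dF h (σ' j) ≤ opt j + near j
          dist-served j eq = subst (λ h → dF h (σ' j) ≤ opt j + near j) eq (dF≤ j)
          -- Here the clients of `h` at `g₀` need no rerouting, and `g₀` is available to all the
          -- others, for whom it is no farther from `h` than their present facility.
          captured : cap g₀ h ≡ true → Goal
          captured cap₀ = pointwise (λ j sj → bool-elim (λ b → when (not b) (leave j) ≤ opt j + opt j) (cap (σ' j) (σ* j))
            (λ _ → +-mono-≤ (opt≥0 j) (opt≥0 j))
            (λ uncap → combine (alt j) (near j) (opt j) d₀
              (alt₀ j (served sj) (λ eq → true≢false (subst₂ (λ f h → cap f h ≡ true) eq (sym (served sj)) cap₀) uncap))
              (≤-trans (closest (σ' j) (σ'∈S j)) (dist-served j (served sj)))))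
            where
            combine : ∀ a n p d → a ≤ p + d → d ≤ p + n → a - n ≤ p + p
            combine a n p d h₁ h₂ = ≤-by-difference (+-mono-≤ h₁ h₂) (solve (a ∷ n ∷ p ∷ d ∷ []) ℚ-ring)
          uncaptured : cap g₀ h ≡ false → Goal
          uncaptured uncap₀ = [ sole , with-second ]′ (argmin (λ g → S g ∧ not ⌊ g₀ Fin.≟ g ⌋) (dF h))
            where
            sole : (∀ g → S g ∧ not ⌊ g₀ Fin.≟ g ⌋ ≡ false) → Goal
            sole none = pointwise (λ j sj → ⊥-elim
              (true≢false (subst (λ h → cap g₀ h ≡ true) (served sj) (cap-sole only j)) uncap₀))
              where
              only : ∀ i → σ' i ≡ g₀
              only i = sym (⌊⌋-true (g₀ Fin.≟ σ' i) (not-false (trans (cong (_∧ not ⌊ g₀ Fin.≟ σ' i ⌋) (sym (σ'∈S i))) (none (σ' i)))))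
            with-second : (∃ λ g₁ → S g₁ ∧ not ⌊ g₀ Fin.≟ g₁ ⌋ ≡ true ×
                            (∀ g → S g ∧ not ⌊ g₀ Fin.≟ g ⌋ ≡ true → dF h g₁ ≤ dF h g)) → Goal
            with-second (g₁ , second , next-closest) =
              -- The weight is +1 at `g₀` and -1 elsewhere: having to use the second closest
              -- facility costs up to `d₁ - d₀` more than 2 opt, and each client elsewhere has that
              -- much to spare.
              ∑-when-transfer (serves h) (λ j → rerouting (σ' j) j) (λ j → opt j + opt j)
                (λ j → - 1ℚ + (1ℚ + 1ℚ) * when ⌊ σ' j Fin.≟ g₀ ⌋ 1ℚ) (d₁ - d₀) (nonneg d₁ d₀ (closest g₁ g₁∈S))
                balance term
              where
              d₁ : ℚ
              d₁ = dF h g₁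
              g₁∈S : S g₁ ≡ true
              g₁∈S = proj₁ (∧-true (S g₁) second)
              g₀≢g₁ : g₀ ≢ g₁
              g₀≢g₁ = ⌊⌋-false (g₀ Fin.≟ g₁) (not-true (proj₂ (∧-true (S g₁) second)))
              balance : ∑ (λ j → when (serves h j) (- 1ℚ + (1ℚ + 1ℚ) * when ⌊ σ' j Fin.≟ g₀ ⌋ 1ℚ)) ≤ 0ℚ
              balance = ≤-trans (≤-reflexive (∑-when-affine (serves h) (- 1ℚ) (1ℚ + 1ℚ) (λ j → when ⌊ σ' j Fin.≟ g₀ ⌋ 1ℚ)))
                (combine (∑ (λ j → when (serves h j) 1ℚ)) (∑ (λ j → when (serves h j) (when ⌊ σ' j Fin.≟ g₀ ⌋ 1ℚ)))
                  (uncaptured-half g₀ h uncap₀))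
                where
                combine : ∀ n m → m + m ≤ n → (- 1ℚ) * n + (1ℚ + 1ℚ) * m ≤ 0ℚ
                combine n m h = ≤-by-difference h (solve (n ∷ m ∷ []) ℚ-ring)
              far : ∀ j → σ* j ≡ h → σ' j ≢ g₀ → d₁ ≤ opt j + near j
              far j eq ≢ = ≤-trans (next-closest (σ' j) (cong₂ (λ a b → a ∧ not b) (σ'∈S j) (false⇒⌊⌋ (g₀ Fin.≟ σ' j) (≢ ∘ sym))))
                                   (dist-served j eq)
              own : ∀ j → σ* j ≡ h → σ' j ≡ g₀ → d₀ ≤ opt j + near j
              own j eq eq′ = subst (λ g → dF h g ≤ opt j + near j) eq′ (dist-served j eq)
              term : ∀ j → serves h j ≡ true →
                rerouting (σ' j) j ≤ (opt j + opt j) + (- 1ℚ + (1ℚ + 1ℚ) * when ⌊ σ' j Fin.≟ g₀ ⌋ 1ℚ) * (d₁ - d₀)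
              term j sj = dec-elim (λ b → rerouting (σ' j) j ≤ (opt j + opt j) + (- 1ℚ + (1ℚ + 1ℚ) * when b 1ℚ) * (d₁ - d₀))
                (σ' j Fin.≟ g₀)
                (λ at-g₀ → bool-elim (λ b → when (not b) (leave j) ≤ (opt j + opt j) + (- 1ℚ + (1ℚ + 1ℚ) * 1ℚ) * (d₁ - d₀))
                  (cap (σ' j) (σ* j))
                  (λ _ → stay₀ (opt j) d₀ d₁ (opt≥0 j) (closest g₁ g₁∈S))
                  (λ _ → move₀ (alt j) (near j) (opt j) d₀ d₁
                    (subst (λ h → alt j ≤ opt j + dF h g₁) (served sj) (alt≤ j g₁ g₁∈S (λ eq → g₀≢g₁ (sym (trans eq at-g₀)))))
                    (own j (served sj) at-g₀)))
                (λ ≢g₀ → bool-elim (λ b → when (not b) (leave j) ≤ (opt j + opt j) + (- 1ℚ + (1ℚ + 1ℚ) * 0ℚ) * (d₁ - d₀))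
                  (cap (σ' j) (σ* j))
                  -- A client that is not rerouted must still provide its credit: `near j` is at
                  -- most `opt j + d₀`, whence `d₁ - d₀` is at most 2 opt.
                  (λ _ → stay₁ (near j) (opt j) d₀ d₁ (subst (λ h → near j ≤ opt j + dF h g₀) (served sj) (near≤ j g₀ g₀∈S))
                    (far j (served sj) ≢g₀))
                  (λ _ → move₁ (alt j) (near j) (opt j) d₀ d₁ (alt₀ j (served sj) (≢g₀ ∘ sym)) (far j (served sj) ≢g₀)))
                where
                stay₀ : ∀ p d₀ d₁ → 0ℚ ≤ p → d₀ ≤ d₁ → 0ℚ ≤ (p + p) + (- 1ℚ + (1ℚ + 1ℚ) * 1ℚ) * (d₁ - d₀)
                stay₀ p d₀ d₁ h₁ h₂ = ≤-by-difference (+-mono-≤ (+-mono-≤ h₁ h₁) h₂) (solve (p ∷ d₀ ∷ d₁ ∷ []) ℚ-ring)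
                move₀ : ∀ a n p d₀ d₁ → a ≤ p + d₁ → d₀ ≤ p + n → a - n ≤ (p + p) + (- 1ℚ + (1ℚ + 1ℚ) * 1ℚ) * (d₁ - d₀)
                move₀ a n p d₀ d₁ h₁ h₂ = ≤-by-difference (+-mono-≤ h₁ h₂) (solve (a ∷ n ∷ p ∷ d₀ ∷ d₁ ∷ []) ℚ-ring)
                stay₁ : ∀ n p d₀ d₁ → n ≤ p + d₀ → d₁ ≤ p + n → 0ℚ ≤ (p + p) + (- 1ℚ + (1ℚ + 1ℚ) * 0ℚ) * (d₁ - d₀)
                stay₁ n p d₀ d₁ h₁ h₂ = ≤-by-difference (+-mono-≤ h₁ h₂) (solve (n ∷ p ∷ d₀ ∷ d₁ ∷ []) ℚ-ring)
                move₁ : ∀ a n p d₀ d₁ → a ≤ p + d₀ → d₁ ≤ p + n → a - n ≤ (p + p) + (- 1ℚ + (1ℚ + 1ℚ) * 0ℚ) * (d₁ - d₀)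
                move₁ a n p d₀ d₁ h₁ h₂ = ≤-by-difference (+-mono-≤ h₁ h₂) (solve (a ∷ n ∷ p ∷ d₀ ∷ d₁ ∷ []) ℚ-ring)

      when-bound : ∀ h {b} (x : Fin nC → ℚ) → matched h ≡ b → (∀ j → (if b then matchedBound j else lonelyBound j) ≡ x j) →
        ∀ j → when (serves h j) (x j) ≡ when (serves h j) (bound j)
      when-bound h {b} x eq-h eq-x j = dec-elim (λ c → when c (x j) ≡ when c (bound j)) (σ* j Fin.≟ h)
        (λ eq → trans (sym (eq-x j)) (cong (λ m → if m then matchedBound j else lonelyBound j) (trans (sym eq-h) (cong matched (sym eq)))))
        (λ _ → refl)

      lonely-charge : ∀ h → matched h ≡ false → ∑ (λ j → when (serves h j) (charge j)) ≤ ∑ (λ j → when (serves h j) (bound j))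
      lonely-charge h lonely = begin
        ∑ (λ j → when (serves h j) (charge j))
          ≡⟨ ∑-cong {nC} split ⟩
        ∑ (λ j → when (serves h j) ((opt j + opt j) - near j) + when (serves h j) (rerouting (σ' j) j))
          ≡⟨ ∑-+ (λ j → when (serves h j) ((opt j + opt j) - near j)) (λ j → when (serves h j) (rerouting (σ' j) j)) ⟩
        ∑ (λ j → when (serves h j) ((opt j + opt j) - near j)) + ∑ (λ j → when (serves h j) (rerouting (σ' j) j))
          ≤⟨ +-monoʳ-≤ (∑ (λ j → when (serves h j) ((opt j + opt j) - near j))) (lonely-rerouting h) ⟩
        ∑ (λ j → when (serves h j) ((opt j + opt j) - near j)) + ∑ (λ j → when (serves h j) (opt j + opt j))
          ≡⟨ sym (∑-+ (λ j → when (serves h j) ((opt j + opt j) - near j)) (λ j → when (serves h j) (opt j + opt j))) ⟩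
        ∑ (λ j → when (serves h j) ((opt j + opt j) - near j) + when (serves h j) (opt j + opt j))
          ≡⟨ ∑-cong {nC} (λ j → sym (when-+ (serves h j) ((opt j + opt j) - near j) (opt j + opt j))) ⟩
        ∑ (λ j → when (serves h j) (lonelyBound j))
          ≡⟨ ∑-cong {nC} (when-bound h lonelyBound lonely (λ _ → refl)) ⟩
        ∑ (λ j → when (serves h j) (bound j)) ∎
        where
        open ≤-Reasoning
        split : ∀ j → when (serves h j) (charge j)
                      ≡ when (serves h j) ((opt j + opt j) - near j) + when (serves h j) (rerouting (σ' j) j)
        split j = trans (when-+ (serves h j) (enter j) (rerouting (σ' j) j))
          (cong (_+ when (serves h j) (rerouting (σ' j) j))
            (dec-elim (λ c → when c (enter j) ≡ when c ((opt j + opt j) - near j)) (σ* j Fin.≟ h)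
              (λ eq → enter-lonely j (trans (cong matched eq) lonely))
              (λ _ → refl)))

      -- The clients of h outside the mate f are rerouted to f; they are few, so that their detours
      -- through h can be charged to the clients in common.
      matched-charge : ∀ h → matched h ≡ true → ∑ (λ j → when (serves h j) (charge j)) ≤ ∑ (λ j → when (serves h j) (bound j))
      matched-charge h is-matched = by-mate (mate h is-matched)
        where
        by-mate : (∃ λ f → cap f h ≡ true × S f ≡ true ×
          ∑ (λ j → when (serves h j) 1ℚ) ≤ (1ℚ + κ) * ∑ (λ j → when (serves h j) (when ⌊ σ' j Fin.≟ f ⌋ 1ℚ))) →
          ∑ (λ j → when (serves h j) (charge j)) ≤ ∑ (λ j → when (serves h j) (bound j))
        by-mate (f , cap-f , f∈S , most) = ≤-trans
          -- The weight is -κ for a client at the mate and 1 otherwise. A detour exceeds the bound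
          -- by at most one `dF h f`, and a common client can give up κ times this distance because
          -- it is at most `opt j + near j`.
          (∑-when-transfer (serves h) charge matchedBound (λ j → 1ℚ + (- (1ℚ + κ)) * when ⌊ σ' j Fin.≟ f ⌋ 1ℚ) (dF h f) (dF≥0 h f)
            balance term)
          (≤-reflexive (∑-cong {nC} (when-bound h matchedBound is-matched (λ _ → refl))))
          where
          balance : ∑ (λ j → when (serves h j) (1ℚ + (- (1ℚ + κ)) * when ⌊ σ' j Fin.≟ f ⌋ 1ℚ)) ≤ 0ℚ
          balance = ≤-trans (≤-reflexive (∑-when-affine (serves h) 1ℚ (- (1ℚ + κ)) (λ j → when ⌊ σ' j Fin.≟ f ⌋ 1ℚ)))
            (combine κ (∑ (λ j → when (serves h j) 1ℚ)) (∑ (λ j → when (serves h j) (when ⌊ σ' j Fin.≟ f ⌋ 1ℚ))) most)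
            where
            combine : ∀ k n m → n ≤ (1ℚ + k) * m → 1ℚ * n + (- (1ℚ + k)) * m ≤ 0ℚ
            combine k n m h = ≤-by-difference h (solve (k ∷ n ∷ m ∷ []) ℚ-ring)
          enter-matched : ∀ j b → σ* j ≡ h → cap (σ' j) h ≡ b → enter j ≡ (if b then opt j - near j else 0ℚ ⊓ (opt j - near j))
          enter-matched j b eq eq-b = cong₂
            (λ m c → if m then (if c then opt j - near j else 0ℚ ⊓ (opt j - near j)) else (opt j + opt j) - near j)
            (trans (cong matched eq) is-matched) (trans (cong (cap (σ' j)) eq) eq-b)
          rerouting-matched : ∀ j b → σ* j ≡ h → cap (σ' j) h ≡ b → rerouting (σ' j) j ≡ when (not b) (leave j)
          rerouting-matched j b eq eq-b = cong (λ c → when (not c) (leave j)) (trans (cong (cap (σ' j)) eq) eq-b)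
          charge-matched : ∀ j b → σ* j ≡ h → cap (σ' j) h ≡ b →
            charge j ≡ (if b then opt j - near j else 0ℚ ⊓ (opt j - near j)) + when (not b) (leave j)
          charge-matched j b eq eq-b = cong₂ _+_ (enter-matched j b eq eq-b) (rerouting-matched j b eq eq-b)
          term : ∀ j → serves h j ≡ true →
            charge j ≤ matchedBound j + (1ℚ + (- (1ℚ + κ)) * when ⌊ σ' j Fin.≟ f ⌋ 1ℚ) * dF h f
          term j sj = dec-elim (λ b → charge j ≤ matchedBound j + (1ℚ + (- (1ℚ + κ)) * when b 1ℚ) * dF h f) (σ' j Fin.≟ f)
            (λ at-f → ≤-trans (≤-reflexive (charge-matched j true (served sj) (trans (cong (λ g → cap g h) at-f) cap-f)))
              (common-case κ (opt j) (near j) (dF h f) (*-monoˡ-≤-nonNeg κ {{nonNegative κ≥0}}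
                (subst₂ (λ h g → dF h g ≤ opt j + near j) (served sj) at-f (dF≤ j)))))
            (λ ≢f → ≤-trans (≤-reflexive (charge-matched j false (served sj) (other j ≢f)))
              -- This client is charged both for opening `h` and for closing its own facility. The
              -- minimum with zero in `enter` prevents the first charge from adding to the detour.
              (other-case κ (opt j) (near j) (alt j) (dF h f) (0ℚ ⊓ (opt j - near j)) (p⊓q≤p 0ℚ (opt j - near j))
                (subst (λ h → alt j ≤ opt j + dF h f) (served sj) (alt≤ j f f∈S (≢f ∘ sym)))
                (subst (_≤ κ * (opt j + near j)) (*-zeroʳ κ)
                  (*-monoˡ-≤-nonNeg κ {{nonNegative κ≥0}} (+-mono-≤ (opt≥0 j) (near≥0 j))))))
            where
            other : ∀ j → σ' j ≢ f → cap (σ' j) h ≡ false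
            other j ≢f = bool-elim (λ b → cap (σ' j) h ≡ b → b ≡ false) (cap (σ' j) h)
              (λ _ eq → ⊥-elim (≢f (cap-unique eq cap-f))) (λ _ _ → refl) refl
            common-case : ∀ k p n d → k * d ≤ k * (p + n) →
              (p - n) + 0ℚ ≤ ((p - n) + k * (p + n)) + (1ℚ + (- (1ℚ + k)) * 1ℚ) * d
            common-case k p n d h = ≤-by-difference h (solve (k ∷ p ∷ n ∷ d ∷ []) ℚ-ring)
            other-case : ∀ k p n a d m → m ≤ 0ℚ → a ≤ p + d → 0ℚ ≤ k * (p + n) →
              m + (a - n) ≤ ((p - n) + k * (p + n)) + (1ℚ + (- (1ℚ + k)) * 0ℚ) * d
            other-case k p n a d m h₁ h₂ h₃ = ≤-by-difference (+-mono-≤ (+-mono-≤ h₁ h₂) h₃)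
              (solve (k ∷ p ∷ n ∷ a ∷ d ∷ m ∷ []) ℚ-ring)

    charge-total : ∑ charge ≤ ∑ bound
    charge-total = subst₂ _≤_ (sym (∑-fibres σ* charge)) (sym (∑-fibres σ* bound))
      (∑-mono (λ h → bool-elim (λ _ → ∑ (λ j → when (serves h j) (charge j)) ≤ ∑ (λ j → when (serves h j) (bound j)))
        (matched h) (matched-charge h) (lonely-charge h)))

-- Local optima

when-cover : ∀ b c d {x} → 0ℚ ≤ x → (b ≡ true → c ≡ true ⊎ d ≡ true) → when b x ≤ when c x + when d x
when-cover false c     d     x≥0 _ = +-mono-≤ (when-nonneg c x≥0) (when-nonneg d x≥0)
when-cover true  true  d {x} x≥0 _ = ≤-trans (≤-reflexive (sym (+-identityʳ x))) (+-monoʳ-≤ x (when-nonneg d x≥0))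
when-cover true  false true  x≥0 _ = ≤-reflexive (sym (+-identityˡ _))
when-cover true  false false x≥0 h with h refl
... | inj₁ ()
... | inj₂ ()

when-pack : ∀ b c d {x} → 0ℚ ≤ x → (c ≡ true → b ≡ true) → (d ≡ true → b ≡ true) → (c ≡ true → d ≡ true → ⊥) →
  when c x + when d x ≤ when b x
when-pack b     true  true  x≥0 _ _ h = ⊥-elim (h refl refl)
when-pack b     false false x≥0 _ _ _ = ≤-trans (≤-reflexive (+-identityˡ 0ℚ)) (when-nonneg b x≥0)
when-pack true  true  false x≥0 _ _ _ = ≤-reflexive (+-identityʳ _)
when-pack true  false true  x≥0 _ _ _ = ≤-reflexive (+-identityˡ _)
when-pack false true  false x≥0 h _ _ with () ← h refl
when-pack false false true  x≥0 _ h _ with () ← h refl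

extended : ∀ {nF} → (Fin nF → ℚ) → Subset nF → Fin nF → ℚ
extended o X f = if lookup X f then 0ℚ else o f

extended-∈ : ∀ {nF} (o : Fin nF → ℚ) (X : Subset nF) {f} → lookup X f ≡ true → extended o X f ≡ 0ℚ
extended-∈ o X {f} = cong (λ b → if b then 0ℚ else o f)

module _ {nF : ℕ} (o : Fin nF → ℚ) (o≥0 : ∀ f → 0ℚ ≤ o f) where

  extended-nonneg : ∀ X f → 0ℚ ≤ extended o X f
  extended-nonneg X f = bool-elim (λ b → 0ℚ ≤ (if b then 0ℚ else o f)) (lookup X f) (λ _ → ≤-refl) (λ _ → o≥0 f)

  extended-≤ : ∀ X f → extended o X f ≤ o f
  extended-≤ X f = bool-elim (λ b → (if b then 0ℚ else o f) ≤ o f) (lookup X f) (λ _ → o≥0 f) (λ _ → ≤-refl)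

module _ {nC nF : ℕ} (cd : Fin nC → Fin nF → ℚ) (o : Fin nF → ℚ) (o≥0 : ∀ f → 0ℚ ≤ o f) where
  open UFL cd o

  openCost-nonneg : ∀ S → 0ℚ ≤ openCost S
  openCost-nonneg S = subst (0ℚ ≤_) (sym (openCost-∑ cd o S)) (∑-nonneg (λ f → when-nonneg (lookup S f) (o≥0 f)))

  openCost-∪⁅⁆ : ∀ S h → openCost (S ∪ ⁅ h ⁆) ≤ openCost S + o h
  openCost-∪⁅⁆ S h = begin
    openCost (S ∪ ⁅ h ⁆)
      ≡⟨ openCost-∑ cd o (S ∪ ⁅ h ⁆) ⟩
    ∑ (λ g → when (lookup (S ∪ ⁅ h ⁆) g) (o g))
      ≤⟨ ∑-mono (λ g → when-cover (lookup (S ∪ ⁅ h ⁆) g) (lookup S g) ⌊ h Fin.≟ g ⌋ (o≥0 g) (cover g)) ⟩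
    ∑ (λ g → when (lookup S g) (o g) + when ⌊ h Fin.≟ g ⌋ (o g))
      ≡⟨ ∑-+ (λ g → when (lookup S g) (o g)) (λ g → when ⌊ h Fin.≟ g ⌋ (o g)) ⟩
    ∑ (λ g → when (lookup S g) (o g)) + ∑ (λ g → when ⌊ h Fin.≟ g ⌋ (o g))
      ≡⟨ cong₂ _+_ (sym (openCost-∑ cd o S)) (∑-point h o) ⟩
    openCost S + o h ∎
    where
    open ≤-Reasoning
    cover : ∀ g → lookup (S ∪ ⁅ h ⁆) g ≡ true → lookup S g ≡ true ⊎ ⌊ h Fin.≟ g ⌋ ≡ true
    cover g eq = [ inj₁ , (λ eq′ → inj₂ (true⇒⌊⌋ (h Fin.≟ g) (sym (lookup-⁅⁆ {x = g} {y = h} eq′)))) ]′ (lookup-∪ S ⁅ h ⁆ eq)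

  openCost-∖ : ∀ S {f} → lookup S f ≡ true → openCost (S ∖ f) + o f ≤ openCost S
  openCost-∖ S {f} f∈S = begin
    openCost (S ∖ f) + o f
      ≡⟨ cong₂ _+_ (openCost-∑ cd o (S ∖ f)) (sym (∑-point f o)) ⟩
    ∑ (λ g → when (lookup (S ∖ f) g) (o g)) + ∑ (λ g → when ⌊ f Fin.≟ g ⌋ (o g))
      ≡⟨ sym (∑-+ (λ g → when (lookup (S ∖ f) g) (o g)) (λ g → when ⌊ f Fin.≟ g ⌋ (o g))) ⟩
    ∑ (λ g → when (lookup (S ∖ f) g) (o g) + when ⌊ f Fin.≟ g ⌋ (o g))
      ≤⟨ ∑-mono (λ g → when-pack (lookup S g) (lookup (S ∖ f) g) ⌊ f Fin.≟ g ⌋ (o≥0 g) (lookup-∖⁻ S)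
           (λ eq → subst (λ g → lookup S g ≡ true) (⌊⌋-true (f Fin.≟ g) eq) f∈S)
           (λ eq eq′ → lookup-∖-self S eq (sym (⌊⌋-true (f Fin.≟ g) eq′)))) ⟩
    ∑ (λ g → when (lookup S g) (o g))
      ≡⟨ sym (openCost-∑ cd o S) ⟩
    openCost S ∎
    where open ≤-Reasoning

  -- Whatever the modified instance gives away for free lies in `X`, so paying for all of `X` makes
  -- up for it.
  openCost-extended : ∀ X S → openCost S ≤ openCost X + UFL.openCost cd (extended o X) S
  openCost-extended X S = begin
    openCost S
      ≡⟨ openCost-∑ cd o S ⟩
    ∑ (λ f → when (lookup S f) (o f))
      ≤⟨ ∑-mono (λ f → term (lookup S f) (lookup X f) (o≥0 f)) ⟩
    ∑ (λ f → when (lookup X f) (o f) + when (lookup S f) (extended o X f))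
      ≡⟨ ∑-+ (λ f → when (lookup X f) (o f)) (λ f → when (lookup S f) (extended o X f)) ⟩
    ∑ (λ f → when (lookup X f) (o f)) + ∑ (λ f → when (lookup S f) (extended o X f))
      ≡⟨ cong₂ _+_ (sym (openCost-∑ cd o X)) (sym (openCost-∑ cd (extended o X) S)) ⟩
    openCost X + UFL.openCost cd (extended o X) S ∎
    where
    open ≤-Reasoning
    term : ∀ b c {x} → 0ℚ ≤ x → when b x ≤ when c x + when b (if c then 0ℚ else x)
    term b true  {x} x≥0 = ≤-trans (when-≤ b x≥0) (≤-reflexive (sym (trans (cong (x +_) (when-0 b)) (+-identityʳ x))))
    term b false {x} x≥0 = ≤-reflexive (sym (+-identityˡ (when b x)))

module Metric {nC nF : ℕ} {dist : Point nC nF → Point nC nF → ℚ} (metric : IsMetric dist) where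
  open IsMetric metric

  cd : Fin nC → Fin nF → ℚ
  cd = cdist dist

  dF : Fin nF → Fin nF → ℚ
  dF h g = dist (inj₂ h) (inj₂ g)

  cd-nonneg : ∀ j f → 0ℚ ≤ cd j f
  cd-nonneg j f = nonneg (inj₁ j) (inj₂ f)

  cd-via : ∀ j h g → cd j g ≤ cd j h + dF h g
  cd-via j h g = triangle (inj₁ j) (inj₂ h) (inj₂ g)

  dF-via : ∀ j h g → dF h g ≤ cd j h + cd j g
  dF-via j h g = subst (λ d → dF h g ≤ d + cd j g) (symm (inj₂ h) (inj₁ j)) (triangle (inj₂ h) (inj₁ j) (inj₂ g))

  detour : ∀ i j f g → cd i g ≤ cd i f + cd j f + cd j g
  detour i j f g = combine (cd i g) (cd i f) (cd j f) (cd j g) (dF f g) (cd-via i f g) (dF-via j f g)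
    where
    combine : ∀ x a b c d → x ≤ a + d → d ≤ b + c → x ≤ a + b + c
    combine x a b c d h₁ h₂ = ≤-by-difference (+-mono-≤ h₁ h₂) (solve (x ∷ a ∷ b ∷ c ∷ d ∷ []) ℚ-ring)

-- The summand 1 alone admits such a move; from 1/ε only nonnegativity is used.
small-size : ∀ {ε k m} → 0ℚ < ε → k ℕ.+ m ℕ.≤ 1 → ℕ→ℚ (k ℕ.+ m) ≤ divQ 1ℚ ε + 1ℚ
small-size {ε} {k} {m} ε>0 size = ≤-trans (ℕ→ℚ≤1 (k ℕ.+ m) size)
  (≤-trans (≤-reflexive (sym (+-identityˡ 1ℚ))) (+-monoˡ-≤ 1ℚ
    (*-cancelˡ-≤-pos ε {{positive ε>0}} (subst₂ _≤_ (sym (*-zeroʳ ε)) (sym (*-divQ 1ℚ (λ eq → <-irrefl (sym eq) ε>0))) (nonNegative⁻¹ 1ℚ)))))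
  where
  ℕ→ℚ≤1 : ∀ n → n ℕ.≤ 1 → ℕ→ℚ n ≤ 1ℚ
  ℕ→ℚ≤1 zero          _ = nonNegative⁻¹ 1ℚ
  ℕ→ℚ≤1 (suc zero)    _ = ≤-refl
  ℕ→ℚ≤1 (suc (suc _)) (ℕ.s≤s ())

module LocalMoves {nC nF : ℕ} (cd : Fin nC → Fin nF → ℚ) (o : Fin nF → ℚ) (ε : ℚ) (ε>0 : 0ℚ < ε) (S : Subset nF)
  (stuck : ∀ S'' → ¬ LocalSearch.Move cd o ε S S'') where
  open UFL cd o
  open LocalSearch cd o ε using (small; extend)

  add-move : ∀ {h} → lookup S h ≡ false → cost S ≤ cost (S ∪ ⁅ h ⁆)
  add-move {h} h∉S = ≮⇒≥ (λ better → stuck (S ∪ ⁅ h ⁆)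
    (small (h , lookup⇒∈ (S ∪ ⁅ h ⁆) (lookup-∪⁅⁆ S h)) better
      (small-size {ε} {∣ (S ∪ ⁅ h ⁆) ─ S ∣} {∣ S ─ (S ∪ ⁅ h ⁆) ∣} ε>0
        (ℕP.+-mono-≤ (∣∣≤1 ((S ∪ ⁅ h ⁆) ─ S) h only) (∣∣≤0 (S ─ (S ∪ ⁅ h ⁆)) none)))))
    where
    only : ∀ x → lookup ((S ∪ ⁅ h ⁆) ─ S) x ≡ true → x ≡ h
    only x eq = [ (λ x∈S → ⊥-elim (true≢false x∈S (lookup-─ (S ∪ ⁅ h ⁆) S x eq))) , lookup-⁅⁆ {x = x} {y = h} ]′
      (lookup-∪ S ⁅ h ⁆ ([]=⇒lookup (SubsetP.p─q⊆p (S ∪ ⁅ h ⁆) S (lookup⇒∈ ((S ∪ ⁅ h ⁆) ─ S) eq))))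
    none : ∀ x → lookup (S ─ (S ∪ ⁅ h ⁆)) x ≡ true → ⊥
    none x eq = true≢false (lookup-∪ˡ S ⁅ h ⁆ ([]=⇒lookup (SubsetP.p─q⊆p S (S ∪ ⁅ h ⁆) (lookup⇒∈ (S ─ (S ∪ ⁅ h ⁆)) eq))))
                           (lookup-─ S (S ∪ ⁅ h ⁆) x eq)

  delete-move : ∀ {f g} → lookup S g ≡ true → g ≢ f → cost S ≤ cost (S ∖ f)
  delete-move {f} {g} g∈S g≢f = ≮⇒≥ (λ better → stuck (S ∖ f)
    (small (g , lookup⇒∈ (S ∖ f) (lookup-∖ S g∈S g≢f)) better
      (small-size {ε} {∣ (S ∖ f) ─ S ∣} {∣ S ─ (S ∖ f) ∣} ε>0
        (ℕP.+-mono-≤ (∣∣≤0 ((S ∖ f) ─ S) none) (∣∣≤1 (S ─ (S ∖ f)) f only)))))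
    where
    none : ∀ x → lookup ((S ∖ f) ─ S) x ≡ true → ⊥
    none x eq = true≢false (lookup-∖⁻ S ([]=⇒lookup (SubsetP.p─q⊆p (S ∖ f) S (lookup⇒∈ ((S ∖ f) ─ S) eq))))
                           (lookup-─ (S ∖ f) S x eq)
    only : ∀ x → lookup (S ─ (S ∖ f)) x ≡ true → x ≡ f
    only x eq = decidable-stable (x Fin.≟ f) (λ x≢f → true≢false
      (lookup-∖ S ([]=⇒lookup (SubsetP.p─q⊆p S (S ∖ f) (lookup⇒∈ (S ─ (S ∖ f)) eq))) x≢f) (lookup-─ S (S ∖ f) x eq))

  extend-move : ∀ {f h} → lookup S f ≡ true → lookup S h ≡ false → cost S ≤ cost (extendJMS cd o ((S ∖ f) ∪ ⁅ h ⁆))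
  extend-move {f} {h} f∈S h∉S = ≮⇒≥ (λ better → stuck (extendJMS cd o ((S ∖ f) ∪ ⁅ h ⁆))
    (extend f h (lookup⇒∈ S f∈S) (lookup⇒∉ S h∉S) refl better))

module LocalOptimum {nC nF : ℕ} {dist : Point nC nF → Point nC nF → ℚ} (metric : IsMetric dist)
  (o : Fin nF → ℚ) (o≥0 : ∀ f → 0ℚ ≤ o f) (ε : ℚ) (ε>0 : 0ℚ < ε) (S O : Subset nF)
  (stuck : ∀ S'' → ¬ LocalSearch.Move (cdist dist) o ε S S'')
  (σ' σ* : Fin nC → Fin nF) (closest' : UFL.Closest (cdist dist) o S σ') (closest* : UFL.Closest (cdist dist) o O σ*)
  (δ : ℚ) (½≤1-δ : ½ ≤ 1ℚ - δ) (j₀ : Fin nC) where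

  open Metric metric
  open UFL cd o
  open Capture cd o
  open LocalMoves cd o ε ε>0 S stuck

  near opt alt : Fin nC → ℚ
  near j = cd j (σ' j)
  opt j  = cd j (σ* j)
  alt j  = distTo (S ∖ σ' j) j

  inS inO : Fin nF → Bool
  inS = lookup S
  inO = lookup O

  cap : Fin nF → Fin nF → Bool
  cap f h = ⌊ captures? ½ σ' f σ* h ⌋

  matched : Fin nF → Bool
  matched h = ⌊ matchedOpt? δ σ' σ* h ⌋

  captures : ∀ {f h} → cap f h ≡ true → Captures ½ σ' f σ* h
  captures {f} {h} = ⌊⌋-true (captures? ½ σ' f σ* h)

  opt≥0 : ∀ j → 0ℚ ≤ opt j
  opt≥0 j = cd-nonneg j (σ* j)

  near≥0 : ∀ j → 0ℚ ≤ near j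
  near≥0 j = cd-nonneg j (σ' j)

  σ'∈S : ∀ j → inS (σ' j) ≡ true
  σ'∈S j = []=⇒lookup (proj₁ (closest' j))

  σ*∈O : ∀ j → inO (σ* j) ≡ true
  σ*∈O j = []=⇒lookup (proj₁ (closest* j))

  near-least : ∀ j {g} → inS g ≡ true → near j ≤ cd j g
  near-least j {g} g∈S = proj₂ (closest' j) g (lookup⇒∈ S g∈S)

  cap-unique : ∀ {f g h} → cap f h ≡ true → cap g h ≡ true → f ≡ g
  cap-unique {f} {g} {h} cf cg = ½-captor-unique {σ'} {f} {g} {σ*} {h} (captures cf) (captures cg)

  cap-client : ∀ {f h} → cap f h ≡ true → ∃ λ j → σ' j ≡ f × σ* j ≡ h
  cap-client {f} {h} cf = captured-client {σ'} {f} {σ*} {h} (captures cf)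

  cap-sole : ∀ {f} → (∀ i → σ' i ≡ f) → ∀ j → cap f (σ* j) ≡ true
  cap-sole {f} sole j = true⇒⌊⌋ (captures? ½ σ' f σ* (σ* j)) (sole-captures {σ'} {f} σ* j sole)

  open Charging o inS inO σ' σ* near opt alt cap matched o≥0 opt≥0 σ'∈S σ*∈O cap-unique cap-client cap-sole public

  mate-of : ∀ {h} → matched h ≡ true → MatchedOpt δ σ' σ* h
  mate-of {h} = ⌊⌋-true (matchedOpt? δ σ' σ* h)

  mate-captures : ∀ {f h} → Matched δ σ' σ* f h → Captures ½ σ' f σ* h
  mate-captures {f} {h} m = captures-weaken {1ℚ - δ} {½} {σ'} {f} {σ*} {h} ½≤1-δ (proj₁ m)

  -- The mate (1-δ)-captures `h`, hence ½-captures it, and ½-captors are unique.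
  captor-is-mate : ∀ {f h} → cap f h ≡ true → matched h ≡ true → Captures ½ σ* h σ' f
  captor-is-mate {f} {h} cf mh = let f₁ , m = mate-of mh in
    subst (Captures ½ σ* h σ') (½-captor-unique {σ'} {f₁} {f} {σ*} {h} (mate-captures m) (captures cf)) (proj₂ m)

  -- Uniqueness of captors with the two solutions exchanged: both facilities capture `f` in return.
  -- Hence one free facility per move is enough.
  matched-unique : ∀ {f h h'} → cap f h ≡ true → matched h ≡ true → cap f h' ≡ true → matched h' ≡ true → h ≡ h'
  matched-unique {f} {h} {h'} c m c' m' =
    ½-captor-unique {σ*} {h} {h'} {σ'} {f} (captor-is-mate c m) (captor-is-mate c' m')

  connCost-near : connCost S ≡ ∑ near
  connCost-near = ∑-cong {nC} (λ j → ≤-antisym (distTo-≤ cd o S j (σ'∈S j))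
    (let g , g∈S , eq = distTo-attained cd o S j (σ'∈S j) in subst (near j ≤_) (sym eq) (near-least j g∈S)))

  entry : ∀ h → 0ℚ ≤ enterCost h
  entry h = bool-elim (λ _ → 0ℚ ≤ enterCost h) (inS h)
    (λ h∈S → enterCost-open h (λ j eq → near-least j (subst (λ g → inS g ≡ true) (sym eq) h∈S)))
    (λ h∉S → enterCost-add h (distTo (S ∪ ⁅ h ⁆))
      (λ j → distTo-≤ cd o (S ∪ ⁅ h ⁆) j (lookup-∪ˡ S ⁅ h ⁆ (σ'∈S j)))
      (λ j eq → distTo-≤ cd o (S ∪ ⁅ h ⁆) j (subst (λ g → lookup (S ∪ ⁅ h ⁆) g ≡ true) (sym eq) (lookup-∪⁅⁆ S h)))
      (combine (openCost S) (∑ near) (openCost (S ∪ ⁅ h ⁆)) (connCost (S ∪ ⁅ h ⁆)) (o h)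
        (subst (λ n → openCost S + n ≤ cost (S ∪ ⁅ h ⁆)) connCost-near (add-move h∉S)) (openCost-∪⁅⁆ cd o o≥0 S h)))
    where
    combine : ∀ s n x c h → s + n ≤ x + c → x ≤ s + h → n ≤ h + c
    combine s n x c h h₁ h₂ = ≤-by-difference (+-mono-≤ h₁ h₂) (solve (s ∷ n ∷ x ∷ c ∷ h ∷ []) ℚ-ring)

  -- If `f` served all clients, it would capture the facility of `j` in `O`.
  other-facility : ∀ f j → cap f (σ* j) ≡ false → ∃ λ g → inS g ≡ true × g ≢ f
  other-facility f j uncap = [ (λ none → ⊥-elim (true≢false (cap-sole (only none) j) uncap)) , found ]′
    (argmin (λ i → not ⌊ σ' i Fin.≟ f ⌋) (λ _ → 0ℚ))
    where
    only : (∀ i → not ⌊ σ' i Fin.≟ f ⌋ ≡ false) → ∀ i → σ' i ≡ f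
    only none i = ⌊⌋-true (σ' i Fin.≟ f) (not-false (none i))
    found : (∃ λ i → not ⌊ σ' i Fin.≟ f ⌋ ≡ true × (∀ i → not ⌊ σ' i Fin.≟ f ⌋ ≡ true → 0ℚ ≤ 0ℚ)) → ∃ λ g → inS g ≡ true × g ≢ f
    found (i , eq , _) = σ' i , σ'∈S i , ⌊⌋-false (σ' i Fin.≟ f) (not-true eq)

  alt-attained : ∀ f j → σ' j ≡ f → cap f (σ* j) ≡ false → ∃ λ g → inS g ≡ true × g ≢ f × alt j ≡ cd j g
  alt-attained f j refl uncap =
    let g , g∈S , g≢f = other-facility f j uncap
        g′ , g′∈ , eq = distTo-attained cd o (S ∖ f) j (lookup-∖ S g∈S g≢f)
    in g′ , lookup-∖⁻ S g′∈ , lookup-∖-self S g′∈ , eq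

  Stay : Fin nF → (Fin nC → ℚ) → Set
  Stay f α = ∀ j → σ' j ≢ f → α j ≤ near j

  paid-open : ∀ f h (α : Fin nC → ℚ) x → cap f h ≡ true → Stay f α → (∀ j → σ* j ≡ h → α j ≤ opt j) → x ≤ o h →
    x + ∑ (λ j → when (serves h j) (α j - near j)) ≤ enterCost h
  paid-open f h α x cap-f stay α≤opt x≤ = +-mono-≤ x≤ (∑-mono (λ j → when-mono (serves h j) (λ sj → term j (⌊⌋-true (σ* j Fin.≟ h) sj))))
    where
    term : ∀ j → σ* j ≡ h → α j - near j ≤ enter j
    term j eq = ≤-enter j (α j) (α≤opt j eq) (λ uncap → stay j (λ eq′ →
      true≢false (subst₂ (λ f h → cap f h ≡ true) (sym eq′) (sym eq) cap-f) uncap))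

  -- For captured facilities that already belong to `S` there is nothing to open, so `q` vanishes.
  -- They survive the deletion because `f` is not one of them.
  closing-delete : ∀ f {g} → inS f ≡ true → inS g ≡ true → g ≢ f → cap f f ≡ false →
    (∀ h → cap f h ≡ true → inS h ≡ true) → Closing f
  closing-delete f {g} f∈S g∈S g≢f not-self captured-open = closing f α (λ _ → 0ℚ)
    (combine (openCost S) (∑ near) (openCost (S ∖ f)) (∑ α) (o f) (∑ {nF} (λ _ → 0ℚ))
      (subst (λ n → openCost S + n ≤ cost (S ∖ f)) connCost-near (delete-move g∈S g≢f)) (openCost-∖ cd o o≥0 S f∈S) (∑-0 nF))
    stay
    (λ j eq _ → ≤-reflexive (cong (λ f → distTo (S ∖ f) j) (sym eq)))
    (λ h cap-h → paid-open f h α 0ℚ cap-h stay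
      (λ j eq → distTo-≤ cd o (S ∖ f) j (subst (λ g → lookup (S ∖ f) g ≡ true) (sym eq)
        (lookup-∖ S (captured-open h cap-h) (λ h≡f → true≢false (subst (λ h → cap f h ≡ true) h≡f cap-h) not-self))))
      (o≥0 h))
    (λ _ _ → ≤-refl)
    where
    α : Fin nC → ℚ
    α = distTo (S ∖ f)
    stay : Stay f α
    stay j σ'j≢f = distTo-≤ cd o (S ∖ f) j (lookup-∖ S (σ'∈S j) σ'j≢f)
    combine : ∀ s n x c f z → s + n ≤ x + c → x + f ≤ s → z ≡ 0ℚ → f + n ≤ z + c
    combine s n x c f z h₁ h₂ refl = ≤-by-difference (+-mono-≤ h₁ h₂) (solve (s ∷ n ∷ x ∷ c ∷ f ∷ []) ℚ-ring)

  -- Facilities of `X` cost nothing in the modified run, so a dual is at most the distance to any of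
  -- them. This handles everything kept in `S`, together with `h'`. By the last hypothesis every
  -- other captured facility is lonely, and the factor 2 of `dual≤open` is the one built into
  -- `enter`.
  closing-extend : ∀ f {h'} → inS f ≡ true → inS h' ≡ false → cap f f ≡ false → cap f h' ≡ true →
    (∀ h → cap f h ≡ true → matched h ≡ true → h ≡ h' ⊎ inS h ≡ true) → Closing f
  closing-extend f {h'} f∈S h'∉S not-self cap-h' matched-open = closing f α q total stay move paid unpaid
    where
    X : Subset nF
    X = (S ∖ f) ∪ ⁅ h' ⁆
    oX : Fin nF → ℚ
    oX = extended o X
    module Run = JMSAnalysis cd oX cd-nonneg (extended-nonneg o o≥0 X) detour σ'
    α : Fin nC → ℚ
    α = Run.dual
    q : Fin nF → ℚ
    -- Only `h'` is paid for outside the duals. The kept part of `S` is free as well, and its cost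
    -- cancels against the cost of `S` up to `o f`.
    q h = when ⌊ h' Fin.≟ h ⌋ (o h)
    keep : ∀ {g} → inS g ≡ true → g ≢ f → lookup X g ≡ true
    keep g∈S g≢f = lookup-∪ˡ (S ∖ f) ⁅ h' ⁆ (lookup-∖ S g∈S g≢f)
    α≤ : ∀ j {g} → lookup X g ≡ true → α j ≤ cd j g
    α≤ j {g} g∈X = ≤-trans (Run.dual≤connect j g)
      (≤-reflexive (trans (cong (_+ cd j g) (extended-∈ o X g∈X)) (+-identityˡ (cd j g))))
    stay : Stay f α
    stay j σ'j≢f = α≤ j (keep (σ'∈S j) σ'j≢f)
    move : ∀ j → σ' j ≡ f → cap f (σ* j) ≡ false → α j ≤ alt j
    move j eq uncap = let g , g∈S , g≢f , alt≡ = alt-attained f j eq uncap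
                      in subst (α j ≤_) (sym alt≡) (α≤ j (keep g∈S g≢f))
    total : o f + ∑ near ≤ ∑ q + ∑ α
    total = subst (λ z → o f + ∑ near ≤ z + ∑ α) (sym (∑-point h' o))
      (combine (openCost S) (∑ near) (openCost S'') (connCost S'') (openCost X) (UFL.openCost cd oX S'')
        (openCost (S ∖ f)) (o f) (o h') (∑ α)
        (subst (λ n → openCost S + n ≤ cost S'') connCost-near (extend-move f∈S h'∉S))
        (openCost-extended cd o o≥0 X S'') Run.cost≤dual (openCost-∪⁅⁆ cd o o≥0 (S ∖ f) h') (openCost-∖ cd o o≥0 S f∈S))
      where
      S'' : Subset nF
      S'' = extendJMS cd o X
      combine : ∀ s n s″ c x x″ m f h a → s + n ≤ s″ + c → s″ ≤ x + x″ → x″ + c ≤ a → x ≤ m + h → m + f ≤ s → f + n ≤ h + a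
      combine s n s″ c x x″ m f h a h₁ h₂ h₃ h₄ h₅ =
        ≤-by-difference (+-mono-≤ (+-mono-≤ (+-mono-≤ h₁ h₂) (+-mono-≤ h₃ h₄)) h₅)
          (solve (s ∷ n ∷ s″ ∷ c ∷ x ∷ x″ ∷ m ∷ f ∷ h ∷ a ∷ []) ℚ-ring)
    paid-∈X : ∀ h → cap f h ≡ true → lookup X h ≡ true → q h + ∑ (λ j → when (serves h j) (α j - near j)) ≤ enterCost h
    paid-∈X h cap-h h∈X = paid-open f h α (q h) cap-h stay
      (λ j eq → α≤ j (subst (λ g → lookup X g ≡ true) (sym eq) h∈X)) (when-≤ ⌊ h' Fin.≟ h ⌋ (o≥0 h))
    paid-lonely : ∀ h → h' ≢ h → matched h ≡ false → q h + ∑ (λ j → when (serves h j) (α j - near j)) ≤ enterCost h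
    paid-lonely h h'≢h lonely = combine (q h) (∑ (λ j → when (serves h j) (α j - near j))) (o h)
      (∑ (λ j → when (serves h j) (enter j))) (∑ (λ j → when (serves h j) (α j))) (∑ (λ j → when (serves h j) (near j)))
      (oX h) (∑ (λ j → when (serves h j) (opt j)))
      (cong (λ b → when b (o h)) (false⇒⌊⌋ (h' Fin.≟ h) h'≢h))
      (∑-when-- (serves h) α near)
      (subst (λ c → ∑ (λ j → when (serves h j) (α j)) ≤ oX h + (c + c)) cd-opt (Run.dual≤open h (serves h)))
      (extended-≤ o o≥0 X h) enter-sum
      where
      cd-opt : ∑ (λ j → when (serves h j) (cd j h)) ≡ ∑ (λ j → when (serves h j) (opt j))
      cd-opt = ∑-cong {nC} (λ j → dec-elim (λ b → when b (cd j h) ≡ when b (opt j)) (σ* j Fin.≟ h)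
        (λ eq → cong (cd j) (sym eq)) (λ _ → refl))
      enter-sum : ∑ (λ j → when (serves h j) (enter j))
                  ≡ (∑ (λ j → when (serves h j) (opt j)) + ∑ (λ j → when (serves h j) (opt j))) - ∑ (λ j → when (serves h j) (near j))
      enter-sum = begin
        ∑ (λ j → when (serves h j) (enter j))
          ≡⟨ ∑-cong {nC} (λ j → dec-elim (λ b → when b (enter j) ≡ when b ((opt j + opt j) - near j)) (σ* j Fin.≟ h)
               (λ eq → enter-lonely j (trans (cong matched eq) lonely)) (λ _ → refl)) ⟩
        ∑ (λ j → when (serves h j) ((opt j + opt j) - near j))
          ≡⟨ ∑-when-- (serves h) (λ j → opt j + opt j) near ⟩
        ∑ (λ j → when (serves h j) (opt j + opt j)) - ∑ (λ j → when (serves h j) (near j))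
          ≡⟨ cong (_- ∑ (λ j → when (serves h j) (near j))) (trans (∑-cong {nC} (λ j → when-+ (serves h j) (opt j) (opt j)))
               (∑-+ (λ j → when (serves h j) (opt j)) (λ j → when (serves h j) (opt j)))) ⟩
        (∑ (λ j → when (serves h j) (opt j)) + ∑ (λ j → when (serves h j) (opt j))) - ∑ (λ j → when (serves h j) (near j)) ∎
        where open ≡-Reasoning
      combine : ∀ q d h e a n x c → q ≡ 0ℚ → d ≡ a - n → a ≤ x + (c + c) → x ≤ h → e ≡ (c + c) - n → q + d ≤ h + e
      combine q d h e a n x c refl refl h₁ h₂ refl = ≤-by-difference (+-mono-≤ h₁ h₂) (solve (h ∷ a ∷ n ∷ x ∷ c ∷ []) ℚ-ring)
    paid : ∀ h → cap f h ≡ true → q h + ∑ (λ j → when (serves h j) (α j - near j)) ≤ enterCost h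
    paid h cap-h = dec-elim (λ _ → q h + ∑ (λ j → when (serves h j) (α j - near j)) ≤ enterCost h) (h' Fin.≟ h)
      (λ h'≡h → paid-∈X h cap-h (subst (λ g → lookup X g ≡ true) h'≡h (lookup-∪⁅⁆ (S ∖ f) h')))
      (λ h'≢h → bool-elim (λ _ → q h + ∑ (λ j → when (serves h j) (α j - near j)) ≤ enterCost h) (matched h)
        (λ is-matched → [ (λ h≡h' → ⊥-elim (h'≢h (sym h≡h')))
                        , (λ h∈S → paid-∈X h cap-h (keep h∈S (λ h≡f →
                             true≢false (subst (λ h → cap f h ≡ true) h≡f cap-h) not-self))) ]′ (matched-open h cap-h is-matched))
        (paid-lonely h h'≢h))
    unpaid : ∀ h → cap f h ≡ false → q h ≤ 0ℚ
    unpaid h uncap = ≤-reflexive (cong (λ b → when b (o h)) (false⇒⌊⌋ (h' Fin.≟ h)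
      (λ h'≡h → true≢false (subst (λ h → cap f h ≡ true) h'≡h cap-h') uncap)))

  -- The free facility is chosen by priority: a matched captured one outside `S`, otherwise any
  -- captured one outside `S`. If every captured facility lies in `S`, no such exchange is available
  -- and `f` is deleted.
  closing-all : ∀ f → inS f ≡ true → Closing f
  closing-all f f∈S = bool-elim (λ _ → Closing f) (cap f f) self (λ not-self →
    [ no-matched not-self , swap-matched not-self ]′ (argmin (λ h → (cap f h ∧ matched h) ∧ not (inS h)) (λ _ → 0ℚ)))
    where
    self : cap f f ≡ true → Closing f
    self cap-f = closing-self f cap-f entry
      (λ j eq → near-least j (subst (λ g → inS g ≡ true) (sym eq) f∈S))
      (λ j eq uncap → let g , g∈S , _ , alt≡ = alt-attained f j eq uncap
                      in subst (near j ≤_) (sym alt≡) (near-least j g∈S))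
    swap-matched : cap f f ≡ false →
      (∃ λ h → (cap f h ∧ matched h) ∧ not (inS h) ≡ true × (∀ g → (cap f g ∧ matched g) ∧ not (inS g) ≡ true → 0ℚ ≤ 0ℚ)) → Closing f
    swap-matched not-self (h' , eq , _) =
      let cap-matched , h'∉S = ∧-true (cap f h' ∧ matched h') eq
          cap-h' , matched-h' = ∧-true (cap f h') cap-matched
      in closing-extend f f∈S (not-true h'∉S) not-self cap-h'
           (λ h cap-h matched-h → inj₁ (matched-unique cap-h matched-h cap-h' matched-h'))
    no-matched : cap f f ≡ false → (∀ h → (cap f h ∧ matched h) ∧ not (inS h) ≡ false) → Closing f
    no-matched not-self none = [ no-captured , swap-captured ]′ (argmin (λ h → cap f h ∧ not (inS h)) (λ _ → 0ℚ))
      where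
      swap-captured : (∃ λ h → cap f h ∧ not (inS h) ≡ true × (∀ g → cap f g ∧ not (inS g) ≡ true → 0ℚ ≤ 0ℚ)) → Closing f
      swap-captured (h' , eq , _) =
        let cap-h' , h'∉S = ∧-true (cap f h') eq
        in closing-extend f f∈S (not-true h'∉S) not-self cap-h' (λ h cap-h matched-h →
             inj₂ (not-false (trans (cong (_∧ not (inS h)) (sym (cong₂ _∧_ cap-h matched-h))) (none h))))
      no-captured : (∀ h → cap f h ∧ not (inS h) ≡ false) → Closing f
      no-captured none′ = [ sole , delete ]′ (argmin (λ g → inS g ∧ not ⌊ f Fin.≟ g ⌋) (λ _ → 0ℚ))
        where
        captured-open : ∀ h → cap f h ≡ true → inS h ≡ true
        captured-open h cap-h = not-false (trans (cong (_∧ not (inS h)) (sym cap-h)) (none′ h))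
        delete : (∃ λ g → inS g ∧ not ⌊ f Fin.≟ g ⌋ ≡ true × (∀ g → inS g ∧ not ⌊ f Fin.≟ g ⌋ ≡ true → 0ℚ ≤ 0ℚ)) → Closing f
        delete (g , eq , _) = let g∈S , ≢f = ∧-true (inS g) eq
          in closing-delete f f∈S g∈S (λ g≡f → ⌊⌋-false (f Fin.≟ g) (not-true ≢f) (sym g≡f)) not-self captured-open
        -- If `f` were all of `S`, it would capture the facility of the client `j₀` in `O`. That
        -- facility lies in `S`, so it would be `f` itself, against `not-self`.
        sole : (∀ g → inS g ∧ not ⌊ f Fin.≟ g ⌋ ≡ false) → Closing f
        sole alone = ⊥-elim (true≢false (subst (λ h → cap f h ≡ true) (sym (only (captured-open (σ* j₀) captured))) captured) not-self)
          where
          only : ∀ {g} → inS g ≡ true → f ≡ g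
          only {g} g∈S = ⌊⌋-true (f Fin.≟ g) (not-false (trans (cong (_∧ not ⌊ f Fin.≟ g ⌋) (sym g∈S)) (alone g)))
          captured : cap f (σ* j₀) ≡ true
          captured = cap-sole (λ i → sym (only (σ'∈S i))) j₀

  module _ (κ : ℚ) (κ≥0 : 0ℚ ≤ κ) (κ-scale : (1ℚ + κ) * (1ℚ - δ) ≡ 1ℚ) where

    private
      alt≤ : ∀ j g → inS g ≡ true → g ≢ σ' j → alt j ≤ opt j + dF (σ* j) g
      alt≤ j g g∈S g≢ = ≤-trans (distTo-≤ cd o (S ∖ σ' j) j (lookup-∖ S g∈S g≢)) (cd-via j (σ* j) g)

      near≤ : ∀ j g → inS g ≡ true → near j ≤ opt j + dF (σ* j) g
      near≤ j g g∈S = ≤-trans (near-least j g∈S) (cd-via j (σ* j) g)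

      uncaptured-half : ∀ g h → cap g h ≡ false → common σ' g σ* h + common σ' g σ* h ≤ served σ* h
      uncaptured-half g h uncap = subst (common σ' g σ* h + common σ' g σ* h ≤_) (halves (served σ* h)) (+-mono-≤ half half)
        where
        half : common σ' g σ* h ≤ ½ * served σ* h
        half = ≮⇒≥ (λ lt → ⌊⌋-false (captures? ½ σ' g σ* h) uncap (captures⁺ {½} {σ'} {g} {σ*} {h} lt))

      -- The strict capture inequality is multiplied by `1 + κ`, the inverse of `1 - δ`.
      mate : ∀ h → matched h ≡ true →
        ∃ λ f → cap f h ≡ true × inS f ≡ true × served σ* h ≤ (1ℚ + κ) * common σ' f σ* h
      mate h is-matched =
        let f , m = mate-of is-matched
            j , σ'j , _ = captured-client {σ'} {f} {σ*} {h} (mate-captures m)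
        in f , true⇒⌊⌋ (captures? ½ σ' f σ* h) (mate-captures m) , subst (λ g → inS g ≡ true) σ'j (σ'∈S j)
             , most f (captures⁻ {1ℚ - δ} {σ'} {f} {σ*} {h} (proj₁ m))
        where
        most : ∀ f → (1ℚ - δ) * served σ* h < common σ' f σ* h → served σ* h ≤ (1ℚ + κ) * common σ' f σ* h
        most f lt = begin
          served σ* h                          ≡⟨ sym (*-identityˡ (served σ* h)) ⟩
          1ℚ * served σ* h                     ≡⟨ cong (_* served σ* h) (sym κ-scale) ⟩
          (1ℚ + κ) * (1ℚ - δ) * served σ* h    ≡⟨ *-assoc (1ℚ + κ) (1ℚ - δ) (served σ* h) ⟩
          (1ℚ + κ) * ((1ℚ - δ) * served σ* h)  ≤⟨ *-monoˡ-≤-nonNeg (1ℚ + κ) {{nonNegative (+-mono-≤ (nonNegative⁻¹ 1ℚ) κ≥0)}} (<⇒≤ lt) ⟩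
          (1ℚ + κ) * common σ' f σ* h          ∎
          where open ≤-Reasoning

      dF≥0 : ∀ h g → 0ℚ ≤ dF h g
      dF≥0 h g = IsMetric.nonneg metric (inj₂ h) (inj₂ g)

      dF≤ : ∀ j → dF (σ* j) (σ' j) ≤ opt j + near j
      dF≤ j = dF-via j (σ* j) (σ' j)

    open Rerouting dF κ near≥0 dF≥0 κ≥0 alt≤ near≤ dF≤ uncaptured-half mate

    cost-bound : openCost S + connCost S ≤
      openCost O + κ * connCost S + (1ℚ + κ) * optM δ σ' σ* + ((1ℚ + 1ℚ) + (1ℚ + 1ℚ)) * optL δ σ' σ*
    cost-bound = combine (openCost S) (connCost S) (openCost O) κ (∑ near) (∑ charge) (∑ bound) (optM δ σ' σ*) (optL δ σ' σ*)
      (subst₂ (λ s t → s ≤ t + ∑ charge) (sym (openCost-∑ cd o S)) (sym (openCost-∑ cd o O)) (closing-total entry closing-all))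
      charge-total connCost-near total
      where
      M L : Fin nC → ℚ
      M j = if matched (σ* j) then opt j else 0ℚ
      L j = if matched (σ* j) then 0ℚ else opt j
      matched-case : ∀ k p n → ((p - n) + k * (p + n)) + n ≤ k * n + ((1ℚ + k) * p + ((1ℚ + 1ℚ) + (1ℚ + 1ℚ)) * 0ℚ)
      matched-case k p n = ≤-reflexive (solve (k ∷ p ∷ n ∷ []) ℚ-ring)
      lonely-case : ∀ k p n → 0ℚ ≤ k * n → (((p + p) - n) + (p + p)) + n ≤ k * n + ((1ℚ + k) * 0ℚ + ((1ℚ + 1ℚ) + (1ℚ + 1ℚ)) * p)
      lonely-case k p n h = ≤-by-difference h (solve (k ∷ p ∷ n ∷ []) ℚ-ring)
      term : ∀ j → bound j + near j ≤ κ * near j + ((1ℚ + κ) * M j + ((1ℚ + 1ℚ) + (1ℚ + 1ℚ)) * L j)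
      term j = bool-elim (λ m → (if m then matchedBound j else lonelyBound j) + near j ≤
          κ * near j + ((1ℚ + κ) * (if m then opt j else 0ℚ) + ((1ℚ + 1ℚ) + (1ℚ + 1ℚ)) * (if m then 0ℚ else opt j)))
        (matched (σ* j))
        (λ _ → matched-case κ (opt j) (near j))
        (λ _ → lonely-case κ (opt j) (near j)
          (subst (_≤ κ * near j) (*-zeroʳ κ) (*-monoˡ-≤-nonNeg κ {{nonNegative κ≥0}} (near≥0 j))))
      total : ∑ bound + ∑ near ≤ κ * ∑ near + ((1ℚ + κ) * ∑ M + ((1ℚ + 1ℚ) + (1ℚ + 1ℚ)) * ∑ L)
      total = subst₂ _≤_ (∑-+ bound near)
        (trans (∑-+ (λ j → κ * near j) (λ j → (1ℚ + κ) * M j + ((1ℚ + 1ℚ) + (1ℚ + 1ℚ)) * L j))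
          (cong₂ _+_ (∑-* κ near) (trans (∑-+ (λ j → (1ℚ + κ) * M j) (λ j → ((1ℚ + 1ℚ) + (1ℚ + 1ℚ)) * L j))
            (cong₂ _+_ (∑-* (1ℚ + κ) M) (∑-* ((1ℚ + 1ℚ) + (1ℚ + 1ℚ)) L)))))
        (∑-mono term)
      combine : ∀ s d t k n c b m l → s ≤ t + c → c ≤ b → d ≡ n →
        b + n ≤ k * n + ((1ℚ + k) * m + ((1ℚ + 1ℚ) + (1ℚ + 1ℚ)) * l) →
        s + d ≤ t + k * d + (1ℚ + k) * m + ((1ℚ + 1ℚ) + (1ℚ + 1ℚ)) * l
      combine s d t k n c b m l h₁ h₂ refl h₃ = ≤-by-difference (+-mono-≤ (+-mono-≤ h₁ h₂) h₃)
        (solve (s ∷ d ∷ t ∷ k ∷ c ∷ b ∷ m ∷ l ∷ []) ℚ-ring)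

-- Every move improves the cost. This settles instances without clients, where the empty sum of
-- duals shows that the JMS solution at the start costs nothing.
reachable-cost : ∀ {nC nF : ℕ} {cd : Fin nC → Fin nF → ℚ} {o : Fin nF → ℚ} {ε S} →
  LocalSearch.Reachable cd o ε S → UFL.cost cd o S ≤ UFL.cost cd o (jms cd o)
reachable-cost LocalSearch.start = ≤-refl
reachable-cost (LocalSearch.move r (LocalSearch.small _ better _)) = ≤-trans (<⇒≤ better) (reachable-cost r)
reachable-cost (LocalSearch.move r (LocalSearch.extend _ _ _ _ _ better)) = ≤-trans (<⇒≤ better) (reachable-cost r)

-- The constants δ/(1-δ) and 1/(1-δ)

module _ {δ : ℚ} (δ≥0 : 0ℚ ≤ δ) (½≤1-δ : ½ ≤ 1ℚ - δ) where

  private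
    κ : ℚ
    κ = divQ δ (1ℚ - δ)

    1-δ>0 : 0ℚ < 1ℚ - δ
    1-δ>0 = <-≤-trans (positive⁻¹ ½) ½≤1-δ

    1-δ≢0 : 1ℚ - δ ≢ 0ℚ
    1-δ≢0 eq = <-irrefl (sym eq) 1-δ>0

  κ-nonneg : 0ℚ ≤ divQ δ (1ℚ - δ)
  κ-nonneg = *-cancelˡ-≤-pos (1ℚ - δ) {{positive 1-δ>0}}
    (subst₂ _≤_ (sym (*-zeroʳ (1ℚ - δ))) (sym (*-divQ δ 1-δ≢0)) δ≥0)

  κ-scale : (1ℚ + divQ δ (1ℚ - δ)) * (1ℚ - δ) ≡ 1ℚ
  κ-scale = trans (expand κ (1ℚ - δ)) (trans (cong ((1ℚ - δ) +_) (*-divQ δ 1-δ≢0)) (cancel δ))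
    where
    expand : ∀ k x → (1ℚ + k) * x ≡ x + x * k
    expand k x = solve (k ∷ x ∷ []) ℚ-ring
    cancel : ∀ x → (1ℚ - x) + x ≡ 1ℚ
    cancel x = solve (x ∷ []) ℚ-ring

  divQ-1 : 1ℚ + divQ δ (1ℚ - δ) ≡ divQ 1ℚ (1ℚ - δ)
  divQ-1 = begin
    1ℚ + κ                                       ≡⟨ sym (*-identityʳ (1ℚ + κ)) ⟩
    (1ℚ + κ) * 1ℚ                                ≡⟨ cong ((1ℚ + κ) *_) (sym (*-divQ 1ℚ 1-δ≢0)) ⟩
    (1ℚ + κ) * ((1ℚ - δ) * divQ 1ℚ (1ℚ - δ))     ≡⟨ sym (*-assoc (1ℚ + κ) (1ℚ - δ) (divQ 1ℚ (1ℚ - δ))) ⟩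
    (1ℚ + κ) * (1ℚ - δ) * divQ 1ℚ (1ℚ - δ)       ≡⟨ cong (_* divQ 1ℚ (1ℚ - δ)) κ-scale ⟩
    1ℚ * divQ 1ℚ (1ℚ - δ)                        ≡⟨ *-identityˡ (divQ 1ℚ (1ℚ - δ)) ⟩
    divQ 1ℚ (1ℚ - δ)                             ∎
    where open ≡-Reasoning

returned-bound : ∀ {δ ε} → 0ℚ < δ → δ ≤ ½ → 0ℚ < ε →
  ∀ nC {nF} {dist : Point nC nF → Point nC nF → ℚ} (o : Fin nF → ℚ) → IsMetric dist → (∀ f → 0ℚ ≤ o f) →
  ∀ S O σ' σ* → LocalSearch.Returned (cdist dist) o ε S →
  UFL.Closest (cdist dist) o S σ' → UFL.Closest (cdist dist) o O σ* →
  UFL.cost (cdist dist) o S ≤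
    UFL.openCost (cdist dist) o O + divQ δ (1ℚ - δ) * UFL.connCost (cdist dist) o S
    + (1ℚ + divQ δ (1ℚ - δ)) * UFL.optM (cdist dist) o δ σ' σ*
    + ((1ℚ + 1ℚ) + (1ℚ + 1ℚ)) * UFL.optL (cdist dist) o δ σ' σ*
-- Without clients S' may consist of a single facility, which cannot be deleted.
returned-bound {δ} _ _ _ zero {dist = dist} o metric o≥0 S O σ' σ* (reachable , _) _ _ =
  ≤-trans (reachable-cost reachable)
    (≤-trans (JMSAnalysis.cost≤dual cd o cd-nonneg o≥0 detour σ')
      (combine (UFL.openCost cd o O) (divQ δ (1ℚ - δ)) (openCost-nonneg cd o o≥0 O)))
  where
  open Metric metric
  combine : ∀ x k → 0ℚ ≤ x → 0ℚ ≤ x + k * 0ℚ + (1ℚ + k) * 0ℚ + ((1ℚ + 1ℚ) + (1ℚ + 1ℚ)) * 0ℚ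
  combine x k h = ≤-by-difference h (solve (x ∷ k ∷ []) ℚ-ring)
returned-bound {δ} {ε} δ>0 δ≤½ ε>0 (suc nC) o metric o≥0 S O σ' σ* (_ , stuck) closest' closest* =
  LocalOptimum.cost-bound metric o o≥0 ε ε>0 S O stuck σ' σ* closest' closest* δ ½≤1-δ Fin.zero
    (divQ δ (1ℚ - δ)) (κ-nonneg (<⇒≤ δ>0) ½≤1-δ) (κ-scale (<⇒≤ δ>0) ½≤1-δ)
  where
  ½≤1-δ : ½ ≤ 1ℚ - δ
  ½≤1-δ = +-monoʳ-≤ 1ℚ (neg-antimono-≤ δ≤½)

open import Data.Integer using (+_)

theoremG3 : Σ ℚ λ c →
  ∀ (δ ε : ℚ) → 0ℚ < δ → δ ≤ + 1 / 2 → 0ℚ < ε →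
  ∀ (nC nF : ℕ) (dist : Point nC nF → Point nC nF → ℚ) (o : Fin nF → ℚ) →
  IsMetric dist → (∀ f → 0ℚ ≤ o f) →
  ∀ (S' OPT : Subset nF) (σ' σ* : Fin nC → Fin nF) →
  LocalSearch.Returned (cdist dist) o ε S' →
  Nonempty OPT →
  UFL.Closest (cdist dist) o S' σ' →
  UFL.Closest (cdist dist) o OPT σ* →
  UFL.openCost (cdist dist) o S' + UFL.connCost (cdist dist) o S'
    ≤ UFL.openCost (cdist dist) o OPT
      + divQ δ (1ℚ - δ) * UFL.connCost (cdist dist) o S'
      + divQ 1ℚ (1ℚ - δ) * UFL.optM (cdist dist) o δ σ' σ*
      + (+ 4 / 1) * UFL.optL (cdist dist) o δ σ' σ*
      + c * (ε * (UFL.connCost (cdist dist) o S' + UFL.connCost (cdist dist) o OPT))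
theoremG3 = 0ℚ , λ δ ε δ>0 δ≤½ ε>0 nC nF dist o metric o≥0 S' OPT σ' σ* returned _ closest' closest* →
  let open UFL (cdist dist) o
      κ   = divQ δ (1ℚ - δ)
      D   = connCost S' + connCost OPT
      rhs = λ l → openCost OPT + κ * connCost S' + l * optM δ σ' σ* + (+ 4 / 1) * optL δ σ' σ*
  in ≤-trans (returned-bound δ>0 δ≤½ ε>0 nC o metric o≥0 S' OPT σ' σ* returned closest' closest*)
    (≤-reflexive (trans (cong rhs (divQ-1 (<⇒≤ δ>0) (+-monoʳ-≤ 1ℚ (neg-antimono-≤ δ≤½))))
      (trans (sym (+-identityʳ (rhs (divQ 1ℚ (1ℚ - δ)))))
        (cong (λ z → rhs (divQ 1ℚ (1ℚ - δ)) + z) (sym (*-zeroˡ (ε * D)))))))
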